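{- Let $n,v,k$ be positive integers with $v\ge 2$ and $k\le v$, put $w=e^{2\pi\sqrt{ -1}/n}$, and let $\lambda=\frac{k(k-1)}{v-1}$. Suppose there is a commutative association scheme whose adjacency matrices and primitive idempotents can be labelled so that its first and second eigenmatrices $P,Q$ are as follows, where $i$ runs over $\{0,\dots,n-1\}$ and $j$ over $\{1,\dots,n-1\}$, and $A_{0,0}$ is the identity relation. Case 1, $k=v$: the adjacency matrices are $A_{0,i},A_1,A_{2,i}$, the primitive idempotents are $E_0,E_1,E_2,E_{3,j},E_{4,j}$, and $$P=\begin{array}{c|ccc} & A_{0,i} & A_1 & A_{2,i} \\ \hline E_0 & 1 & n(v-1) & k \\ E_1 & 1 & n(v-1) & -k \\ E_2 & 1 & -n & 0 \\ E_{3,j} & w^{ -ij} & 0 & \sqrt{k}\,w^{ -ij} \\ E_{4,j} & w^{ -ij} & 0 & -\sqrt{k}\,w^{ -ij} \end{array}$$ $$Q=\begin{array}{c|ccccc} & E_0 & E_1 & E_2 & E_{3,j} & E_{4,j} \\ \hline A_{0,i} & 1 & 1 & 2(v-1) & v w^{ij} & v w^{ij} \\ A_1 & 1 & 1 & -2 & 0 & 0 \\ A_{2,i} & 1 & -1 & 0 & \frac{v}{\sqrt{k}}w^{ij} & -\frac{v}{\sqrt{k}}w^{ij} \end{array}$$ Case 2, $k<v$: the adjacency matrices are $A_{0,i},A_1,A_{2,i},A_3$, the primitive idempotents are $E_0,E_1,E_{2,1},E_{2,2},E_{3,j},E_{4,j}$, and $$P=\begin{array}{c|cccc} & A_{0,i}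 & A_1 & A_{2,i} & A_3 \\ \hline E_0 & 1 & n(v-1) & k & n(v-k) \\ E_1 & 1 & n(v-1) & -k & -n(v-k) \\ E_{2,1} & 1 & -n & \sqrt{\frac{k(v-k)}{v-1}} & -n\sqrt{\frac{k(v-k)}{v-1}} \\ E_{2,2} & 1 & -n & -\sqrt{\frac{k(v-k)}{v-1}} & n\sqrt{\frac{k(v-k)}{v-1}} \\ E_{3,j} & w^{ -ij} & 0 & \sqrt{k}\,w^{ -ij} & 0 \\ E_{4,j} & w^{ -ij} & 0 & -\sqrt{k}\,w^{ -ij} & 0 \end{array}$$ $$Q=\begin{array}{c|cccccc} & E_0 & E_1 & E_{2,1} & E_{2,2} & E_{3,j} & E_{4,j} \\ \hline A_{0,i} & 1 & 1 & v-1 & v-1 & v w^{ij} & v w^{ij} \\ A_1 & 1 & 1 & -1 & -1 & 0 & 0 \\ A_{2,i} & 1 & -1 & \sqrt{\frac{(v-1)(v-k)}{k}} & -\sqrt{\frac{(v-1)(v-k)}{k}} & \frac{v}{\sqrt{k}}w^{ij} & -\frac{v}{\sqrt{k}}w^{ij} \\ A_3 & 1 & -1 & -\sqrt{\frac{(v-1)k}{v-k}} & \sqrt{\frac{(v-1)k}{v-k}} & 0 & 0 \end{array}$$ Then, in either case, there exists a balanced generalized weighing matrix $BGW(v,k,\lambda)$ over $\mathbb{Z}_n$.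
   Context: Balanced generalized weighing matrices. Let $\mathbb{Z}_n$ be the additive cyclic group of order $n$. A $BGW(v,k,\lambda)$ over $\mathbb{Z}_n$ is a $v\times v$ matrix $W=(w_{ij})$ with entries in $\mathbb{Z}_n\cup\{0\}$, where $0$ is a formal zero symbol different from the identity element $\bar 0$ of $\mathbb{Z}_n$, such that each row has exactly $k$ nonzero entries (entries in $\mathbb{Z}_n$) and, for any distinct rows $i,j$, the multiset $\{w_{i\ell}-w_{j\ell}\mid w_{i\ell},w_{j\ell}\in\mathbb{Z}_n\}$ contains every element of $\mathbb{Z}_n$ exactly $\lambda/n$ times. Association schemes. A commutative association scheme with $d$ classes on a finite set $X$ is a collection of nonzero $(0,1)$-matrices $A_0,A_1,\dots,A_d$ (the adjacency matrices) indexed by $X$ such that: $A_0=I_{|X|}$; $\sum_{i=0}^d A_i=J_{|X|}$ (the all-ones matrix); $A_i^t\in\{A_1,\dots,A_d\}$ for every $i\in\{1,\dots,d\}$; every product $A_iA_j$ is a linear combination of $A_0,\dots,A_d$; and $A_iA_j=A_jA_i$ for all $i,j$. The complex span of the $A_i$ is a commutative algebra (the Bose-Mesner algebra), which has a unique basis of primitive idempotents $E_0=\frac{1}{|X|}J_{|X|},E_1,\dots,E_d$. The first eigenmatrix $P=(p_{ij})$ and the second eigenmatrix $Q=(q_{ij})$ are defined by $A_j=\sum_{i} p_{ij}E_i$ and $E_j=\frac{1}{|X|}\sum_{i} q_{ij}A_i$; thus rows of $P$ are indexed by idempotents and columns by adjacency matrices, and vice versa for $Q$. -}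

module Defs where

-- The standard library has no real numbers.  ℝ consists of Cauchy sequences of
-- rationals, compared by the equivalence relation _≈ʳ_; √, π, cos and sin are
-- explicit such sequences, accompanied by the proofs that they are Cauchy.
module Reals where

  open import Data.Nat.Base as ℕ using (ℕ; zero; suc)
  import Data.Nat.Properties as ℕ
  import Data.Nat.DivMod as ℕ
  import Data.Nat.Solver as ℕSolver
  open import Data.Integer.Base as ℤ using (ℤ; +_)
  import Data.Integer.Properties as ℤ
  open import Data.Rational.Base as ℚ
    using (ℚ; 0ℚ; 1ℚ; ½; _+_; _*_; _-_; -_; _≤_; _<_; ∣_∣; _⊔_; _/_)
  open import Data.Rational.Properties
  import Data.Rational.Unnormalised.Base as ℚᵘ
  import Data.Rational.Unnormalised.Properties as ℚᵘ
  open import Data.Rational.Solver using (module +-*-Solver)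
  open import Data.Product.Base using (∃-syntax; Σ-syntax; _×_; _,_; proj₁; proj₂)
  open import Data.Sum.Base using (inj₁; inj₂)
  open import Relation.Nullary using (yes; no)
  open import Relation.Binary.PropositionalEquality
  open import Algebra.Definitions.RawSemiring ℚ.+-*-rawSemiring using (_^_)

  open +-*-Solver using (solve; _:+_; _:*_; _:-_; :-_; _:=_; con)

  IsCauchy : (ℕ → ℚ) → Set
  IsCauchy s = ∀ ε → 0ℚ < ε → ∃[ N ] ∀ m n → N ℕ.≤ m → N ℕ.≤ n → ∣ s m - s n ∣ < ε

  record ℝ : Set where
    constructor _,_
    field
      seq    : ℕ → ℚ
      cauchy : IsCauchy seq
  open ℝ public

  infix 4 _≈ʳ_
  _≈ʳ_ : ℝ → ℝ → Set
  x ≈ʳ y = ∀ ε → 0ℚ < ε → ∃[ N ] ∀ n → N ℕ.≤ n → ∣ seq x n - seq y n ∣ < ε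

  fromℕ : ℕ → ℚ
  fromℕ n = + n / 1

  1/suc : ℕ → ℚ
  1/suc n = + 1 / suc n

  1/suc-pos : ∀ n → 0ℚ < 1/suc n
  1/suc-pos n = positive⁻¹ (1/suc n) {{normalize-pos 1 (suc n)}}

  fromℕ-≥0 : ∀ n → 0ℚ ≤ fromℕ n
  fromℕ-≥0 n = nonNegative⁻¹ (fromℕ n) {{normalize-nonNeg n 1}}

  toℚᵘ-/ : ∀ i d .{{_ : ℕ.NonZero d}} → ℚ.toℚᵘ (i / d) ℚᵘ.≃ (i ℚᵘ./ d)
  toℚᵘ-/ i (suc d) = toℚᵘ-fromℚᵘ (ℚᵘ.mkℚᵘ i d)

  /-mono : ∀ i j c d .{{_ : ℕ.NonZero c}} .{{_ : ℕ.NonZero d}} →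
           i ℤ.* + d ℤ.≤ j ℤ.* + c → i / c ≤ j / d
  /-mono i j (suc c) (suc d) h = toℚᵘ-cancel-≤ (ℚᵘ.≤-respˡ-≃ (ℚᵘ.≃-sym (toℚᵘ-/ i (suc c)))
     (ℚᵘ.≤-respʳ-≃ (ℚᵘ.≃-sym (toℚᵘ-/ j (suc d))) (ℚᵘ.*≤* h)))

  1/suc-inverse : ∀ n → fromℕ (suc n) * 1/suc n ≡ 1ℚ
  1/suc-inverse n = toℚᵘ-injective (begin
      ℚ.toℚᵘ (fromℕ (suc n) * 1/suc n)                ≈⟨ toℚᵘ-homo-* (fromℕ (suc n)) (1/suc n) ⟩
      ℚ.toℚᵘ (fromℕ (suc n)) ℚᵘ.* ℚ.toℚᵘ (1/suc n)    ≈⟨ ℚᵘ.*-cong (toℚᵘ-/ (+ suc n) 1) (toℚᵘ-/ (+ 1) (suc n)) ⟩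
      ℚᵘ.mkℚᵘ (+ suc n) 0 ℚᵘ.* ℚᵘ.mkℚᵘ (+ 1) n        ≈⟨ ℚᵘ.*≡* (trans (ℤ.*-identityʳ _) (trans (ℤ.*-identityʳ _) (sym (trans (ℤ.*-identityˡ _) (cong (λ z → + suc z) (ℕ.+-identityʳ n)))))) ⟩
      ℚᵘ.1ℚᵘ ∎)
    where open ℚᵘ.≃-Reasoning

  fromℕ-mono : ∀ {m n} → m ℕ.≤ n → fromℕ m ≤ fromℕ n
  fromℕ-mono {m} {n} h = /-mono (+ m) (+ n) 1 1 (ℤ.*-monoʳ-≤-nonNeg (+ 1) (ℤ.+≤+ h))

  archimedean : ∀ q → ∃[ n ] q ≤ fromℕ n
  archimedean q = ℤ.∣ ℚ.↥ q ∣ , subst (_≤ fromℕ ℤ.∣ ℚ.↥ q ∣) (↥p/↧p≡p q)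
     (/-mono (ℚ.↥ q) (+ ℤ.∣ ℚ.↥ q ∣) (ℚ.↧ₙ q) 1 (ℤ.≤-trans (ℤ.≤-reflexive (ℤ.*-identityʳ (ℚ.↥ q))) (ℤ.≤-trans (i≤∣i∣ (ℚ.↥ q))
        (ℤ.≤-trans (ℤ.+≤+ (ℕ.m≤m*n _ (ℚ.↧ₙ q))) (ℤ.≤-reflexive (ℤ.pos-* ℤ.∣ ℚ.↥ q ∣ (ℚ.↧ₙ q)))))))
    where
    i≤∣i∣ : ∀ i → i ℤ.≤ + ℤ.∣ i ∣
    i≤∣i∣ (+ n) = ℤ.≤-refl
    i≤∣i∣ (ℤ.-[1+ n ]) = ℤ.-≤+

  *-mono-≤₀ : ∀ {a b c d} → 0ℚ ≤ c → 0ℚ ≤ b → a ≤ b → c ≤ d → a * c ≤ b * d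
  *-mono-≤₀ {a} {b} {c} {d} 0≤c 0≤b a≤b c≤d =
    ≤-trans (*-monoʳ-≤-nonNeg c {{ℚ.nonNegative 0≤c}} a≤b) (*-monoˡ-≤-nonNeg b {{ℚ.nonNegative 0≤b}} c≤d)

  *-≥0 : ∀ {a b} → 0ℚ ≤ a → 0ℚ ≤ b → 0ℚ ≤ a * b
  *-≥0 {a} {b} p q = nonNegative⁻¹ (a * b) {{nonNeg*nonNeg⇒nonNeg a {{ℚ.nonNegative p}} b {{ℚ.nonNegative q}}}}

  +-≥0 : ∀ {a b} → 0ℚ ≤ a → 0ℚ ≤ b → 0ℚ ≤ a + b
  +-≥0 = +-mono-≤

  *-pos : ∀ {a b} → 0ℚ < a → 0ℚ < b → 0ℚ < a * b
  *-pos {a} {b} p q = positive⁻¹ (a * b) {{pos*pos⇒pos a {{ℚ.positive p}} b {{ℚ.positive q}}}}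

  0<1 : 0ℚ < 1ℚ
  0<1 = positive⁻¹ 1ℚ

  p≤p+q : ∀ {p q} → 0ℚ ≤ q → p ≤ p + q
  p≤p+q {p} {q} h = subst (_≤ p + q) (+-identityʳ p) (+-monoʳ-≤ p h)

  p<p+q : ∀ {p q} → 0ℚ < q → p < p + q
  p<p+q {p} {q} h = subst (_< p + q) (+-identityʳ p) (+-monoʳ-< p h)

  ∣-∣-sym : ∀ p q → ∣ p - q ∣ ≡ ∣ q - p ∣
  ∣-∣-sym p q = trans (sym (∣-p∣≡∣p∣ (p - q)))
    (cong ∣_∣ (solve 2 (λ p q → :- (p :- q) := q :- p) refl p q))

  shrink : ∀ C ε → 0ℚ < ε → ∃[ N ] ∀ n → N ℕ.≤ n → C * 1/suc n < ε
  shrink C ε 0<ε = N , λ n N≤n → begin-strict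
      C * 1/suc n                              ≡⟨ cong (_* 1/suc n) C≡ ⟩
      C * 1/ε * ε * 1/suc n                    ≤⟨ *-monoʳ-≤-nonNeg (1/suc n) {{ℚ.nonNegative (<⇒≤ (1/suc-pos n))}}
                                                   (*-monoʳ-≤-nonNeg ε {{ℚ.nonNegative (<⇒≤ 0<ε)}} (≤-trans (proj₂ arch) (fromℕ-mono N≤n))) ⟩
      fromℕ n * ε * 1/suc n                    <⟨ *-monoˡ-<-pos (1/suc n) {{ℚ.positive (1/suc-pos n)}}
                                                   (*-monoˡ-<-pos ε {{ℚ.positive 0<ε}} (fromℕ-<suc n)) ⟩
      fromℕ (suc n) * ε * 1/suc n              ≡⟨ solve 3 (λ a e r → a :* e :* r := a :* r :* e) refl (fromℕ (suc n)) ε (1/suc n) ⟩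
      fromℕ (suc n) * 1/suc n * ε              ≡⟨ cong (_* ε) (1/suc-inverse n) ⟩
      1ℚ * ε                                   ≡⟨ *-identityˡ ε ⟩
      ε                                        ∎
    where
    open ≤-Reasoning
    instance _ = ℚ.>-nonZero 0<ε
    1/ε = ℚ.1/ ε
    arch = archimedean (C * 1/ε)
    N = proj₁ arch
    C≡ : C ≡ C * 1/ε * ε
    C≡ = sym (trans (*-assoc C 1/ε ε) (trans (cong (C *_) (*-inverseˡ ε)) (*-identityʳ C)))
    fromℕ-<suc : ∀ n → fromℕ n < fromℕ (suc n)
    fromℕ-<suc n = toℚᵘ-cancel-< (ℚᵘ.<-respˡ-≃ (ℚᵘ.≃-sym (toℚᵘ-/ (+ n) 1))
       (ℚᵘ.<-respʳ-≃ (ℚᵘ.≃-sym (toℚᵘ-/ (+ suc n) 1)) (ℚᵘ.*<* (ℤ.*-monoʳ-<-pos (+ 1) (ℤ.+<+ (ℕ.n<1+n n))))))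

  cauchy-tail : ∀ s C N₀ → (∀ N m → N₀ ℕ.≤ N → N ℕ.≤ m → ∣ s m - s N ∣ ≤ C * 1/suc N) → IsCauchy s
  cauchy-tail s C N₀ bound ε 0<ε = N , λ m n N≤m N≤n → begin-strict
      ∣ s m - s n ∣                       ≡⟨ cong ∣_∣ (solve 3 (λ a b c → a :- b := (a :- c) :+ (c :- b)) refl (s m) (s n) (s N)) ⟩
      ∣ (s m - s N) + (s N - s n) ∣       ≤⟨ ∣p+q∣≤∣p∣+∣q∣ (s m - s N) (s N - s n) ⟩
      ∣ s m - s N ∣ + ∣ s N - s n ∣       ≡⟨ cong (λ z → ∣ s m - s N ∣ + z) (∣-∣-sym (s N) (s n)) ⟩
      ∣ s m - s N ∣ + ∣ s n - s N ∣       ≤⟨ +-mono-≤ (bound N m N₀≤N N≤m) (bound N n N₀≤N N≤n) ⟩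
      C * 1/suc N + C * 1/suc N           ≡⟨ solve 2 (λ c r → c :* r :+ c :* r := (c :+ c) :* r) refl C (1/suc N) ⟩
      (C + C) * 1/suc N                   <⟨ proj₂ small N (ℕ.m≤n⊔m N₀ (proj₁ small)) ⟩
      ε                                   ∎
    where
    open ≤-Reasoning
    small = shrink (C + C) ε 0<ε
    N = N₀ ℕ.⊔ proj₁ small
    N₀≤N = ℕ.m≤m⊔n N₀ (proj₁ small)

  scale : ∀ K ε → 0ℚ ≤ K → 0ℚ < ε → Σ[ δ ∈ ℚ ] 0ℚ < δ × K * δ < ε
  scale K ε 0≤K 0<ε = ε * 1/suc N , *-pos 0<ε (1/suc-pos N) , (begin-strict
      K * (ε * 1/suc N) ≡⟨ solve 3 (λ k e r → k :* (e :* r) := (k :* e) :* r) refl K ε (1/suc N) ⟩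
      (K * ε) * 1/suc N <⟨ proj₂ small N ℕ.≤-refl ⟩
      ε ∎)
    where
    open ≤-Reasoning
    small = shrink (K * ε) ε 0<ε
    N = proj₁ small

  cauchy-lipschitz : ∀ s x y A B → 0ℚ ≤ A → 0ℚ ≤ B → IsCauchy x → IsCauchy y →
    (∀ m n → ∣ s m - s n ∣ ≤ A * ∣ x m - x n ∣ + B * ∣ y m - y n ∣) → IsCauchy s
  cauchy-lipschitz s x y A B 0≤A 0≤B cx cy bound ε 0<ε = N , λ m n N≤m N≤n → begin-strict
      ∣ s m - s n ∣                            ≤⟨ bound m n ⟩
      A * ∣ x m - x n ∣ + B * ∣ y m - y n ∣
        ≤⟨ +-mono-≤ (*-monoˡ-≤-nonNeg A {{ℚ.nonNegative 0≤A}} (<⇒≤ (proj₂ Nx m n (ℕ.≤-trans Nx≤ N≤m) (ℕ.≤-trans Nx≤ N≤n))))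
                    (*-monoˡ-≤-nonNeg B {{ℚ.nonNegative 0≤B}} (<⇒≤ (proj₂ Ny m n (ℕ.≤-trans Ny≤ N≤m) (ℕ.≤-trans Ny≤ N≤n)))) ⟩
      A * δ + B * δ                            ≡⟨ *-distribʳ-+ δ A B ⟨
      (A + B) * δ                              <⟨ proj₂ (proj₂ sc) ⟩
      ε                                        ∎
    where
    open ≤-Reasoning
    sc = scale (A + B) ε (+-≥0 0≤A 0≤B) 0<ε
    δ = proj₁ sc
    Nx = cx δ (proj₁ (proj₂ sc))
    Ny = cy δ (proj₁ (proj₂ sc))
    N = proj₁ Nx ℕ.⊔ proj₁ Ny
    Nx≤ = ℕ.m≤m⊔n (proj₁ Nx) (proj₁ Ny)
    Ny≤ = ℕ.m≤n⊔m (proj₁ Nx) (proj₁ Ny)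

  abstract
    cauchy-bounded : ∀ s → IsCauchy s → ∃[ B ] ∀ n → ∣ s n ∣ ≤ fromℕ B
    cauchy-bounded s c = proj₁ arch , λ n → ≤-trans (bound n) (proj₂ arch)
      where
      open ≤-Reasoning
      N : ℕ
      N = proj₁ (c 1ℚ 0<1)
      max : ℕ → ℚ
      max zero    = ∣ s 0 ∣
      max (suc n) = max n ⊔ ∣ s (suc n) ∣
      ≤max : ∀ m {n} → n ℕ.≤′ m → ∣ s n ∣ ≤ max m
      ≤max zero    ℕ.≤′-refl     = ≤-refl
      ≤max (suc m) ℕ.≤′-refl     = p≤q⊔p (max m) ∣ s (suc m) ∣
      ≤max (suc m) (ℕ.≤′-step h) = ≤-trans (≤max m h) (p≤p⊔q (max m) ∣ s (suc m) ∣)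
      arch : ∃[ B ] max N + 1ℚ ≤ fromℕ B
      arch = archimedean (max N + 1ℚ)
      bound : ∀ n → ∣ s n ∣ ≤ max N + 1ℚ
      bound n with ℕ.≤-total n N
      ... | inj₁ n≤N = ≤-trans (≤max N (ℕ.≤⇒≤′ n≤N)) (p≤p+q (<⇒≤ 0<1))
      ... | inj₂ N≤n = begin
        ∣ s n ∣                    ≡⟨ cong ∣_∣ (solve 2 (λ a b → a := b :+ (a :- b)) refl (s n) (s N)) ⟩
        ∣ s N + (s n - s N) ∣      ≤⟨ ∣p+q∣≤∣p∣+∣q∣ (s N) (s n - s N) ⟩
        ∣ s N ∣ + ∣ s n - s N ∣    ≤⟨ +-mono-≤ (≤max N ℕ.≤′-refl) (<⇒≤ (proj₂ (c 1ℚ 0<1) n N N≤n ℕ.≤-refl)) ⟩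
        max N + 1ℚ                 ∎

  ∣0∣<ε : ∀ {p ε} → p ≡ 0ℚ → 0ℚ < ε → ∣ p ∣ < ε
  ∣0∣<ε refl h = h

  abstract
    const-cauchy : ∀ q → IsCauchy (λ _ → q)
    const-cauchy q ε 0<ε = 0 , λ _ _ _ _ → ∣0∣<ε (+-inverseʳ q) 0<ε

  fromℚ : ℚ → ℝ
  fromℚ q = (λ _ → q) , const-cauchy q

  infixl 6 _+ʳ_
  infixl 7 _*ʳ_
  infix  8 -ʳ_

  abstract
    +-cauchy : ∀ x y → IsCauchy x → IsCauchy y → IsCauchy (λ n → x n + y n)
    +-cauchy x y cx cy = cauchy-lipschitz (λ n → x n + y n) x y 1ℚ 1ℚ (<⇒≤ 0<1) (<⇒≤ 0<1) cx cy λ m n → begin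
        ∣ (x m + y m) - (x n + y n) ∣
          ≡⟨ cong ∣_∣ (solve 4 (λ a b c d → (a :+ b) :- (c :+ d) := (a :- c) :+ (b :- d)) refl (x m) (y m) (x n) (y n)) ⟩
        ∣ (x m - x n) + (y m - y n) ∣             ≤⟨ ∣p+q∣≤∣p∣+∣q∣ (x m - x n) (y m - y n) ⟩
        ∣ x m - x n ∣ + ∣ y m - y n ∣             ≡⟨ cong₂ _+_ (*-identityˡ ∣ x m - x n ∣) (*-identityˡ ∣ y m - y n ∣) ⟨
        1ℚ * ∣ x m - x n ∣ + 1ℚ * ∣ y m - y n ∣   ∎
      where open ≤-Reasoning

    neg-cauchy : ∀ x → IsCauchy x → IsCauchy (λ n → - x n)
    neg-cauchy x cx ε 0<ε = proj₁ (cx ε 0<ε) , λ m n p q →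
      subst (_< ε)
        (trans (sym (∣-p∣≡∣p∣ (x m - x n))) (cong ∣_∣ (solve 2 (λ a b → :- (a :- b) := :- a :- :- b) refl (x m) (x n))))
        (proj₂ (cx ε 0<ε) m n p q)

    *-cauchy : ∀ x y → IsCauchy x → IsCauchy y →
      (∃[ A ] ∀ n → ∣ x n ∣ ≤ fromℕ A) → (∃[ B ] ∀ n → ∣ y n ∣ ≤ fromℕ B) → IsCauchy (λ n → x n * y n)
    *-cauchy x y cx cy (A , x≤A) (B , y≤B) =
      cauchy-lipschitz (λ n → x n * y n) x y (fromℕ B) (fromℕ A) (fromℕ-≥0 B) (fromℕ-≥0 A) cx cy λ m n → begin
        ∣ x m * y m - x n * y n ∣
          ≡⟨ cong ∣_∣ (solve 4 (λ a b c d → a :* b :- c :* d := b :* (a :- c) :+ c :* (b :- d)) refl (x m) (y m) (x n) (y n)) ⟩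
        ∣ y m * (x m - x n) + x n * (y m - y n) ∣
          ≤⟨ ∣p+q∣≤∣p∣+∣q∣ (y m * (x m - x n)) (x n * (y m - y n)) ⟩
        ∣ y m * (x m - x n) ∣ + ∣ x n * (y m - y n) ∣
          ≡⟨ cong₂ _+_ (∣p*q∣≡∣p∣*∣q∣ (y m) (x m - x n)) (∣p*q∣≡∣p∣*∣q∣ (x n) (y m - y n)) ⟩
        ∣ y m ∣ * ∣ x m - x n ∣ + ∣ x n ∣ * ∣ y m - y n ∣
          ≤⟨ +-mono-≤ (*-monoʳ-≤-nonNeg ∣ x m - x n ∣ {{∣-∣-nonNeg (x m - x n)}} (y≤B m))
                      (*-monoʳ-≤-nonNeg ∣ y m - y n ∣ {{∣-∣-nonNeg (y m - y n)}} (x≤A n)) ⟩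
        fromℕ B * ∣ x m - x n ∣ + fromℕ A * ∣ y m - y n ∣ ∎
      where open ≤-Reasoning

  _+ʳ_ : ℝ → ℝ → ℝ
  (x , cx) +ʳ (y , cy) = (λ n → x n + y n) , +-cauchy x y cx cy

  -ʳ_ : ℝ → ℝ
  -ʳ (x , cx) = (λ n → - x n) , neg-cauchy x cx

  _*ʳ_ : ℝ → ℝ → ℝ
  (x , cx) *ʳ (y , cy) = (λ n → x n * y n) ,
    *-cauchy x y cx cy (cauchy-bounded x cx) (cauchy-bounded y cy)

  -- ⌊√m⌋
  isqrt : ℕ → ℕ
  isqrt zero    = 0
  isqrt (suc m) with suc (isqrt m) ℕ.* suc (isqrt m) ℕ.≤? suc m
  ... | yes _ = suc (isqrt m)
  ... | no  _ = isqrt m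

  isqrt-spec : ∀ m → isqrt m ℕ.* isqrt m ℕ.≤ m × m ℕ.< suc (isqrt m) ℕ.* suc (isqrt m)
  isqrt-spec zero    = ℕ.z≤n , ℕ.s≤s ℕ.z≤n
  isqrt-spec (suc m) with suc (isqrt m) ℕ.* suc (isqrt m) ℕ.≤? suc m
  ... | yes h = h , ℕ.≤-<-trans (proj₂ (isqrt-spec m)) (ℕ.*-mono-< (ℕ.n<1+n (suc (isqrt m))) (ℕ.n<1+n (suc (isqrt m))))
  ... | no ¬h = ℕ.m≤n⇒m≤1+n (proj₁ (isqrt-spec m)) , ℕ.≰⇒> ¬h

  ∣-∣≤ : ∀ {p q c} → p ≤ q + c → q ≤ p + c → ∣ p - q ∣ ≤ c
  ∣-∣≤ {p} {q} {c} p≤ q≤ with ∣p∣≡p∨∣p∣≡-p (p - q)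
  ... | inj₁ eq = subst₂ _≤_ (sym eq) (solve 2 (λ q c → q :+ c :- q := c) refl q c) (+-monoˡ-≤ (- q) p≤)
  ... | inj₂ eq = subst₂ _≤_ (trans (solve 2 (λ q p → q :- p := :- (p :- q)) refl q p) (sym eq)) (solve 2 (λ q c → q :+ c :- q := c) refl p c) (+-monoˡ-≤ (- p) q≤)

  /suc-+1 : ∀ a N → + a / suc N + 1/suc N ≡ + suc a / suc N
  /suc-+1 a N = toℚᵘ-injective (begin
      ℚ.toℚᵘ (+ a / suc N + 1/suc N)                 ≈⟨ toℚᵘ-homo-+ (+ a / suc N) (1/suc N) ⟩
      ℚ.toℚᵘ (+ a / suc N) ℚᵘ.+ ℚ.toℚᵘ (1/suc N)     ≈⟨ ℚᵘ.+-cong (toℚᵘ-/ (+ a) (suc N)) (toℚᵘ-/ (+ 1) (suc N)) ⟩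
      ℚᵘ.mkℚᵘ (+ a) N ℚᵘ.+ ℚᵘ.mkℚᵘ (+ 1) N           ≈⟨ ℚᵘ.*≡* cross ⟩
      ℚᵘ.mkℚᵘ (+ suc a) N                            ≈⟨ toℚᵘ-/ (+ suc a) (suc N) ⟨
      ℚ.toℚᵘ (+ suc a / suc N) ∎)
    where
    open ℚᵘ.≃-Reasoning
    cross : (+ a ℤ.* + suc N ℤ.+ + 1 ℤ.* + suc N) ℤ.* + suc N ≡ + suc a ℤ.* + (suc N ℕ.* suc N)
    cross = trans (cong (ℤ._* + suc N) (trans (sym (ℤ.*-distribʳ-+ (+ suc N) (+ a) (+ 1))) (cong (λ z → + z ℤ.* + suc N) (ℕ.+-comm a 1))))
       (trans (ℤ.*-assoc (+ suc a) (+ suc N) (+ suc N)) (cong (+ suc a ℤ.*_) (sym (ℤ.pos-* (suc N) (suc N)))))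

  /suc-mono : ∀ a b M N → a ℕ.* suc N ℕ.≤ b ℕ.* suc M → + a / suc M ≤ + b / suc N
  /suc-mono a b M N h = /-mono (+ a) (+ b) (suc M) (suc N)
    (subst₂ ℤ._≤_ (ℤ.pos-* a (suc N)) (ℤ.pos-* b (suc M)) (ℤ.+≤+ h))

  1/suc-antitone : ∀ {N M} → N ℕ.≤ M → 1/suc M ≤ 1/suc N
  1/suc-antitone {N} {M} h = /suc-mono 1 1 M N (ℕ.*-monoʳ-≤ 1 (ℕ.s≤s h))

  module _ (q : ℚ) where
    sqrtApprox : ℕ → ℕ
    sqrtApprox N = isqrt (ℤ.∣ ℚ.↥ q ∣ ℕ.* (suc N ℕ.* suc N) ℕ./ ℚ.↧ₙ q)

    sqrtApprox-spec : ∀ N → let r = sqrtApprox N ; p = ℤ.∣ ℚ.↥ q ∣ ℕ.* (suc N ℕ.* suc N) in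
       (r ℕ.* r) ℕ.* ℚ.↧ₙ q ℕ.≤ p × p ℕ.< (suc r ℕ.* suc r) ℕ.* ℚ.↧ₙ q
    sqrtApprox-spec N =
        ℕ.≤-trans (ℕ.*-monoˡ-≤ d (proj₁ spec)) (ℕ.m/n*n≤m p d)
      , ℕ.<-≤-trans p<  (ℕ.*-monoˡ-≤ d (proj₂ spec))
      where
      d = ℚ.↧ₙ q
      p = ℤ.∣ ℚ.↥ q ∣ ℕ.* (suc N ℕ.* suc N)
      spec = isqrt-spec (p ℕ./ d)
      p< : p ℕ.< suc (p ℕ./ d) ℕ.* d
      p< = subst (ℕ._< suc (p ℕ./ d) ℕ.* d) (sym (ℕ.m≡m%n+[m/n]*n p d)) (ℕ.+-monoˡ-< (p ℕ./ d ℕ.* d) (ℕ.m%n<n p d))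

    sqrtApprox-cross : ∀ M N → sqrtApprox M ℕ.* suc N ℕ.≤ suc (sqrtApprox N) ℕ.* suc M
    sqrtApprox-cross M N = ℕ.≮⇒≥ λ b<a → ℕ.<-irrefl refl (begin-strict
        (rN ℕ.* sM) ℕ.* (rN ℕ.* sM) ℕ.* d            <⟨ ℕ.*-monoˡ-< d (ℕ.*-mono-< b<a b<a) ⟩
        (rM ℕ.* sN) ℕ.* (rM ℕ.* sN) ℕ.* d            ≡⟨ S.solve 3 (λ a b d → (a S.:* b) S.:* (a S.:* b) S.:* d S.:= (a S.:* a S.:* d) S.:* (b S.:* b)) refl rM sN d ⟩
        (rM ℕ.* rM ℕ.* d) ℕ.* (sN ℕ.* sN)            ≤⟨ ℕ.*-monoˡ-≤ (sN ℕ.* sN) (proj₁ (sqrtApprox-spec M)) ⟩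
        (a ℕ.* (sM ℕ.* sM)) ℕ.* (sN ℕ.* sN)          ≡⟨ S.solve 3 (λ a b d → (a S.:* (b S.:* b)) S.:* (d S.:* d) S.:= (a S.:* (d S.:* d)) S.:* (b S.:* b)) refl a sM sN ⟩
        (a ℕ.* (sN ℕ.* sN)) ℕ.* (sM ℕ.* sM)          ≤⟨ ℕ.*-monoˡ-≤ (sM ℕ.* sM) (ℕ.<⇒≤ (proj₂ (sqrtApprox-spec N))) ⟩
        (rN ℕ.* rN ℕ.* d) ℕ.* (sM ℕ.* sM)            ≡⟨ S.solve 3 (λ a b d → (a S.:* a S.:* d) S.:* (b S.:* b) S.:= (a S.:* b) S.:* (a S.:* b) S.:* d) refl rN sM d ⟩
        (rN ℕ.* sM) ℕ.* (rN ℕ.* sM) ℕ.* d            ∎)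
      where
      open ℕ.≤-Reasoning
      module S = ℕSolver.+-*-Solver
      d = ℚ.↧ₙ q
      a = ℤ.∣ ℚ.↥ q ∣
      sM = suc M
      sN = suc N
      rM = sqrtApprox M
      rN = suc (sqrtApprox N)

  abstract
    √-cauchy : ∀ q → IsCauchy (λ N → + sqrtApprox q N / suc N)
    √-cauchy q = cauchy-tail (λ N → + sqrtApprox q N / suc N) 1ℚ 0 λ N m _ N≤m →
      subst (λ z → ∣ + sqrtApprox q m / suc m - + sqrtApprox q N / suc N ∣ ≤ z) (sym (*-identityˡ (1/suc N)))
        (∣-∣≤ (≤-trans (/suc-mono (sqrtApprox q m) (suc (sqrtApprox q N)) m N (sqrtApprox-cross q m N))
                       (≤-reflexive (sym (/suc-+1 (sqrtApprox q N) N))))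
              (≤-trans (/suc-mono (sqrtApprox q N) (suc (sqrtApprox q m)) N m (sqrtApprox-cross q N m))
                (≤-trans (≤-reflexive (sym (/suc-+1 (sqrtApprox q m) m)))
                         (+-monoʳ-≤ (+ sqrtApprox q m / suc m) (1/suc-antitone N≤m)))))

  -- The N-th approximation is ⌊(N+1)√q⌋/(N+1).  Only meant for q ≥ 0: for q < 0
  -- it computes √|q|.
  √ : ℚ → ℝ
  √ q = (λ N → + sqrtApprox q N / suc N) , √-cauchy q

  -- Σ_{m<N} t m
  ∑< : ℕ → (ℕ → ℚ) → ℚ
  ∑< zero    t = 0ℚ
  ∑< (suc N) t = ∑< N t + t N

  module Leibniz where

    sgn : ℕ → ℚ
    sgn zero    = 1ℚ
    sgn (suc m) = - sgn m

    ∣sgn∣ : ∀ m → ∣ sgn m ∣ ≡ 1ℚ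
    ∣sgn∣ zero    = refl
    ∣sgn∣ (suc m) = trans (∣-p∣≡∣p∣ (sgn m)) (∣sgn∣ m)

    size : ℕ → ℚ
    size m = + 4 / suc (2 ℕ.* m)

    term : ℕ → ℚ
    term m = sgn m * size m

    size-≥0 : ∀ m → 0ℚ ≤ size m
    size-≥0 m = nonNegative⁻¹ (size m) {{normalize-nonNeg 4 (suc (2 ℕ.* m))}}

    size-antitone : ∀ m → size (suc m) ≤ size m
    size-antitone m = /suc-mono 4 4 (2 ℕ.* suc m) (2 ℕ.* m)
      (ℕ.*-monoʳ-≤ 4 (ℕ.s≤s (ℕ.*-monoʳ-≤ 2 (ℕ.n≤1+n m))))

    size-≤ : ∀ m → size m ≤ fromℕ 4 * 1/suc m
    size-≤ m = ≤-trans (/suc-mono 4 4 (2 ℕ.* m) m (ℕ.*-monoʳ-≤ 4 (ℕ.s≤s (ℕ.m≤m+n m _)))) (≤-reflexive (sym four))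
      where
      four : fromℕ 4 * 1/suc m ≡ + 4 / suc m
      four = trans (solve 1 (λ r → con (fromℕ 4) :* r := r :+ r :+ r :+ r) refl (1/suc m))
        (trans (cong (λ z → z + 1/suc m + 1/suc m) (/suc-+1 1 m)) (trans (cong (_+ 1/suc m) (/suc-+1 2 m)) (/suc-+1 3 m)))

    tail : ℕ → ℕ → ℚ
    tail N zero    = 0ℚ
    tail N (suc j) = size N - tail (suc N) j

    tail-≥0 : ∀ N j → 0ℚ ≤ tail N j
    tail-≤  : ∀ N j → tail N j ≤ size N
    tail-≥0 N zero    = ≤-refl
    tail-≥0 N (suc j) = subst (_≤ size N - tail (suc N) j) (+-inverseʳ (size N))
       (+-monoʳ-≤ (size N) (neg-antimono-≤ (≤-trans (tail-≤ (suc N) j) (size-antitone N))))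
    tail-≤ N zero     = size-≥0 N
    tail-≤ N (suc j)  = subst (size N - tail (suc N) j ≤_) (+-identityʳ (size N))
       (+-monoʳ-≤ (size N) (neg-antimono-≤ (tail-≥0 (suc N) j)))

    ∑<-tail : ∀ N j → ∑< (j ℕ.+ N) term - ∑< N term ≡ sgn N * tail N j
    ∑<-tail N zero    = trans (+-inverseʳ (∑< N term)) (sym (*-zeroʳ (sgn N)))
    ∑<-tail N (suc j) = begin
      ∑< (suc (j ℕ.+ N)) term - ∑< N term                              ≡⟨ cong (λ z → ∑< z term - ∑< N term) (sym (ℕ.+-suc j N)) ⟩
      ∑< (j ℕ.+ suc N) term - ∑< N term                                ≡⟨ solve 4 (λ a b s t → a :- b := (a :- (b :+ s :* t)) :+ s :* t) refl (∑< (j ℕ.+ suc N) term) (∑< N term) (sgn N) (size N) ⟩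
      (∑< (j ℕ.+ suc N) term - ∑< (suc N) term) + sgn N * size N       ≡⟨ cong (_+ sgn N * size N) (∑<-tail (suc N) j) ⟩
      - sgn N * tail (suc N) j + sgn N * size N                        ≡⟨ solve 3 (λ s t a → :- s :* t :+ s :* a := s :* (a :- t)) refl (sgn N) (tail (suc N) j) (size N) ⟩
      sgn N * (size N - tail (suc N) j)                                ∎
      where open ≡-Reasoning

    abstract
      partial-cauchy : IsCauchy (λ N → ∑< N term)
      partial-cauchy = cauchy-tail (λ N → ∑< N term) (fromℕ 4) 0 λ N m _ N≤m → begin
        ∣ ∑< m term - ∑< N term ∣                        ≡⟨ cong (λ z → ∣ ∑< z term - ∑< N term ∣) (ℕ.m∸n+n≡m N≤m) ⟨
        ∣ ∑< (m ℕ.∸ N ℕ.+ N) term - ∑< N term ∣          ≡⟨ cong ∣_∣ (∑<-tail N (m ℕ.∸ N)) ⟩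
        ∣ sgn N * tail N (m ℕ.∸ N) ∣                     ≡⟨ ∣p*q∣≡∣p∣*∣q∣ (sgn N) (tail N (m ℕ.∸ N)) ⟩
        ∣ sgn N ∣ * ∣ tail N (m ℕ.∸ N) ∣                 ≡⟨ cong₂ _*_ (∣sgn∣ N) (0≤p⇒∣p∣≡p (tail-≥0 N (m ℕ.∸ N))) ⟩
        1ℚ * tail N (m ℕ.∸ N)                            ≡⟨ *-identityˡ (tail N (m ℕ.∸ N)) ⟩
        tail N (m ℕ.∸ N)                                 ≤⟨ tail-≤ N (m ℕ.∸ N) ⟩
        size N                                           ≤⟨ size-≤ N ⟩
        fromℕ 4 * 1/suc N                                ∎
        where open ≤-Reasoning

  -- Leibniz: π = Σ_m (-1)^m 4/(2m+1)
  π : ℝ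
  π = (λ N → ∑< N Leibniz.term) , Leibniz.partial-cauchy

  1/_! : ℕ → ℚ
  1/ zero  ! = 1ℚ
  1/ suc m ! = 1/ m ! * 1/suc m

  1/!-≥0 : ∀ m → 0ℚ ≤ 1/ m !
  1/!-≥0 zero    = <⇒≤ 0<1
  1/!-≥0 (suc m) = *-≥0 (1/!-≥0 m) (<⇒≤ (1/suc-pos m))

  fromℕ-suc : ∀ n → fromℕ n + 1ℚ ≡ fromℕ (suc n)
  fromℕ-suc n = /suc-+1 n 0

  fromℕ-+ : ∀ m n → fromℕ (m ℕ.+ n) ≡ fromℕ m + fromℕ n
  fromℕ-+ zero    n = sym (+-identityˡ (fromℕ n))
  fromℕ-+ (suc m) n = begin
    fromℕ (suc (m ℕ.+ n))         ≡⟨ fromℕ-suc (m ℕ.+ n) ⟨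
    fromℕ (m ℕ.+ n) + 1ℚ          ≡⟨ cong (_+ 1ℚ) (fromℕ-+ m n) ⟩
    fromℕ m + fromℕ n + 1ℚ        ≡⟨ solve 2 (λ a b → a :+ b :+ con 1ℚ := a :+ con 1ℚ :+ b) refl (fromℕ m) (fromℕ n) ⟩
    fromℕ m + 1ℚ + fromℕ n        ≡⟨ cong (_+ fromℕ n) (fromℕ-suc m) ⟩
    fromℕ (suc m) + fromℕ n       ∎
    where open ≡-Reasoning

  *-monoˡ : ∀ {a b c} → 0ℚ ≤ a → b ≤ c → a * b ≤ a * c
  *-monoˡ {a} h = *-monoˡ-≤-nonNeg a {{ℚ.nonNegative h}}

  *-monoʳ : ∀ {a b c} → 0ℚ ≤ a → b ≤ c → b * a ≤ c * a
  *-monoʳ {a} h = *-monoʳ-≤-nonNeg a {{ℚ.nonNegative h}}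

  p≤∣p∣ : ∀ p → p ≤ ∣ p ∣
  p≤∣p∣ p with ≤-total 0ℚ p
  ... | inj₁ h = ≤-reflexive (sym (0≤p⇒∣p∣≡p h))
  ... | inj₂ h = ≤-trans h (0≤∣p∣ p)

  ^-≥0 : ∀ {b} → 0ℚ ≤ b → ∀ m → 0ℚ ≤ b ^ m
  ^-≥0 h zero    = <⇒≤ 0<1
  ^-≥0 h (suc m) = *-≥0 h (^-≥0 h m)

  ∣^∣≤ : ∀ {x b} → ∣ x ∣ ≤ b → ∀ m → ∣ x ^ m ∣ ≤ b ^ m
  ∣^∣≤         h zero    = ≤-refl
  ∣^∣≤ {x} {b} h (suc m) = ≤-trans (≤-reflexive (∣p*q∣≡∣p∣*∣q∣ x (x ^ m)))
    (*-mono-≤₀ (0≤∣p∣ (x ^ m)) (≤-trans (0≤∣p∣ x) h) h (∣^∣≤ h m))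

  ^-lipschitz : ∀ {x y b} → ∣ x ∣ ≤ b → ∣ y ∣ ≤ b → ∀ m →
    ∣ x ^ suc m - y ^ suc m ∣ ≤ fromℕ (suc m) * b ^ m * ∣ x - y ∣
  ^-lipschitz {x} {y} {b} hx hy zero = ≤-reflexive (trans (cong ∣_∣ (cong₂ _-_ (*-identityʳ x) (*-identityʳ y)))
    (solve 1 (λ d → d := con 1ℚ :* con 1ℚ :* d) refl ∣ x - y ∣))
  ^-lipschitz {x} {y} {b} hx hy (suc m) = begin
    ∣ x * x ^ suc m - y * y ^ suc m ∣
      ≡⟨ cong ∣_∣ (solve 4 (λ x X y Y → x :* X :- y :* Y := x :* (X :- Y) :+ Y :* (x :- y)) refl x (x ^ suc m) y (y ^ suc m)) ⟩
    ∣ x * (x ^ suc m - y ^ suc m) + y ^ suc m * (x - y) ∣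
      ≤⟨ ∣p+q∣≤∣p∣+∣q∣ (x * (x ^ suc m - y ^ suc m)) (y ^ suc m * (x - y)) ⟩
    ∣ x * (x ^ suc m - y ^ suc m) ∣ + ∣ y ^ suc m * (x - y) ∣
      ≡⟨ cong₂ _+_ (∣p*q∣≡∣p∣*∣q∣ x (x ^ suc m - y ^ suc m)) (∣p*q∣≡∣p∣*∣q∣ (y ^ suc m) (x - y)) ⟩
    ∣ x ∣ * ∣ x ^ suc m - y ^ suc m ∣ + ∣ y ^ suc m ∣ * ∣ x - y ∣
      ≤⟨ +-mono-≤ (*-mono-≤₀ (0≤∣p∣ (x ^ suc m - y ^ suc m)) (≤-trans (0≤∣p∣ x) hx) hx (^-lipschitz hx hy m))
                  (*-monoʳ (0≤∣p∣ (x - y)) (∣^∣≤ hy (suc m))) ⟩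
    b * (fromℕ (suc m) * b ^ m * ∣ x - y ∣) + b * b ^ m * ∣ x - y ∣
      ≡⟨ solve 4 (λ b B d n → b :* (n :* B :* d) :+ b :* B :* d := (n :+ con 1ℚ) :* (b :* B) :* d) refl b (b ^ m) ∣ x - y ∣ (fromℕ (suc m)) ⟩
    (fromℕ (suc m) + 1ℚ) * (b * b ^ m) * ∣ x - y ∣
      ≡⟨ cong (λ z → z * (b * b ^ m) * ∣ x - y ∣) (fromℕ-suc (suc m)) ⟩
    fromℕ (suc (suc m)) * (b * b ^ m) * ∣ x - y ∣ ∎
    where open ≤-Reasoning

  -- The exponential series at a natural number B; it majorises, on [-B , B], every
  -- power series with coefficients bounded by 1/m!.
  module Majorant (B : ℕ) where
    open ≤-Reasoning

    b : ℚ
    b = fromℕ B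

    g : ℕ → ℚ
    g m = 1/ m ! * b ^ m

    G : ℕ → ℚ
    G N = ∑< N g

    g-≥0 : ∀ m → 0ℚ ≤ g m
    g-≥0 m = *-≥0 (1/!-≥0 m) (^-≥0 (fromℕ-≥0 B) m)

    N₀ : ℕ
    N₀ = B ℕ.+ B

    g-halves : ∀ {N} → N₀ ℕ.≤ N → g (suc N) ≤ ½ * g N
    g-halves {N} h = begin
      1/ N ! * 1/suc N * (b * b ^ N)             ≡⟨ solve 4 (λ f r b p → f :* r :* (b :* p) := con ½ :* ((b :+ b) :* r) :* (f :* p)) refl (1/ N !) (1/suc N) b (b ^ N) ⟩
      ½ * ((b + b) * 1/suc N) * g N              ≤⟨ *-monoʳ (g-≥0 N) (*-monoˡ (nonNegative⁻¹ ½) (*-monoʳ (<⇒≤ (1/suc-pos N))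
                                                     (≤-trans (≤-reflexive (sym (fromℕ-+ B B))) (fromℕ-mono (ℕ.m≤n⇒m≤1+n h))))) ⟩
      ½ * (fromℕ (suc N) * 1/suc N) * g N        ≡⟨ cong (λ z → ½ * z * g N) (1/suc-inverse N) ⟩
      ½ * g N                                    ∎

    K : ℚ
    K = g N₀ * fromℕ (suc N₀)

    K-≥0 : 0ℚ ≤ K
    K-≥0 = *-≥0 (g-≥0 N₀) (fromℕ-≥0 (suc N₀))

    ½1/suc : ∀ N → ½ * 1/suc N ≤ 1/suc (suc N)
    ½1/suc N = begin
      ½ * 1/suc N                     ≡⟨ *-identityʳ (½ * 1/suc N) ⟨
      ½ * 1/suc N * 1ℚ                ≡⟨ cong (½ * 1/suc N *_) (1/suc-inverse (suc N)) ⟨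
      ½ * 1/suc N * (fromℕ (suc (suc N)) * 1/suc (suc N))
        ≤⟨ *-monoˡ (*-≥0 (nonNegative⁻¹ ½) (<⇒≤ (1/suc-pos N))) (*-monoʳ (<⇒≤ (1/suc-pos (suc N)))
             (≤-trans (fromℕ-mono {suc (suc N)} {suc N ℕ.+ suc N} (ℕ.s≤s (ℕ.m≤n+m (suc N) N))) (≤-reflexive (fromℕ-+ (suc N) (suc N))))) ⟩
      ½ * 1/suc N * ((fromℕ (suc N) + fromℕ (suc N)) * 1/suc (suc N))
        ≡⟨ solve 3 (λ r n s → con ½ :* r :* ((n :+ n) :* s) := n :* r :* s) refl (1/suc N) (fromℕ (suc N)) (1/suc (suc N)) ⟩
      fromℕ (suc N) * 1/suc N * 1/suc (suc N)   ≡⟨ cong (_* 1/suc (suc N)) (1/suc-inverse N) ⟩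
      1ℚ * 1/suc (suc N)                        ≡⟨ *-identityˡ (1/suc (suc N)) ⟩
      1/suc (suc N)                             ∎

    g-≤ : ∀ {N} → N₀ ℕ.≤′ N → g N ≤ K * 1/suc N
    g-≤ ℕ.≤′-refl = ≤-reflexive (sym (begin-equality
      g N₀ * fromℕ (suc N₀) * 1/suc N₀       ≡⟨ *-assoc (g N₀) (fromℕ (suc N₀)) (1/suc N₀) ⟩
      g N₀ * (fromℕ (suc N₀) * 1/suc N₀)     ≡⟨ cong (g N₀ *_) (1/suc-inverse N₀) ⟩
      g N₀ * 1ℚ                              ≡⟨ *-identityʳ (g N₀) ⟩
      g N₀                                   ∎))
    g-≤ {suc N} (ℕ.≤′-step h) = begin
      g (suc N)                ≤⟨ g-halves (ℕ.≤′⇒≤ h) ⟩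
      ½ * g N                  ≤⟨ *-monoˡ (nonNegative⁻¹ ½) (g-≤ h) ⟩
      ½ * (K * 1/suc N)        ≡⟨ solve 2 (λ k r → con ½ :* (k :* r) := k :* (con ½ :* r)) refl K (1/suc N) ⟩
      K * (½ * 1/suc N)        ≤⟨ *-monoˡ K-≥0 (½1/suc N) ⟩
      K * 1/suc (suc N)        ∎

    G-mono : ∀ {N m} → N ℕ.≤′ m → G N ≤ G m
    G-mono ℕ.≤′-refl             = ≤-refl
    G-mono {m = suc m} (ℕ.≤′-step h) = ≤-trans (G-mono h) (p≤p+q (g-≥0 m))

    -- G + 2g is antitone beyond N₀, hence an upper bound for the sum of the series
    upper : ∀ {N m} → N₀ ℕ.≤ N → N ℕ.≤′ m → G m + (g m + g m) ≤ G N + (g N + g N)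
    upper h ℕ.≤′-refl = ≤-refl
    upper {N} {suc m} h (ℕ.≤′-step k) = begin
      G m + g m + (g (suc m) + g (suc m))      ≤⟨ +-monoʳ-≤ (G m + g m) (+-mono-≤ half half) ⟩
      G m + g m + (½ * g m + ½ * g m)          ≡⟨ solve 2 (λ G g → G :+ g :+ (con ½ :* g :+ con ½ :* g) := G :+ (g :+ g)) refl (G m) (g m) ⟩
      G m + (g m + g m)                        ≤⟨ upper h k ⟩
      G N + (g N + g N)                        ∎
      where half = g-halves (ℕ.≤-trans h (ℕ.≤′⇒≤ k))

    G-cauchy : IsCauchy G
    G-cauchy = cauchy-tail G (K + K) N₀ λ N m N₀≤N N≤m → ∣-∣≤
      (begin
        G m                             ≤⟨ p≤p+q (+-≥0 (g-≥0 m) (g-≥0 m)) ⟩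
        G m + (g m + g m)               ≤⟨ upper N₀≤N (ℕ.≤⇒≤′ N≤m) ⟩
        G N + (g N + g N)               ≤⟨ +-monoʳ-≤ (G N) (+-mono-≤ (g-≤ (ℕ.≤⇒≤′ N₀≤N)) (g-≤ (ℕ.≤⇒≤′ N₀≤N))) ⟩
        G N + (K * 1/suc N + K * 1/suc N) ≡⟨ cong (λ z → G N + z) (*-distribʳ-+ (1/suc N) K K) ⟨
        G N + (K + K) * 1/suc N         ∎)
      (≤-trans (G-mono (ℕ.≤⇒≤′ N≤m)) (p≤p+q (*-≥0 (+-≥0 K-≥0 K-≥0) (<⇒≤ (1/suc-pos N)))))

  module _ (c : ℕ → ℚ) (c-bound : ∀ m → ∣ c m ∣ ≤ 1/ m !) where

    partial : ℕ → ℚ → ℚ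
    partial N x = ∑< N (λ m → c m * x ^ m)

    module _ (B : ℕ) where
      open Majorant B
      open ≤-Reasoning

      partial-lipschitz : ∀ {x y} → ∣ x ∣ ≤ b → ∣ y ∣ ≤ b → ∀ N →
        ∣ partial (suc N) x - partial (suc N) y ∣ ≤ G N * ∣ x - y ∣
      partial-lipschitz {x} {y} hx hy zero    = ≤-reflexive (trans (cong ∣_∣ (+-inverseʳ (0ℚ + c 0 * 1ℚ))) (sym (*-zeroˡ ∣ x - y ∣)))
      partial-lipschitz {x} {y} hx hy (suc m) = begin
        ∣ (P x + c (suc m) * x ^ suc m) - (P y + c (suc m) * y ^ suc m) ∣
          ≡⟨ cong ∣_∣ (solve 5 (λ p q c a b → (p :+ c :* a) :- (q :+ c :* b) := (p :- q) :+ c :* (a :- b)) refl (P x) (P y) (c (suc m)) (x ^ suc m) (y ^ suc m)) ⟩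
        ∣ (P x - P y) + c (suc m) * (x ^ suc m - y ^ suc m) ∣
          ≤⟨ ∣p+q∣≤∣p∣+∣q∣ (P x - P y) (c (suc m) * (x ^ suc m - y ^ suc m)) ⟩
        ∣ P x - P y ∣ + ∣ c (suc m) * (x ^ suc m - y ^ suc m) ∣
          ≤⟨ +-mono-≤ (partial-lipschitz hx hy m) term ⟩
        G m * ∣ x - y ∣ + g m * ∣ x - y ∣
          ≡⟨ *-distribʳ-+ ∣ x - y ∣ (G m) (g m) ⟨
        G (suc m) * ∣ x - y ∣ ∎
        where
        P = partial (suc m)
        n = fromℕ (suc m)
        term : ∣ c (suc m) * (x ^ suc m - y ^ suc m) ∣ ≤ g m * ∣ x - y ∣
        term = begin
          ∣ c (suc m) * (x ^ suc m - y ^ suc m) ∣          ≡⟨ ∣p*q∣≡∣p∣*∣q∣ (c (suc m)) (x ^ suc m - y ^ suc m) ⟩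
          ∣ c (suc m) ∣ * ∣ x ^ suc m - y ^ suc m ∣        ≤⟨ *-mono-≤₀ (0≤∣p∣ (x ^ suc m - y ^ suc m)) (1/!-≥0 (suc m)) (c-bound (suc m)) (^-lipschitz hx hy m) ⟩
          1/ m ! * 1/suc m * (n * b ^ m * ∣ x - y ∣)
            ≡⟨ solve 5 (λ f r n p d → f :* r :* (n :* p :* d) := n :* r :* (f :* p :* d)) refl (1/ m !) (1/suc m) n (b ^ m) ∣ x - y ∣ ⟩
          n * 1/suc m * (1/ m ! * b ^ m * ∣ x - y ∣)       ≡⟨ cong (_* (g m * ∣ x - y ∣)) (1/suc-inverse m) ⟩
          1ℚ * (g m * ∣ x - y ∣)                           ≡⟨ *-identityˡ (g m * ∣ x - y ∣) ⟩
          g m * ∣ x - y ∣                                  ∎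

      partial-tail : ∀ {x} → ∣ x ∣ ≤ b → ∀ {N m} → N ℕ.≤′ m → ∣ partial m x - partial N x ∣ ≤ G m - G N
      partial-tail {x} hx {N} ℕ.≤′-refl = ≤-reflexive (trans (cong ∣_∣ (+-inverseʳ (partial N x))) (sym (+-inverseʳ (G N))))
      partial-tail {x} hx {N} {suc m} (ℕ.≤′-step h) = begin
        ∣ partial m x + c m * x ^ m - partial N x ∣
          ≡⟨ cong ∣_∣ (solve 3 (λ p t q → p :+ t :- q := (p :- q) :+ t) refl (partial m x) (c m * x ^ m) (partial N x)) ⟩
        ∣ (partial m x - partial N x) + c m * x ^ m ∣    ≤⟨ ∣p+q∣≤∣p∣+∣q∣ (partial m x - partial N x) (c m * x ^ m) ⟩
        ∣ partial m x - partial N x ∣ + ∣ c m * x ^ m ∣  ≤⟨ +-mono-≤ (partial-tail hx h) term ⟩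
        (G m - G N) + g m                                ≡⟨ solve 3 (λ p q t → (p :- q) :+ t := p :+ t :- q) refl (G m) (G N) (g m) ⟩
        G m + g m - G N                                  ∎
        where
        term : ∣ c m * x ^ m ∣ ≤ g m
        term = ≤-trans (≤-reflexive (∣p*q∣≡∣p∣*∣q∣ (c m) (x ^ m)))
          (*-mono-≤₀ (0≤∣p∣ (x ^ m)) (1/!-≥0 m) (c-bound m) (∣^∣≤ hx m))

      partial-tail′ : ∀ {x} → ∣ x ∣ ≤ b → ∀ m n → ∣ partial m x - partial n x ∣ ≤ ∣ G m - G n ∣
      partial-tail′ {x} hx m n with ℕ.≤-total n m
      ... | inj₁ n≤m = ≤-trans (partial-tail hx (ℕ.≤⇒≤′ n≤m)) (p≤∣p∣ (G m - G n))
      ... | inj₂ m≤n = subst₂ _≤_ (∣-∣-sym (partial n x) (partial m x)) (∣-∣-sym (G n) (G m))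
        (≤-trans (partial-tail hx (ℕ.≤⇒≤′ m≤n)) (p≤∣p∣ (G n - G m)))

      partial-lipschitz′ : ∀ L → (∀ N → ∣ G N ∣ ≤ fromℕ L) → ∀ {x y} → ∣ x ∣ ≤ b → ∣ y ∣ ≤ b → ∀ N →
        ∣ partial N x - partial N y ∣ ≤ fromℕ L * ∣ x - y ∣
      partial-lipschitz′ L hL {x} {y} hx hy zero    = *-≥0 {fromℕ L} {∣ x - y ∣} (fromℕ-≥0 L) (0≤∣p∣ (x - y))
      partial-lipschitz′ L hL {x} {y} hx hy (suc m) = ≤-trans (partial-lipschitz hx hy m)
        (*-monoʳ (0≤∣p∣ (x - y)) (≤-trans (p≤∣p∣ (G m)) (hL m)))

    partial-cauchy′ : ∀ x → IsCauchy x → ∀ B → (∀ n → ∣ x n ∣ ≤ fromℕ B) → (∃[ L ] ∀ N → ∣ Majorant.G B N ∣ ≤ fromℕ L) →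
      IsCauchy (λ N → partial N (x N))
    partial-cauchy′ x cx B hB (L , hL) =
      cauchy-lipschitz (λ N → partial N (x N)) x G (fromℕ L) 1ℚ (fromℕ-≥0 L) (<⇒≤ 0<1) cx G-cauchy λ m n → begin
        ∣ partial m (x m) - partial n (x n) ∣
          ≡⟨ cong ∣_∣ (solve 3 (λ a b c → a :- c := (a :- b) :+ (b :- c)) refl (partial m (x m)) (partial m (x n)) (partial n (x n))) ⟩
        ∣ (partial m (x m) - partial m (x n)) + (partial m (x n) - partial n (x n)) ∣
          ≤⟨ ∣p+q∣≤∣p∣+∣q∣ (partial m (x m) - partial m (x n)) (partial m (x n) - partial n (x n)) ⟩
        ∣ partial m (x m) - partial m (x n) ∣ + ∣ partial m (x n) - partial n (x n) ∣
          ≤⟨ +-mono-≤ (partial-lipschitz′ B L hL (hB m) (hB n) m) (partial-tail′ B (hB n) m n) ⟩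
        fromℕ L * ∣ x m - x n ∣ + ∣ G m - G n ∣
          ≡⟨ cong (λ z → fromℕ L * ∣ x m - x n ∣ + z) (*-identityˡ ∣ G m - G n ∣) ⟨
        fromℕ L * ∣ x m - x n ∣ + 1ℚ * ∣ G m - G n ∣ ∎
      where
      open ≤-Reasoning
      open Majorant B

    abstract
      partial-cauchy : ∀ x → IsCauchy x → (∃[ B ] ∀ n → ∣ x n ∣ ≤ fromℕ B) → IsCauchy (λ N → partial N (x N))
      partial-cauchy x cx (B , hB) =
        partial-cauchy′ x cx B hB (cauchy-bounded (Majorant.G B) (Majorant.G-cauchy B))

    -- Σ_m c m x^m, taking the N-th partial sum at the N-th approximation of x
    powerSeries : ℝ → ℝ
    powerSeries (x , cx) = (λ N → partial N (x N)) , partial-cauchy x cx (cauchy-bounded x cx)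

  -- i^m = re-i^ m + i im-i^ m
  re-i^ im-i^ : ℕ → ℚ
  re-i^ zero    = 1ℚ
  re-i^ (suc m) = - im-i^ m
  im-i^ zero    = 0ℚ
  im-i^ (suc m) = re-i^ m

  ∣re-i^∣≤1 : ∀ m → ∣ re-i^ m ∣ ≤ 1ℚ
  ∣im-i^∣≤1 : ∀ m → ∣ im-i^ m ∣ ≤ 1ℚ
  ∣re-i^∣≤1 zero    = ≤-refl
  ∣re-i^∣≤1 (suc m) = ≤-trans (≤-reflexive (∣-p∣≡∣p∣ (im-i^ m))) (∣im-i^∣≤1 m)
  ∣im-i^∣≤1 zero    = <⇒≤ 0<1
  ∣im-i^∣≤1 (suc m) = ∣re-i^∣≤1 m

  scaled-bound : ∀ a m → ∣ a ∣ ≤ 1ℚ → ∣ a * 1/ m ! ∣ ≤ 1/ m !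
  scaled-bound a m h = begin
    ∣ a * 1/ m ! ∣          ≡⟨ ∣p*q∣≡∣p∣*∣q∣ a (1/ m !) ⟩
    ∣ a ∣ * ∣ 1/ m ! ∣      ≡⟨ cong (∣ a ∣ *_) (0≤p⇒∣p∣≡p (1/!-≥0 m)) ⟩
    ∣ a ∣ * 1/ m !          ≤⟨ *-monoʳ (1/!-≥0 m) h ⟩
    1ℚ * 1/ m !             ≡⟨ *-identityˡ (1/ m !) ⟩
    1/ m !                  ∎
    where open ≤-Reasoning

  -- Real and imaginary part of Σ_m (i x)^m / m!
  cos sin : ℝ → ℝ
  cos = powerSeries (λ m → re-i^ m * 1/ m !) (λ m → scaled-bound (re-i^ m) m (∣re-i^∣≤1 m))
  sin = powerSeries (λ m → im-i^ m * 1/ m !) (λ m → scaled-bound (im-i^ m) m (∣im-i^∣≤1 m))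

open import Algebra.Bundles.Raw using (RawSemiring)
open import Data.Bool.Base using (Bool; true; if_then_else_)
open import Data.Fin.Base using (Fin; zero; suc; toℕ; fromℕ<)
open import Data.Fin.Properties using (_≟_)
open import Data.Integer.Base using (+_)
open import Data.List.Base using (List; length; tabulate; catMaybes; filter)
open import Data.Maybe.Base using (Maybe; zipWith)
open import Data.Nat.Base as ℕ using (ℕ; NonZero; _+_; _*_; _∸_)
open import Data.Nat.DivMod using (_mod_)
import Data.Nat.Properties as ℕ
open import Data.Product.Base using (∃₂; ∃-syntax; Σ-syntax; _×_)
open import Data.Rational.Base as ℚ using (ℚ; 0ℚ; 1ℚ; _/_)
open import Data.Sum.Base using (_⊎_)
open import Function.Bundles using (_↔_; Inverse)
open import Level using (0ℓ)
open import Relation.Binary.PropositionalEquality using (_≡_; _≢_)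
open import Relation.Nullary using (¬_; does)

open Reals public using (ℝ; _≈ʳ_; _+ʳ_; _*ʳ_; -ʳ_; fromℚ; √; π; cos; sin)

infix 5 _+i_
record ℂ : Set where
  constructor _+i_
  field
    re im : ℝ
open ℂ public

infix  4 _≈ᶜ_
infixl 6 _+ᶜ_
infixl 7 _*ᶜ_
infix  8 -ᶜ_ #_

_≈ᶜ_ : ℂ → ℂ → Set
z ≈ᶜ w = re z ≈ʳ re w × im z ≈ʳ im w

_+ᶜ_ _*ᶜ_ : ℂ → ℂ → ℂ
z +ᶜ w = re z +ʳ re w +i im z +ʳ im w
z *ᶜ w = re z *ʳ re w +ʳ -ʳ (im z *ʳ im w) +i re z *ʳ im w +ʳ im z *ʳ re w

-ᶜ_ : ℂ → ℂ
-ᶜ z = -ʳ re z +i -ʳ im z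

real : ℝ → ℂ
real x = x +i fromℚ 0ℚ

#_ : ℕ → ℂ
# m = real (fromℚ (+ m / 1))

e^i_ : ℝ → ℂ
e^i θ = cos θ +i sin θ

ℂ-rawSemiring : RawSemiring 0ℓ 0ℓ
ℂ-rawSemiring = record { _≈_ = _≈ᶜ_ ; _+_ = _+ᶜ_ ; _*_ = _*ᶜ_ ; 0# = # 0 ; 1# = # 1 }

open import Algebra.Definitions.RawSemiring ℂ-rawSemiring public
  using () renaming (_^_ to _^ᶜ_; sum to ∑)

Matrix : ℕ → Set
Matrix N = Fin N → Fin N → ℂ

infix  4 _≈ᴹ_
infixl 7 _*ᴹ_
infixr 7 _•_

_≈ᴹ_ : ∀ {N} → Matrix N → Matrix N → Set
M ≈ᴹ M′ = ∀ x y → M x y ≈ᶜ M′ x y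

_*ᴹ_ : ∀ {N} → Matrix N → Matrix N → Matrix N
(M *ᴹ M′) x y = ∑ λ z → M x z *ᶜ M′ z y

_•_ : ∀ {N} → ℂ → Matrix N → Matrix N
(c • M) x y = c *ᶜ M x y

∑ᴹ : ∀ {m N} → (Fin m → Matrix N) → Matrix N
∑ᴹ M x y = ∑ λ i → M i x y

0ᴹ Iᴹ Jᴹ : ∀ {N} → Matrix N
0ᴹ _ _ = # 0
Iᴹ x y = if does (x ≟ y) then # 1 else # 0
Jᴹ _ _ = # 1

01-matrix : ∀ {N} → (Fin N → Fin N → Bool) → Matrix N
01-matrix R x y = if R x y then # 1 else # 0

_∈Span_ : ∀ {m N} → Matrix N → (Fin m → Matrix N) → Set
_∈Span_ {m} M B = Σ[ c ∈ (Fin m → ℂ) ] M ≈ᴹ ∑ᴹ λ i → c i • B i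

record CommutativeAssociationScheme (d N : ℕ) : Set where
  field
    relation : Fin (ℕ.suc d) → Fin N → Fin N → Bool

  A : Fin (ℕ.suc d) → Matrix N
  A i = 01-matrix (relation i)

  field
    nonzero     : ∀ i → ∃₂ λ x y → relation i x y ≡ true
    A₀≈I        : A zero ≈ᴹ Iᴹ
    ∑A≈J        : ∑ᴹ A ≈ᴹ Jᴹ
    transpose   : ∀ (i : Fin d) → ∃[ j ] ∀ x y → relation (suc i) y x ≡ relation (suc {d} j) x y
    closed      : ∀ i j → (A i *ᴹ A j) ∈Span A
    commutative : ∀ i j → A i *ᴹ A j ≈ᴹ A j *ᴹ A i

module _ {d N : ℕ} .{{_ : NonZero N}} (𝔛 : CommutativeAssociationScheme d N) where
  open CommutativeAssociationScheme 𝔛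

  record IsPrimitiveIdempotent (e : Matrix N) : Set where
    field
      in-algebra : e ∈Span A
      idempotent : e *ᴹ e ≈ᴹ e
      nonzero    : ¬ e ≈ᴹ 0ᴹ
      minimal    : ∀ f → f ∈Span A → f *ᴹ f ≈ᴹ f → e *ᴹ f ≈ᴹ f → f ≈ᴹ 0ᴹ ⊎ f ≈ᴹ e

  record IsPrimitiveIdempotentBasis (E : Fin (ℕ.suc d) → Matrix N) : Set where
    field
      primitiveIdempotent : ∀ i → IsPrimitiveIdempotent (E i)
      spanning            : ∀ j → A j ∈Span E
      independent         : ∀ (c : Fin (ℕ.suc d) → ℂ) → ∑ᴹ (λ i → c i • E i) ≈ᴹ 0ᴹ → ∀ i → c i ≈ᶜ # 0
      E₀≈J/N              : E zero ≈ᴹ real (fromℚ (+ 1 / N)) • Jᴹ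

  IsFirstEigenmatrix : (E : Fin (ℕ.suc d) → Matrix N) → (Fin (ℕ.suc d) → Fin (ℕ.suc d) → ℂ) → Set
  IsFirstEigenmatrix E P = ∀ j → A j ≈ᴹ ∑ᴹ λ i → P i j • E i

  IsSecondEigenmatrix : (E : Fin (ℕ.suc d) → Matrix N) → (Fin (ℕ.suc d) → Fin (ℕ.suc d) → ℂ) → Set
  IsSecondEigenmatrix E Q = ∀ j → E j ≈ᴹ real (fromℚ (+ 1 / N)) • ∑ᴹ λ i → Q i j • A i

-- A scheme whose adjacency matrices and primitive idempotents can be labelled by
-- Rel and Idem, with a₀ labelling the identity relation and e₀ labelling J/|X|, so
-- that the eigenmatrices become P and Q.
record SchemeWithEigenmatrices {Rel Idem : Set} (a₀ : Rel) (e₀ : Idem)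
    (P : Idem → Rel → ℂ) (Q : Rel → Idem → ℂ) : Set where
  field
    classes size      : ℕ
    .{{size-nonZero}} : NonZero size
    scheme            : CommutativeAssociationScheme classes size
    E                 : Fin (ℕ.suc classes) → Matrix size
    E-basis           : IsPrimitiveIdempotentBasis scheme E
    Rel↔Fin           : Rel ↔ Fin (ℕ.suc classes)
    Idem↔Fin          : Idem ↔ Fin (ℕ.suc classes)

  rel : Fin (ℕ.suc classes) → Rel
  rel = Inverse.from Rel↔Fin

  idem : Fin (ℕ.suc classes) → Idem
  idem = Inverse.from Idem↔Fin

  field
    rel-zero          : rel zero ≡ a₀
    idem-zero         : idem zero ≡ e₀
    firstEigenmatrix  : IsFirstEigenmatrix scheme E λ i j → P (idem i) (rel j)
    secondEigenmatrix : IsSecondEigenmatrix scheme E λ i j → Q (rel i) (idem j)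

-- A constructor argument of type Fin (n ∸ 1) stands for the index j = 1 , … , n-1,
-- shifted by one; one of type Fin n for the index i = 0 , … , n-1.
data Rel₁ (n : ℕ) : Set where
  A₀ : Fin n → Rel₁ n
  A₁ : Rel₁ n
  A₂ : Fin n → Rel₁ n

data Idem₁ (n : ℕ) : Set where
  E₀ E₁ E₂ : Idem₁ n
  E₃ E₄    : Fin (n ∸ 1) → Idem₁ n

data Rel₂ (n : ℕ) : Set where
  A₀ : Fin n → Rel₂ n
  A₁ : Rel₂ n
  A₂ : Fin n → Rel₂ n
  A₃ : Rel₂ n

data Idem₂ (n : ℕ) : Set where
  E₀ E₁ E₂₁ E₂₂ : Idem₂ n
  E₃ E₄         : Fin (n ∸ 1) → Idem₂ n

<⇒∸-nonZero : ∀ {k v} → k ℕ.< v → NonZero (v ∸ k)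
<⇒∸-nonZero k<v = ℕ.>-nonZero (ℕ.m<n⇒0<n∸m k<v)

module _ (n : ℕ) .{{_ : NonZero n}} where

  0ₙ : Fin n
  0ₙ = fromℕ< (ℕ.>-nonZero⁻¹ n)

  _-ₙ_ : Fin n → Fin n → Fin n
  a -ₙ b = (toℕ a + (n ∸ toℕ b)) mod n

  2π/n : ℝ
  2π/n = fromℚ (+ 2 / n) *ʳ π

  w^ w^- : Fin n → Fin (n ∸ 1) → ℂ
  w^  i j = (e^i 2π/n) ^ᶜ (toℕ i * ℕ.suc (toℕ j))
  w^- i j = (e^i (-ʳ 2π/n)) ^ᶜ (toℕ i * ℕ.suc (toℕ j))

  module _ (v k : ℕ) .{{_ : NonZero k}} where

    √k : ℂ
    √k = real (√ (+ k / 1))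

    -- v/√k, with its denominator rationalised
    v/√k : ℂ
    v/√k = real (fromℚ (+ v / k) *ʳ √ (+ k / 1))

    P₁ : Idem₁ n → Rel₁ n → ℂ
    P₁ E₀     (A₀ i) = # 1
    P₁ E₀     A₁     = # (n * (v ∸ 1))
    P₁ E₀     (A₂ i) = # k
    P₁ E₁     (A₀ i) = # 1
    P₁ E₁     A₁     = # (n * (v ∸ 1))
    P₁ E₁     (A₂ i) = -ᶜ # k
    P₁ E₂     (A₀ i) = # 1
    P₁ E₂     A₁     = -ᶜ # n
    P₁ E₂     (A₂ i) = # 0
    P₁ (E₃ j) (A₀ i) = w^- i j
    P₁ (E₃ j) A₁     = # 0
    P₁ (E₃ j) (A₂ i) = √k *ᶜ w^- i j
    P₁ (E₄ j) (A₀ i) = w^- i j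
    P₁ (E₄ j) A₁     = # 0
    P₁ (E₄ j) (A₂ i) = -ᶜ √k *ᶜ w^- i j

    Q₁ : Rel₁ n → Idem₁ n → ℂ
    Q₁ (A₀ i) E₀     = # 1
    Q₁ (A₀ i) E₁     = # 1
    Q₁ (A₀ i) E₂     = # (2 * (v ∸ 1))
    Q₁ (A₀ i) (E₃ j) = # v *ᶜ w^ i j
    Q₁ (A₀ i) (E₄ j) = # v *ᶜ w^ i j
    Q₁ A₁     E₀     = # 1
    Q₁ A₁     E₁     = # 1
    Q₁ A₁     E₂     = -ᶜ # 2
    Q₁ A₁     (E₃ j) = # 0
    Q₁ A₁     (E₄ j) = # 0
    Q₁ (A₂ i) E₀     = # 1
    Q₁ (A₂ i) E₁     = -ᶜ # 1
    Q₁ (A₂ i) E₂     = # 0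
    Q₁ (A₂ i) (E₃ j) = v/√k *ᶜ w^ i j
    Q₁ (A₂ i) (E₄ j) = -ᶜ v/√k *ᶜ w^ i j

    module _ (2≤v : 2 ℕ.≤ v) where

      √[k[v-k]/[v-1]] : ℂ
      √[k[v-k]/[v-1]] = real (√ ((+ (k * (v ∸ k)) / (v ∸ 1)) {{<⇒∸-nonZero 2≤v}}))

      P₂ : Idem₂ n → Rel₂ n → ℂ
      P₂ E₀     (A₀ i) = # 1
      P₂ E₀     A₁     = # (n * (v ∸ 1))
      P₂ E₀     (A₂ i) = # k
      P₂ E₀     A₃     = # (n * (v ∸ k))
      P₂ E₁     (A₀ i) = # 1
      P₂ E₁     A₁     = # (n * (v ∸ 1))
      P₂ E₁     (A₂ i) = -ᶜ # k
      P₂ E₁     A₃     = -ᶜ # (n * (v ∸ k))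
      P₂ E₂₁    (A₀ i) = # 1
      P₂ E₂₁    A₁     = -ᶜ # n
      P₂ E₂₁    (A₂ i) = √[k[v-k]/[v-1]]
      P₂ E₂₁    A₃     = -ᶜ # n *ᶜ √[k[v-k]/[v-1]]
      P₂ E₂₂    (A₀ i) = # 1
      P₂ E₂₂    A₁     = -ᶜ # n
      P₂ E₂₂    (A₂ i) = -ᶜ √[k[v-k]/[v-1]]
      P₂ E₂₂    A₃     = # n *ᶜ √[k[v-k]/[v-1]]
      P₂ (E₃ j) (A₀ i) = w^- i j
      P₂ (E₃ j) A₁     = # 0
      P₂ (E₃ j) (A₂ i) = √k *ᶜ w^- i j
      P₂ (E₃ j) A₃     = # 0
      P₂ (E₄ j) (A₀ i) = w^- i j
      P₂ (E₄ j) A₁     = # 0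
      P₂ (E₄ j) (A₂ i) = -ᶜ √k *ᶜ w^- i j
      P₂ (E₄ j) A₃     = # 0

    module _ (k<v : k ℕ.< v) where

      √[[v-1][v-k]/k] √[[v-1]k/[v-k]] : ℂ
      √[[v-1][v-k]/k] = real (√ (+ ((v ∸ 1) * (v ∸ k)) / k))
      √[[v-1]k/[v-k]] = real (√ ((+ ((v ∸ 1) * k) / (v ∸ k)) {{<⇒∸-nonZero k<v}}))

      Q₂ : Rel₂ n → Idem₂ n → ℂ
      Q₂ (A₀ i) E₀     = # 1
      Q₂ (A₀ i) E₁     = # 1
      Q₂ (A₀ i) E₂₁    = # (v ∸ 1)
      Q₂ (A₀ i) E₂₂    = # (v ∸ 1)
      Q₂ (A₀ i) (E₃ j) = # v *ᶜ w^ i j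
      Q₂ (A₀ i) (E₄ j) = # v *ᶜ w^ i j
      Q₂ A₁     E₀     = # 1
      Q₂ A₁     E₁     = # 1
      Q₂ A₁     E₂₁    = -ᶜ # 1
      Q₂ A₁     E₂₂    = -ᶜ # 1
      Q₂ A₁     (E₃ j) = # 0
      Q₂ A₁     (E₄ j) = # 0
      Q₂ (A₂ i) E₀     = # 1
      Q₂ (A₂ i) E₁     = -ᶜ # 1
      Q₂ (A₂ i) E₂₁    = √[[v-1][v-k]/k]
      Q₂ (A₂ i) E₂₂    = -ᶜ √[[v-1][v-k]/k]
      Q₂ (A₂ i) (E₃ j) = v/√k *ᶜ w^ i j
      Q₂ (A₂ i) (E₄ j) = -ᶜ v/√k *ᶜ w^ i j
      Q₂ A₃     E₀     = # 1
      Q₂ A₃     E₁     = -ᶜ # 1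
      Q₂ A₃     E₂₁    = -ᶜ √[[v-1]k/[v-k]]
      Q₂ A₃     E₂₂    = √[[v-1]k/[v-k]]
      Q₂ A₃     (E₃ j) = # 0
      Q₂ A₃     (E₄ j) = # 0

  differences : ∀ {v} → (Fin v → Fin v → Maybe (Fin n)) → Fin v → Fin v → List (Fin n)
  differences W i j = catMaybes (tabulate λ l → zipWith _-ₙ_ (W i l) (W j l))

  -- The entry nothing is the formal zero; just a is the element a of ℤₙ = Fin n.
  record IsBGW (v k : ℕ) (μ : ℚ) (W : Fin v → Fin v → Maybe (Fin n)) : Set where
    field
      row-weight : ∀ i → length (catMaybes (tabulate (W i))) ≡ k
      balanced   : ∀ i j → i ≢ j → ∀ g →
        + length (filter (_≟ g) (differences W i j)) / 1 ≡ μ ℚ.* (+ 1 / n)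

{-# OPTIONS --safe #-}
-- Equality of matrices in the Bose-Mesner algebra can be tested on eigenvalues, so the
-- eigenmatrices yield identities between products of adjacency matrices, which count
-- points.  The A_{0,i} are permutations and A_{0,i} A_{0,j} = A_{0,i+j} for i+j < n.
-- The relation T formed by A₁ and all A_{0,i} is, up to an affine change, |X| E₁; it is
-- an equivalence with two classes, exchanged by A_{2,0}.  As A₁ is stable under
-- τ = A_{0,1}, the point τⁿ x can only be x, so τ generates an action of ℤₙ whose orbits
-- cut each class of T into v blocks of size n.
-- The eigenvalues of A_{2,0} give A_{2,0}² = k A_{0,0} + (λ/n) A₁; hence A_{2,0} is
-- symmetric, meets each pair (point, block) at most once, and any two points related by
-- A₁ have λ/n common neighbours.  The position of the neighbour of the a-th block
-- representative of one class inside the b-th block of the other is the entry w_{ab}.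
module Submission where

open import Defs hiding (∑; _∈Span_)
open import Algebra.Bundles using (CommutativeMonoid; CommutativeRing)
import Algebra.Properties.Semiring.Sum as SemiringSum
open import Algebra.Structures using (IsCommutativeRing)
open import Data.Bool.Base using (Bool; true; false; if_then_else_; not)
import Data.Bool.Properties as Boolₚ
open import Data.Fin.Base using (Fin; zero; suc; toℕ; fromℕ<; punchIn; punchOut; inject)
open import Data.Fin.Properties using (_≟_; any?; all?; punchInᵢ≢i; punchIn-punchOut; toℕ-injective; toℕ-fromℕ<; toℕ<n; fromℕ<-toℕ; toℕ-inject; ¬∀⟶∃¬-smallest)
open import Data.Integer.Base as ℤ using (+_)
import Data.Integer.Properties as ℤₚ
open import Data.List.Base using (List; length; tabulate; catMaybes; filter; lookup; allFin)
open import Data.List.Membership.Propositional.Properties using (∈-lookup; ∈-filter⁺; ∈-filter⁻; ∈-allFin)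
import Data.List.Relation.Unary.All as All
import Data.List.Relation.Unary.Any as Any
open import Data.List.Relation.Unary.Any.Properties using (lookup-index)
open import Data.List.Relation.Unary.AllPairs using (_∷_)
open import Data.List.Relation.Unary.Unique.Propositional using (Unique)
open import Data.List.Relation.Unary.Unique.Propositional.Properties using (filter⁺; allFin⁺)
open import Data.Maybe.Base using (Maybe; just; nothing; is-just; zipWith)
open import Data.Nat.Base as ℕ using (ℕ; zero; suc; NonZero; z≤n; s≤s)
open import Data.Nat.DivMod as ℕ/ using (_mod_; _%_; m≡m%n+[m/n]*n; m%n<n; m<n⇒m%n≡m; m%n%n≡m%n; [m+n]%n≡m%n; %-distribˡ-+)
import Data.Nat.Properties as ℕₚ
import Data.Nat.Solver as ℕSolver
open import Data.Product.Base using (∃; ∃-syntax; Σ-syntax; _×_; _,_; proj₁; proj₂)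
open import Data.Rational.Base as ℚ using (ℚ; 0ℚ; 1ℚ; _/_)
import Data.Rational.Properties as ℚₚ
open import Data.Rational.Solver using (module +-*-Solver)
import Data.Rational.Unnormalised.Base as ℚᵘ
import Data.Rational.Unnormalised.Properties as ℚᵘₚ
open import Data.Sum.Base using (_⊎_; inj₁; inj₂)
open import Function.Base using (_∘_)
open import Function.Bundles using (Inverse)
open import Level using (0ℓ)
open import Relation.Binary.PropositionalEquality
  using (_≡_; _≢_; refl; sym; trans; cong; cong₂; subst; subst₂; module ≡-Reasoning)
open import Relation.Binary.Structures using (IsEquivalence)
open import Relation.Binary.Bundles using (Setoid)
open import Relation.Nullary using (¬_; Dec; yes; no; does; contradiction; ¬?; _×-dec_)
open import Relation.Nullary.Decidable using (decidable-stable; dec-true; dec-false)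
open import Relation.Unary using (Decidable)

-- Three obstacles shape the proof. The roots of unity w^(-ij) are powers of explicit Cauchy series,
-- and w^n = 1 would be a fact of analysis about them; the exponent law alone covers products of the
-- A_{0,i} whose indices add up to less than n, and the wrap-around is recovered afterwards by
-- counting points. Primitive idempotents are given as minimal and linearly independent, not as
-- orthogonal, so Eᵢ Eⱼ = 0 has to be derived before eigenvalues can be multiplied. Equality of
-- reals is a limit statement on which no case distinction is possible. Every matrix identity is
-- therefore carried over to ℕ as soon as its eigenvalues have been compared, and `ι-injective` is
-- the bridge. In ℕ neither subtraction nor division is available: T = (J + |X| E₁)/2 is handled as
-- 2T, the complement J - T through the identity R T + k T = k J, and the coefficient λ/n, which is
-- not known in advance to be an integer, through multiplication by n(v-1).

record NaturalsIn (K : CommutativeRing 0ℓ 0ℓ) : Set where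
  open CommutativeRing K
  field
    ι           : ℕ → Carrier
    ι-0         : ι 0 ≈ 0#
    ι-1         : ι 1 ≈ 1#
    ι-+         : ∀ m n → ι (m ℕ.+ n) ≈ ι m + ι n
    ι-*         : ∀ m n → ι (m ℕ.* n) ≈ ι m * ι n
    ι-injective : ∀ {m n} → ι m ≈ ι n → m ≡ n

-- Cauchy reals: congruence of the operations and the square of `√`.

module RealArithmetic where
  open Reals
  open import Data.Rational.Base using (_+_; _*_; _-_; -_; _≤_; _<_; ∣_∣)
  open +-*-Solver using (solve; _:+_; _:*_; _:-_; :-_; _:=_; con)

  -- The counterpart of `cauchy-lipschitz` for two sequences instead of two indices: the single
  -- ε-argument behind transitivity and behind the congruence of sum and product.
  ≈ʳ-lipschitz : ∀ (s t x x′ y y′ : ℕ → ℚ) A B → 0ℚ ≤ A → 0ℚ ≤ B →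
    (∀ ε → 0ℚ < ε → ∃[ N ] ∀ n → N ℕ.≤ n → ∣ x n - x′ n ∣ < ε) →
    (∀ ε → 0ℚ < ε → ∃[ N ] ∀ n → N ℕ.≤ n → ∣ y n - y′ n ∣ < ε) →
    (∀ n → ∣ s n - t n ∣ ≤ A * ∣ x n - x′ n ∣ + B * ∣ y n - y′ n ∣) →
    ∀ ε → 0ℚ < ε → ∃[ N ] ∀ n → N ℕ.≤ n → ∣ s n - t n ∣ < ε
  ≈ʳ-lipschitz s t x x′ y y′ A B 0≤A 0≤B x≈ y≈ bound ε 0<ε = N , λ n N≤n → begin-strict
      ∣ s n - t n ∣ ≤⟨ bound n ⟩
      A * ∣ x n - x′ n ∣ + B * ∣ y n - y′ n ∣
        ≤⟨ ℚₚ.+-mono-≤ (*-monoˡ 0≤A (ℚₚ.<⇒≤ (proj₂ Nx n (ℕₚ.≤-trans (ℕₚ.m≤m⊔n (proj₁ Nx) (proj₁ Ny)) N≤n))))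
                      (*-monoˡ 0≤B (ℚₚ.<⇒≤ (proj₂ Ny n (ℕₚ.≤-trans (ℕₚ.m≤n⊔m (proj₁ Nx) (proj₁ Ny)) N≤n)))) ⟩
      A * δ + B * δ ≡⟨ ℚₚ.*-distribʳ-+ δ A B ⟨
      (A + B) * δ <⟨ proj₂ (proj₂ sc) ⟩
      ε ∎
    where
    open ℚₚ.≤-Reasoning
    sc = scale (A + B) ε (+-≥0 0≤A 0≤B) 0<ε
    δ = proj₁ sc
    Nx = x≈ δ (proj₁ (proj₂ sc))
    Ny = y≈ δ (proj₁ (proj₂ sc))
    N = proj₁ Nx ℕ.⊔ proj₁ Ny

  -- The operations act termwise, so each ring law of ℝ and of ℂ reduces to a rational identity at
  -- every index.
  pointwise : ∀ x y → (∀ n → seq x n ≡ seq y n) → x ≈ʳ y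
  pointwise x y eq ε 0<ε = 0 , λ n _ →
    ∣0∣<ε (trans (cong (_- seq y n) (eq n)) (ℚₚ.+-inverseʳ (seq y n))) 0<ε

  ≈ʳ-refl : ∀ x → x ≈ʳ x
  ≈ʳ-refl x = pointwise x x λ _ → refl

  ≈ʳ-sym : ∀ x y → x ≈ʳ y → y ≈ʳ x
  ≈ʳ-sym x y x≈y ε 0<ε = proj₁ (x≈y ε 0<ε) , λ n N≤n →
    subst (_< ε) (∣-∣-sym (seq x n) (seq y n)) (proj₂ (x≈y ε 0<ε) n N≤n)

  private
    0≤1 : 0ℚ ≤ 1ℚ
    0≤1 = ℚₚ.<⇒≤ 0<1

    triangle : ∀ s t a b → s - t ≡ a + b → ∣ s - t ∣ ≤ 1ℚ * ∣ a ∣ + 1ℚ * ∣ b ∣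
    triangle s t a b eq = begin
      ∣ s - t ∣               ≡⟨ cong ∣_∣ eq ⟩
      ∣ a + b ∣               ≤⟨ ℚₚ.∣p+q∣≤∣p∣+∣q∣ a b ⟩
      ∣ a ∣ + ∣ b ∣           ≡⟨ cong₂ _+_ (ℚₚ.*-identityˡ ∣ a ∣) (ℚₚ.*-identityˡ ∣ b ∣) ⟨
      1ℚ * ∣ a ∣ + 1ℚ * ∣ b ∣ ∎
      where open ℚₚ.≤-Reasoning

  ≈ʳ-trans : ∀ x y z → x ≈ʳ y → y ≈ʳ z → x ≈ʳ z
  ≈ʳ-trans x y z x≈y y≈z =
    ≈ʳ-lipschitz (seq x) (seq z) (seq x) (seq y) (seq y) (seq z) 1ℚ 1ℚ 0≤1 0≤1 x≈y y≈z λ n →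
      triangle (seq x n) (seq z n) (seq x n - seq y n) (seq y n - seq z n)
        (solve 3 (λ x y z → x :- z := (x :- y) :+ (y :- z)) refl (seq x n) (seq y n) (seq z n))

  +ʳ-cong : ∀ x x′ y y′ → x ≈ʳ x′ → y ≈ʳ y′ → x +ʳ y ≈ʳ x′ +ʳ y′
  +ʳ-cong x x′ y y′ x≈ y≈ =
    ≈ʳ-lipschitz (seq (x +ʳ y)) (seq (x′ +ʳ y′)) (seq x) (seq x′) (seq y) (seq y′) 1ℚ 1ℚ 0≤1 0≤1 x≈ y≈ λ n →
      triangle (seq (x +ʳ y) n) (seq (x′ +ʳ y′) n) (seq x n - seq x′ n) (seq y n - seq y′ n)
        (solve 4 (λ x x′ y y′ → x :+ y :- (x′ :+ y′) := (x :- x′) :+ (y :- y′)) refl (seq x n) (seq x′ n) (seq y n) (seq y′ n))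

  -ʳ-cong : ∀ x x′ → x ≈ʳ x′ → -ʳ x ≈ʳ -ʳ x′
  -ʳ-cong x x′ x≈ ε 0<ε = proj₁ (x≈ ε 0<ε) , λ n N≤n →
    subst (_< ε) (trans (∣-∣-sym (seq x n) (seq x′ n))
        (cong ∣_∣ (solve 2 (λ x x′ → x′ :- x := :- x :- :- x′) refl (seq x n) (seq x′ n))))
      (proj₂ (x≈ ε 0<ε) n N≤n)

  *ʳ-cong : ∀ x x′ y y′ → x ≈ʳ x′ → y ≈ʳ y′ → x *ʳ y ≈ʳ x′ *ʳ y′
  -- The splitting xy - x′y′ = y(x - x′) + x′(y - y′) requires bounds for `y` and `x′` only.
  *ʳ-cong x x′ y y′ x≈ y≈ = go (cauchy-bounded (seq y) (cauchy y)) (cauchy-bounded (seq x′) (cauchy x′))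
    where
    go : (∃[ B ] ∀ n → ∣ seq y n ∣ ≤ fromℕ B) → (∃[ A ] ∀ n → ∣ seq x′ n ∣ ≤ fromℕ A) → x *ʳ y ≈ʳ x′ *ʳ y′
    go (B , y≤B) (A , x≤A) =
      ≈ʳ-lipschitz (seq (x *ʳ y)) (seq (x′ *ʳ y′)) (seq x) (seq x′) (seq y) (seq y′)
        (fromℕ B) (fromℕ A) (fromℕ-≥0 B) (fromℕ-≥0 A) x≈ y≈ λ n → begin
          ∣ seq x n * seq y n - seq x′ n * seq y′ n ∣
            ≡⟨ cong ∣_∣ (solve 4 (λ a b c d → a :* b :- c :* d := b :* (a :- c) :+ c :* (b :- d)) refl (seq x n) (seq y n) (seq x′ n) (seq y′ n)) ⟩
          ∣ seq y n * (seq x n - seq x′ n) + seq x′ n * (seq y n - seq y′ n) ∣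
            ≤⟨ ℚₚ.∣p+q∣≤∣p∣+∣q∣ (seq y n * (seq x n - seq x′ n)) (seq x′ n * (seq y n - seq y′ n)) ⟩
          ∣ seq y n * (seq x n - seq x′ n) ∣ + ∣ seq x′ n * (seq y n - seq y′ n) ∣
            ≡⟨ cong₂ _+_ (ℚₚ.∣p*q∣≡∣p∣*∣q∣ (seq y n) (seq x n - seq x′ n)) (ℚₚ.∣p*q∣≡∣p∣*∣q∣ (seq x′ n) (seq y n - seq y′ n)) ⟩
          ∣ seq y n ∣ * ∣ seq x n - seq x′ n ∣ + ∣ seq x′ n ∣ * ∣ seq y n - seq y′ n ∣
            ≤⟨ ℚₚ.+-mono-≤ (*-monoʳ (ℚₚ.0≤∣p∣ (seq x n - seq x′ n)) (y≤B n)) (*-monoʳ (ℚₚ.0≤∣p∣ (seq y n - seq y′ n)) (x≤A n)) ⟩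
          fromℕ B * ∣ seq x n - seq x′ n ∣ + fromℕ A * ∣ seq y n - seq y′ n ∣ ∎
      where open ℚₚ.≤-Reasoning

  -- If ∣p - q∣ were positive it could serve as ε, and some term would give ∣p - q∣ < ∣p - q∣.
  fromℚ-injective : ∀ p q → fromℚ p ≈ʳ fromℚ q → p ≡ q
  fromℚ-injective p q p≈q = p≡q (ℚₚ.∣p∣≡0⇒p≡0 (p - q) (ℚₚ.≤-antisym (ℚₚ.≮⇒≥ λ 0<d →
    let N , h = p≈q ∣ p - q ∣ 0<d in ℚₚ.<-irrefl refl (h N ℕₚ.≤-refl)) (ℚₚ.0≤∣p∣ (p - q))))
    where
    p≡q : p - q ≡ 0ℚ → p ≡ q
    p≡q eq = trans (solve 2 (λ p q → p := p :- q :+ q) refl p q) (trans (cong (_+ q) eq) (ℚₚ.+-identityˡ q))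

  fromℕ-* : ∀ m n → fromℕ (m ℕ.* n) ≡ fromℕ m * fromℕ n
  fromℕ-* zero    n = sym (ℚₚ.*-zeroˡ (fromℕ n))
  fromℕ-* (suc m) n = begin
    fromℕ (n ℕ.+ m ℕ.* n)           ≡⟨ fromℕ-+ n (m ℕ.* n) ⟩
    fromℕ n + fromℕ (m ℕ.* n)       ≡⟨ cong (λ z → fromℕ n + z) (fromℕ-* m n) ⟩
    fromℕ n + fromℕ m * fromℕ n     ≡⟨ solve 2 (λ m n → n :+ m :* n := (m :+ con 1ℚ) :* n) refl (fromℕ m) (fromℕ n) ⟩
    (fromℕ m + 1ℚ) * fromℕ n        ≡⟨ cong (_* fromℕ n) (fromℕ-suc m) ⟩
    fromℕ (suc m) * fromℕ n         ∎
    where open ≡-Reasoning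

  fromℕ-injective : ∀ {m n} → fromℕ m ≡ fromℕ n → m ≡ n
  fromℕ-injective {m} {n} eq =
    trans (sym (ℕₚ.*-identityʳ m)) (trans (ℚₚ.normalize-injective-≃ m n 1 1 eq) (ℕₚ.*-identityʳ n))

  /-fromℕ : ∀ m d .{{_ : ℕ.NonZero d}} → (+ m / d) * fromℕ d ≡ fromℕ m
  /-fromℕ m d@(suc _) = ℚₚ.toℚᵘ-injective (begin
      ℚ.toℚᵘ ((+ m / d) * fromℕ d)              ≈⟨ ℚₚ.toℚᵘ-homo-* (+ m / d) (fromℕ d) ⟩
      ℚ.toℚᵘ (+ m / d) ℚᵘ.* ℚ.toℚᵘ (fromℕ d)    ≈⟨ ℚᵘₚ.*-cong (toℚᵘ-/ (+ m) d) (toℚᵘ-/ (+ d) 1) ⟩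
      (+ m ℚᵘ./ d) ℚᵘ.* (+ d ℚᵘ./ 1)            ≈⟨ ℚᵘ.*≡* (trans (ℤₚ.*-identityʳ (+ m ℤ.* + d)) (cong (λ z → + m ℤ.* + z) (sym (ℕₚ.*-identityʳ d)))) ⟩
      + m ℚᵘ./ 1                                ≈⟨ toℚᵘ-/ (+ m) 1 ⟨
      ℚ.toℚᵘ (fromℕ m) ∎)
    where open ℚᵘₚ.≃-Reasoning

  fromℕ-pos : ∀ d .{{_ : ℕ.NonZero d}} → 0ℚ < fromℕ d
  fromℕ-pos (suc d) = ℚₚ.<-≤-trans 0<1 (fromℕ-mono (ℕ.s≤s {n = d} ℕ.z≤n))

  -- `sqrtApprox` works with the absolute value of the numerator; this is where the sign of `q`
  -- enters.
  ↥-fromℕ : ∀ q → 0ℚ ≤ q → q * fromℕ (ℚ.↧ₙ q) ≡ fromℕ ℤ.∣ ℚ.↥ q ∣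
  ↥-fromℕ q@record{} 0≤q = trans (cong (_* fromℕ (ℚ.↧ₙ q)) (sym eq)) (/-fromℕ ℤ.∣ ℚ.↥ q ∣ (ℚ.↧ₙ q))
    where
    eq : + ℤ.∣ ℚ.↥ q ∣ / ℚ.↧ₙ q ≡ q
    eq = trans (cong (λ z → z / ℚ.↧ₙ q) (ℤₚ.0≤i⇒+∣i∣≡i (ℤₚ.nonNegative⁻¹ (ℚ.↥ q) {{ℚ.nonNegative 0≤q}}))) (ℚₚ.↥p/↧p≡p q)

  -- `isqrt` rounds down, so the approximation x with step e = 1/(N+1) satisfies x² ≤ q ≤ (x + e)².
  -- The gap (2x + e)e is at most (2B + 1)e for a bound B of the sequence, and tends to 0.
  √-square : ∀ q → 0ℚ ≤ q → √ q *ʳ √ q ≈ʳ fromℚ q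
  √-square q 0≤q ε 0<ε = go (cauchy-bounded (seq (√ q)) (cauchy (√ q)))
    where
    d = ℚ.↧ₙ q
    D = fromℕ d
    instance _ = ℚ.positive (fromℕ-pos d)

    module _ (N : ℕ) where
      open ℚₚ.≤-Reasoning
      e = 1/suc N
      s = fromℕ (suc N)
      r = sqrtApprox q N
      x = seq (√ q) N
      p = ℤ.∣ ℚ.↥ q ∣ ℕ.* (suc N ℕ.* suc N)

      0≤e : 0ℚ ≤ e
      0≤e = ℚₚ.<⇒≤ (1/suc-pos N)

      s*e : s * e ≡ 1ℚ
      s*e = 1/suc-inverse N

      p-eq : fromℕ p * (e * e) ≡ q * D
      p-eq = begin-equality
        fromℕ p * (e * e)                         ≡⟨ cong (_* (e * e)) (trans (fromℕ-* ℤ.∣ ℚ.↥ q ∣ (suc N ℕ.* suc N)) (cong₂ _*_ (sym (↥-fromℕ q 0≤q)) (fromℕ-* (suc N) (suc N)))) ⟩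
        q * D * (s * s) * (e * e)                 ≡⟨ solve 3 (λ a s e → a :* (s :* s) :* (e :* e) := a :* (s :* e) :* (s :* e)) refl (q * D) s e ⟩
        q * D * (s * e) * (s * e)                 ≡⟨ cong (λ z → q * D * z * z) s*e ⟩
        q * D * 1ℚ * 1ℚ                           ≡⟨ solve 1 (λ a → a :* con 1ℚ :* con 1ℚ := a) refl (q * D) ⟩
        q * D                                     ∎

      square : ∀ m → fromℕ ((m ℕ.* m) ℕ.* d) * (e * e) ≡ (fromℕ m * e) * (fromℕ m * e) * D
      square m = trans (cong (_* (e * e)) (trans (fromℕ-* (m ℕ.* m) d) (cong (_* D) (fromℕ-* m m))))
        (solve 3 (λ m d e → m :* m :* d :* (e :* e) := (m :* e) :* (m :* e) :* d) refl (fromℕ m) D e)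

      x-eq : x ≡ fromℕ r * e
      x-eq = begin-equality
        x              ≡⟨ ℚₚ.*-identityʳ x ⟨
        x * 1ℚ         ≡⟨ cong (x *_) s*e ⟨
        x * (s * e)    ≡⟨ ℚₚ.*-assoc x s e ⟨
        x * s * e      ≡⟨ cong (_* e) (/-fromℕ r (suc N)) ⟩
        fromℕ r * e    ∎

      lower : x * x ≤ q
      lower = ℚₚ.*-cancelʳ-≤-pos D (begin
        x * x * D                            ≡⟨ cong (λ z → z * z * D) x-eq ⟩
        (fromℕ r * e) * (fromℕ r * e) * D    ≡⟨ square r ⟨
        fromℕ ((r ℕ.* r) ℕ.* d) * (e * e)    ≤⟨ *-monoʳ (*-≥0 0≤e 0≤e) (fromℕ-mono (proj₁ (sqrtApprox-spec q N))) ⟩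
        fromℕ p * (e * e)                    ≡⟨ p-eq ⟩
        q * D                                ∎)

      upper : q ≤ (x + e) * (x + e)
      upper = ℚₚ.*-cancelʳ-≤-pos D (begin
        q * D                                            ≡⟨ p-eq ⟨
        fromℕ p * (e * e)                                ≤⟨ *-monoʳ (*-≥0 0≤e 0≤e) (fromℕ-mono (ℕₚ.<⇒≤ (proj₂ (sqrtApprox-spec q N)))) ⟩
        fromℕ ((suc r ℕ.* suc r) ℕ.* d) * (e * e)        ≡⟨ square (suc r) ⟩
        (fromℕ (suc r) * e) * (fromℕ (suc r) * e) * D    ≡⟨ cong (λ z → z * z * D) (trans (cong (_* e) (sym (fromℕ-suc r))) (trans (solve 2 (λ r e → (r :+ con 1ℚ) :* e := r :* e :+ e) refl (fromℕ r) e) (cong (_+ e) (sym x-eq)))) ⟩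
        (x + e) * (x + e) * D                            ∎)

      module _ (B : ℕ) (x≤B : ∣ x ∣ ≤ fromℕ B) where
        c = fromℕ B + fromℕ B + 1ℚ

        close : ∣ x * x - q ∣ ≤ c * e
        close = ∣-∣≤ (ℚₚ.≤-trans lower (p≤p+q (*-≥0 (+-≥0 (+-≥0 (fromℕ-≥0 B) (fromℕ-≥0 B)) (ℚₚ.<⇒≤ 0<1)) 0≤e))) (begin
          q                             ≤⟨ upper ⟩
          (x + e) * (x + e)             ≡⟨ solve 2 (λ x e → (x :+ e) :* (x :+ e) := x :* x :+ (x :+ x :+ e) :* e) refl x e ⟩
          x * x + (x + x + e) * e       ≤⟨ ℚₚ.+-monoʳ-≤ (x * x) (*-monoʳ 0≤e (ℚₚ.+-mono-≤ (ℚₚ.+-mono-≤ x≤ x≤) (1/suc-antitone {0} {N} ℕ.z≤n))) ⟩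
          x * x + c * e                 ∎)
          where x≤ = ℚₚ.≤-trans (p≤∣p∣ x) x≤B

    go : (∃[ B ] ∀ n → ∣ seq (√ q) n ∣ ≤ fromℕ B) → ∃[ N ] ∀ n → N ℕ.≤ n → ∣ seq (√ q *ʳ √ q) n - q ∣ < ε
    go (B , x≤B) = proj₁ small , λ n N≤n → ℚₚ.≤-<-trans (close n B (x≤B n)) (proj₂ small n N≤n)
      where small = shrink (fromℕ B + fromℕ B + 1ℚ) ε 0<ε

-- ℂ as a commutative ring containing ℕ.

module ComplexRing where
  open Reals using (seq; fromℕ; fromℕ-+)
  open RealArithmetic
  open import Data.Rational.Base using (_+_; _*_; _-_; -_)
  open +-*-Solver using (solve; _:+_; _:*_; :-_; _:=_; con; Polynomial)

  pointwiseᶜ : ∀ z w → (∀ n → seq (re z) n ≡ seq (re w) n) → (∀ n → seq (im z) n ≡ seq (im w) n) → z ≈ᶜ w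
  pointwiseᶜ z w eq eq′ = pointwise (re z) (re w) eq , pointwise (im z) (im w) eq′

  ≈ᶜ-isEquivalence : IsEquivalence _≈ᶜ_
  ≈ᶜ-isEquivalence = record
    { refl  = λ {z} → ≈ʳ-refl (re z) , ≈ʳ-refl (im z)
    ; sym   = λ {z} {w} z≈w → ≈ʳ-sym (re z) (re w) (proj₁ z≈w) , ≈ʳ-sym (im z) (im w) (proj₂ z≈w)
    ; trans = λ {z} {w} {u} z≈w w≈u →
        ≈ʳ-trans (re z) (re w) (re u) (proj₁ z≈w) (proj₁ w≈u) , ≈ʳ-trans (im z) (im w) (im u) (proj₂ z≈w) (proj₂ w≈u)
    }

  ≈ᶜ-setoid : Setoid 0ℓ 0ℓ
  ≈ᶜ-setoid = record { isEquivalence = ≈ᶜ-isEquivalence }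

  +ᶜ-cong : ∀ {z z′ w w′} → z ≈ᶜ z′ → w ≈ᶜ w′ → z +ᶜ w ≈ᶜ z′ +ᶜ w′
  +ᶜ-cong {z} {z′} {w} {w′} z≈ w≈ =
      +ʳ-cong (re z) (re z′) (re w) (re w′) (proj₁ z≈) (proj₁ w≈)
    , +ʳ-cong (im z) (im z′) (im w) (im w′) (proj₂ z≈) (proj₂ w≈)

  -ᶜ-cong : ∀ {z z′} → z ≈ᶜ z′ → -ᶜ z ≈ᶜ -ᶜ z′
  -ᶜ-cong {z} {z′} z≈ = -ʳ-cong (re z) (re z′) (proj₁ z≈) , -ʳ-cong (im z) (im z′) (proj₂ z≈)

  *ᶜ-cong : ∀ {z z′ w w′} → z ≈ᶜ z′ → w ≈ᶜ w′ → z *ᶜ w ≈ᶜ z′ *ᶜ w′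
  *ᶜ-cong {a +i b} {a′ +i b′} {c +i d} {c′ +i d′} (a≈ , b≈) (c≈ , d≈) =
      +ʳ-cong (a *ʳ c) (a′ *ʳ c′) (-ʳ (b *ʳ d)) (-ʳ (b′ *ʳ d′)) (*ʳ-cong a a′ c c′ a≈ c≈)
        (-ʳ-cong (b *ʳ d) (b′ *ʳ d′) (*ʳ-cong b b′ d d′ b≈ d≈))
    , +ʳ-cong (a *ʳ d) (a′ *ʳ d′) (b *ʳ c) (b′ *ʳ c′) (*ʳ-cong a a′ d d′ a≈ d≈) (*ʳ-cong b b′ c c′ b≈ c≈)

  private
    -- Complex multiplication on pairs of solver polynomials, so that the solver can treat real and
    -- imaginary parts one at a time.
    _:*re_ _:*im_ : ∀ {m} → Polynomial m × Polynomial m → Polynomial m × Polynomial m → Polynomial m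
    (a , b) :*re (c , d) = a :* c :+ :- (b :* d)
    (a , b) :*im (c , d) = a :* d :+ b :* c

    _:*ᶜ_ _:+ᶜ_ : ∀ {m} → Polynomial m × Polynomial m → Polynomial m × Polynomial m → Polynomial m × Polynomial m
    z :*ᶜ w = z :*re w , z :*im w
    (a , b) :+ᶜ (c , d) = a :+ c , b :+ d

  *ᶜ-assoc : ∀ z w u → (z *ᶜ w) *ᶜ u ≈ᶜ z *ᶜ (w *ᶜ u)
  *ᶜ-assoc z w u = pointwiseᶜ ((z *ᶜ w) *ᶜ u) (z *ᶜ (w *ᶜ u))
    (λ n → solve 6 (λ a b c d e f → (((a , b) :*ᶜ (c , d)) :*re (e , f)) := ((a , b) :*re ((c , d) :*ᶜ (e , f)))) refl
       (seq (re z) n) (seq (im z) n) (seq (re w) n) (seq (im w) n) (seq (re u) n) (seq (im u) n))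
    (λ n → solve 6 (λ a b c d e f → (((a , b) :*ᶜ (c , d)) :*im (e , f)) := ((a , b) :*im ((c , d) :*ᶜ (e , f)))) refl
       (seq (re z) n) (seq (im z) n) (seq (re w) n) (seq (im w) n) (seq (re u) n) (seq (im u) n))

  *ᶜ-comm : ∀ z w → z *ᶜ w ≈ᶜ w *ᶜ z
  *ᶜ-comm z w = pointwiseᶜ (z *ᶜ w) (w *ᶜ z)
    (λ n → solve 4 (λ a b c d → ((a , b) :*re (c , d)) := ((c , d) :*re (a , b))) refl
       (seq (re z) n) (seq (im z) n) (seq (re w) n) (seq (im w) n))
    (λ n → solve 4 (λ a b c d → ((a , b) :*im (c , d)) := ((c , d) :*im (a , b))) refl
       (seq (re z) n) (seq (im z) n) (seq (re w) n) (seq (im w) n))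

  *ᶜ-identityˡ : ∀ z → # 1 *ᶜ z ≈ᶜ z
  *ᶜ-identityˡ z = pointwiseᶜ (# 1 *ᶜ z) z
    (λ n → solve 2 (λ a b → con 1ℚ :* a :+ :- (con 0ℚ :* b) := a) refl (seq (re z) n) (seq (im z) n))
    (λ n → solve 2 (λ a b → con 1ℚ :* b :+ con 0ℚ :* a := b) refl (seq (re z) n) (seq (im z) n))

  distribˡ : ∀ u z w → u *ᶜ (z +ᶜ w) ≈ᶜ u *ᶜ z +ᶜ u *ᶜ w
  distribˡ u z w = pointwiseᶜ (u *ᶜ (z +ᶜ w)) (u *ᶜ z +ᶜ u *ᶜ w)
    (λ n → solve 6 (λ a b c d e f → ((e , f) :*re ((a , b) :+ᶜ (c , d))) := ((e , f) :*re (a , b)) :+ ((e , f) :*re (c , d))) refl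
       (seq (re z) n) (seq (im z) n) (seq (re w) n) (seq (im w) n) (seq (re u) n) (seq (im u) n))
    (λ n → solve 6 (λ a b c d e f → ((e , f) :*im ((a , b) :+ᶜ (c , d))) := ((e , f) :*im (a , b)) :+ ((e , f) :*im (c , d))) refl
       (seq (re z) n) (seq (im z) n) (seq (re w) n) (seq (im w) n) (seq (re u) n) (seq (im u) n))

  +ᶜ-assoc : ∀ z w u → (z +ᶜ w) +ᶜ u ≈ᶜ z +ᶜ (w +ᶜ u)
  +ᶜ-assoc z w u = pointwiseᶜ ((z +ᶜ w) +ᶜ u) (z +ᶜ (w +ᶜ u))
    (λ n → ℚₚ.+-assoc (seq (re z) n) (seq (re w) n) (seq (re u) n))
    (λ n → ℚₚ.+-assoc (seq (im z) n) (seq (im w) n) (seq (im u) n))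

  +ᶜ-comm : ∀ z w → z +ᶜ w ≈ᶜ w +ᶜ z
  +ᶜ-comm z w = pointwiseᶜ (z +ᶜ w) (w +ᶜ z)
    (λ n → ℚₚ.+-comm (seq (re z) n) (seq (re w) n)) (λ n → ℚₚ.+-comm (seq (im z) n) (seq (im w) n))

  +ᶜ-identityˡ : ∀ z → # 0 +ᶜ z ≈ᶜ z
  +ᶜ-identityˡ z = pointwiseᶜ (# 0 +ᶜ z) z
    (λ n → ℚₚ.+-identityˡ (seq (re z) n)) (λ n → ℚₚ.+-identityˡ (seq (im z) n))

  -ᶜ-inverseˡ : ∀ z → -ᶜ z +ᶜ z ≈ᶜ # 0
  -ᶜ-inverseˡ z = pointwiseᶜ (-ᶜ z +ᶜ z) (# 0)
    (λ n → ℚₚ.+-inverseˡ (seq (re z) n)) (λ n → ℚₚ.+-inverseˡ (seq (im z) n))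

  ℂ-isCommutativeRing : IsCommutativeRing _≈ᶜ_ _+ᶜ_ _*ᶜ_ -ᶜ_ (# 0) (# 1)
  ℂ-isCommutativeRing = record
    { isRing = record
      { +-isAbelianGroup = record
        { isGroup = record
          { isMonoid = record
            { isSemigroup = record
              { isMagma = record { isEquivalence = ≈ᶜ-isEquivalence ; ∙-cong = λ {z} {z′} {w} {w′} → +ᶜ-cong {z} {z′} {w} {w′} }
              ; assoc   = +ᶜ-assoc
              }
            ; identity = +ᶜ-identityˡ , comm∧idˡ⇒idʳ {_∙_ = _+ᶜ_} +ᶜ-comm {# 0} +ᶜ-identityˡ
            }
          ; inverse = -ᶜ-inverseˡ , comm∧invˡ⇒invʳ {_∙_ = _+ᶜ_} { -ᶜ_} {# 0} +ᶜ-comm -ᶜ-inverseˡ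
          ; ⁻¹-cong = λ {z} {z′} → -ᶜ-cong {z} {z′}
          }
        ; comm = +ᶜ-comm
        }
      ; *-cong     = λ {z} {z′} {w} {w′} → *ᶜ-cong {z} {z′} {w} {w′}
      ; *-assoc    = *ᶜ-assoc
      ; *-identity = *ᶜ-identityˡ , comm∧idˡ⇒idʳ {_∙_ = _*ᶜ_} *ᶜ-comm {# 1} *ᶜ-identityˡ
      ; distrib    = distribˡ , comm∧distrˡ⇒distrʳ {_∙_ = _*ᶜ_} {_◦_ = _+ᶜ_} (λ {z} {z′} {w} {w′} → +ᶜ-cong {z} {z′} {w} {w′}) *ᶜ-comm distribˡ
      }
    ; *-comm = *ᶜ-comm
    }
    where
    open import Algebra.Consequences.Setoid ≈ᶜ-setoid

  ℂ-commutativeRing : CommutativeRing 0ℓ 0ℓ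
  ℂ-commutativeRing = record { isCommutativeRing = ℂ-isCommutativeRing }

  #-+ : ∀ m n → # (m ℕ.+ n) ≈ᶜ # m +ᶜ # n
  #-+ m n = pointwiseᶜ (# (m ℕ.+ n)) (# m +ᶜ # n) (λ _ → fromℕ-+ m n) (λ _ → refl)

  real-* : ∀ x y → real (x *ʳ y) ≈ᶜ real x *ᶜ real y
  real-* x y = pointwiseᶜ (real (x *ʳ y)) (real x *ᶜ real y)
    (λ n → solve 2 (λ a b → a :* b := a :* b :+ :- (con 0ℚ :* con 0ℚ)) refl (seq x n) (seq y n))
    (λ n → solve 2 (λ a b → con 0ℚ := a :* con 0ℚ :+ con 0ℚ :* b) refl (seq x n) (seq y n))

  real-cong : ∀ x y → x ≈ʳ y → real x ≈ᶜ real y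
  real-cong x y x≈y = x≈y , ≈ʳ-refl (fromℚ 0ℚ)

  open IsEquivalence ≈ᶜ-isEquivalence using () renaming (refl to ≈ᶜ-refl; trans to ≈ᶜ-trans; sym to ≈ᶜ-sym)

  real-ℚ : ∀ p q r → p ℚ.* q ≡ r → real (fromℚ p) *ᶜ real (fromℚ q) ≈ᶜ real (fromℚ r)
  real-ℚ p q r eq = ≈ᶜ-trans {real (fromℚ p) *ᶜ real (fromℚ q)} {real (fromℚ p *ʳ fromℚ q)} {real (fromℚ r)}
    (≈ᶜ-sym {real (fromℚ p *ʳ fromℚ q)} {real (fromℚ p) *ᶜ real (fromℚ q)} (real-* (fromℚ p) (fromℚ q)))
    (pointwiseᶜ (real (fromℚ p *ʳ fromℚ q)) (real (fromℚ r)) (λ _ → eq) (λ _ → refl))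

  #-* : ∀ m n → # (m ℕ.* n) ≈ᶜ # m *ᶜ # n
  #-* m n = ≈ᶜ-sym {# m *ᶜ # n} {# (m ℕ.* n)} (real-ℚ (fromℕ m) (fromℕ n) (fromℕ (m ℕ.* n)) (sym (fromℕ-* m n)))

  #-injective : ∀ {m n} → # m ≈ᶜ # n → m ≡ n
  #-injective {m} {n} eq = fromℕ-injective (fromℚ-injective (fromℕ m) (fromℕ n) (proj₁ eq))

  1/-inverse : ∀ n .{{_ : ℕ.NonZero n}} → real (fromℚ (+ 1 / n)) *ᶜ # n ≈ᶜ # 1
  1/-inverse n = real-ℚ (+ 1 / n) (fromℕ n) 1ℚ (/-fromℕ 1 n)

  -- Kept free of division on the right: d = 1 gives the square of √k, and d = v-1 that of
  -- √(k(v-k)/(v-1)).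
  √-/ : ∀ m d .{{_ : ℕ.NonZero d}} → (real (√ (+ m / d)) *ᶜ real (√ (+ m / d))) *ᶜ # d ≈ᶜ # m
  √-/ m d = ≈ᶜ-trans {(real s *ᶜ real s) *ᶜ # d} {real (fromℚ q) *ᶜ # d} {# m}
      (*ᶜ-cong {real s *ᶜ real s} {real (fromℚ q)} {# d} {# d}
        (≈ᶜ-trans {real s *ᶜ real s} {real (s *ʳ s)} {real (fromℚ q)}
          (≈ᶜ-sym {real (s *ʳ s)} {real s *ᶜ real s} (real-* s s))
          (real-cong (s *ʳ s) (fromℚ q) (√-square q 0≤q)))
        (≈ᶜ-refl {# d}))
      (real-ℚ q (fromℕ d) (fromℕ m) (/-fromℕ m d))
    where
    q = + m / d
    s = √ q
    0≤q = ℚₚ.nonNegative⁻¹ q {{ℚₚ.normalize-nonNeg m d}}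

  ℂ-naturals : NaturalsIn ℂ-commutativeRing
  ℂ-naturals = record
    { ι           = #_
    ; ι-0         = ≈ᶜ-refl {# 0}
    ; ι-1         = ≈ᶜ-refl {# 1}
    ; ι-+         = #-+
    ; ι-*         = #-*
    ; ι-injective = λ {m} {n} → #-injective {m} {n}
    }

-- Matrices over a commutative ring, orthogonal idempotents, spectra.

module SingleTerm (M : CommutativeMonoid 0ℓ 0ℓ) where
  open CommutativeMonoid M renaming (_∙_ to _+_; ε to 0#) hiding (sym)
  open import Algebra.Properties.CommutativeMonoid.Sum M
  open import Relation.Binary.Reasoning.Setoid setoid

  sum-single : ∀ {m} (f : Fin m → Carrier) i → (∀ j → i ≢ j → f j ≈ 0#) → sum f ≈ f i
  sum-single {suc m} f i f≈0 = begin
    sum f                            ≈⟨ sum-remove {i = i} f ⟩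
    f i + sum (f ∘ punchIn i)        ≈⟨ ∙-congˡ (sum-cong-≋ λ j → f≈0 (punchIn i j) (punchInᵢ≢i i j ∘ sym)) ⟩
    f i + sum {m} (λ _ → 0#)         ≈⟨ ∙-congˡ (sum-replicate-zero m) ⟩
    f i + 0#                         ≈⟨ identityʳ (f i) ⟩
    f i                              ∎

module MatrixAlgebra (K : CommutativeRing 0ℓ 0ℓ) where
  open CommutativeRing K hiding (zero) renaming (refl to ≈-refl; sym to ≈-sym; trans to ≈-trans)
  open SemiringSum semiring public renaming (sum to ∑)
  open import Relation.Binary.Reasoning.Setoid setoid

  Mat : ℕ → Set
  Mat N = Fin N → Fin N → Carrier

  infix  4 _≋_
  infixl 7 _⊗_

  _≋_ : ∀ {N} → Mat N → Mat N → Set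
  M ≋ M′ = ∀ x y → M x y ≈ M′ x y

  _⊗_ : ∀ {N} → Mat N → Mat N → Mat N
  (M ⊗ M′) x y = ∑ λ z → M x z * M′ z y

  lin : ∀ {m N} → (Fin m → Carrier) → (Fin m → Mat N) → Mat N
  lin c B x y = ∑ λ i → c i * B i x y

  _∈Span_ : ∀ {m N} → Mat N → (Fin m → Mat N) → Set
  _∈Span_ {m} M B = Σ[ c ∈ (Fin m → Carrier) ] M ≋ lin c B

  δ : ∀ {m} → Fin m → Carrier → Fin m → Carrier
  δ i a j = if does (i ≟ j) then a else 0#

  δ-refl : ∀ {m} (i : Fin m) a → δ i a i ≡ a
  δ-refl i a = cong (λ b → if b then a else 0#) (dec-true (i ≟ i) refl)

  δ-≢ : ∀ {m} {i j : Fin m} a → i ≢ j → δ i a j ≡ 0#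
  δ-≢ {i = i} {j} a i≢j = cong (λ b → if b then a else 0#) (dec-false (i ≟ j) i≢j)

  open SingleTerm +-commutativeMonoid public renaming (sum-single to ∑-single)

  module _ {N : ℕ} where

    ⊗-cong : {M M′ L L′ : Mat N} → M ≋ M′ → L ≋ L′ → M ⊗ L ≋ M′ ⊗ L′
    ⊗-cong M≋ L≋ x y = sum-cong-≋ λ z → *-cong (M≋ x z) (L≋ z y)

    ⊗-assoc : (M L H : Mat N) → (M ⊗ L) ⊗ H ≋ M ⊗ (L ⊗ H)
    ⊗-assoc M L H x y = begin
      ∑ (λ z → ∑ (λ w → M x w * L w z) * H z y)         ≈⟨ sum-cong-≋ (λ z → *-distribʳ-sum (H z y) (λ w → M x w * L w z)) ⟩
      ∑ (λ z → ∑ (λ w → M x w * L w z * H z y))         ≈⟨ ∑-comm (λ z w → M x w * L w z * H z y) ⟩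
      ∑ (λ w → ∑ (λ z → M x w * L w z * H z y))         ≈⟨ sum-cong-≋ (λ w → sum-cong-≋ λ z → *-assoc (M x w) (L w z) (H z y)) ⟩
      ∑ (λ w → ∑ (λ z → M x w * (L w z * H z y)))       ≈⟨ sum-cong-≋ (λ w → *-distribˡ-sum (M x w) (λ z → L w z * H z y)) ⟨
      ∑ (λ w → M x w * ∑ (λ z → L w z * H z y))         ∎

    lin-⊗ : ∀ {m} (c : Fin m → Carrier) (B : Fin m → Mat N) L → lin c B ⊗ L ≋ lin c (λ i → B i ⊗ L)
    lin-⊗ c B L x y = begin
      ∑ (λ z → ∑ (λ i → c i * B i x z) * L z y)         ≈⟨ sum-cong-≋ (λ z → *-distribʳ-sum (L z y) (λ i → c i * B i x z)) ⟩
      ∑ (λ z → ∑ (λ i → c i * B i x z * L z y))         ≈⟨ ∑-comm (λ z i → c i * B i x z * L z y) ⟩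
      ∑ (λ i → ∑ (λ z → c i * B i x z * L z y))         ≈⟨ sum-cong-≋ (λ i → sum-cong-≋ λ z → *-assoc (c i) (B i x z) (L z y)) ⟩
      ∑ (λ i → ∑ (λ z → c i * (B i x z * L z y)))       ≈⟨ sum-cong-≋ (λ i → *-distribˡ-sum (c i) (λ z → B i x z * L z y)) ⟨
      ∑ (λ i → c i * ∑ (λ z → B i x z * L z y))         ∎

    ⊗-lin : ∀ {m} (c : Fin m → Carrier) (B : Fin m → Mat N) L → L ⊗ lin c B ≋ lin c (λ i → L ⊗ B i)
    ⊗-lin c B L x y = begin
      ∑ (λ z → L x z * ∑ (λ i → c i * B i z y))         ≈⟨ sum-cong-≋ (λ z → *-distribˡ-sum (L x z) (λ i → c i * B i z y)) ⟩
      ∑ (λ z → ∑ (λ i → L x z * (c i * B i z y)))       ≈⟨ ∑-comm (λ z i → L x z * (c i * B i z y)) ⟩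
      ∑ (λ i → ∑ (λ z → L x z * (c i * B i z y)))       ≈⟨ sum-cong-≋ (λ i → sum-cong-≋ λ z → swap (L x z) (c i) (B i z y)) ⟩
      ∑ (λ i → ∑ (λ z → c i * (L x z * B i z y)))       ≈⟨ sum-cong-≋ (λ i → *-distribˡ-sum (c i) (λ z → L x z * B i z y)) ⟨
      ∑ (λ i → c i * ∑ (λ z → L x z * B i z y))         ∎
      where
      swap : ∀ a b e → a * (b * e) ≈ b * (a * e)
      swap a b e = ≈-trans (≈-sym (*-assoc a b e)) (≈-trans (*-congʳ (*-comm a b)) (*-assoc b a e))

    lin-⊗-lin : ∀ {m m′} (c : Fin m → Carrier) (B : Fin m → Mat N) (c′ : Fin m′ → Carrier) (B′ : Fin m′ → Mat N) →
      lin c B ⊗ lin c′ B′ ≋ lin c (λ i → lin c′ λ j → B i ⊗ B′ j)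
    lin-⊗-lin c B c′ B′ x y = ≈-trans (lin-⊗ c B (lin c′ B′) x y)
      (sum-cong-≋ λ i → *-congˡ (⊗-lin c′ B′ (B i) x y))

    span-resp : ∀ {m} {M M′ : Mat N} {B : Fin m → Mat N} → M ≋ M′ → M′ ∈Span B → M ∈Span B
    span-resp M≋ (c , M′≋) = c , λ x y → ≈-trans (M≋ x y) (M′≋ x y)

    lin-span : ∀ {m m′} (c : Fin m′ → Carrier) {M : Fin m′ → Mat N} {B : Fin m → Mat N} →
      (∀ i → M i ∈Span B) → lin c M ∈Span B
    lin-span c {M} {B} h = (λ j → ∑ λ i → c i * proj₁ (h i) j) , λ x y → begin
      ∑ (λ i → c i * M i x y)                                  ≈⟨ sum-cong-≋ (λ i → *-congˡ (proj₂ (h i) x y)) ⟩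
      ∑ (λ i → c i * ∑ (λ j → proj₁ (h i) j * B j x y))        ≈⟨ sum-cong-≋ (λ i → *-distribˡ-sum (c i) (λ j → proj₁ (h i) j * B j x y)) ⟩
      ∑ (λ i → ∑ (λ j → c i * (proj₁ (h i) j * B j x y)))      ≈⟨ ∑-comm (λ i j → c i * (proj₁ (h i) j * B j x y)) ⟩
      ∑ (λ j → ∑ (λ i → c i * (proj₁ (h i) j * B j x y)))      ≈⟨ sum-cong-≋ (λ j → sum-cong-≋ λ i → *-assoc (c i) (proj₁ (h i) j) (B j x y)) ⟨
      ∑ (λ j → ∑ (λ i → c i * proj₁ (h i) j * B j x y))        ≈⟨ sum-cong-≋ (λ j → *-distribʳ-sum (B j x y) (λ i → c i * proj₁ (h i) j)) ⟨
      ∑ (λ j → ∑ (λ i → c i * proj₁ (h i) j) * B j x y)        ∎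

  -- The aim is `lin-multiply`: coordinates with respect to the E multiply entrywise, which is what
  -- makes them eigenvalues. Minimality forces Eᵢ Eⱼ to be 0 or to equal both factors, and
  -- independence rules out the latter for i ≠ j.
  module OrthogonalIdempotents {m m′ N : ℕ} (A : Fin m → Mat N) (E : Fin m′ → Mat N)
    (closed      : ∀ i j → (A i ⊗ A j) ∈Span A)
    (commutative : ∀ i j → A i ⊗ A j ≋ A j ⊗ A i)
    (in-algebra  : ∀ i → E i ∈Span A)
    (idempotent  : ∀ i → E i ⊗ E i ≋ E i)
    (minimal     : ∀ i f → f ∈Span A → f ⊗ f ≋ f → E i ⊗ f ≋ f → f ≋ (λ _ _ → 0#) ⊎ f ≋ E i)
    (independent : ∀ (c : Fin m′ → Carrier) → lin c E ≋ (λ _ _ → 0#) → ∀ i → c i ≈ 0#)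
    (1≉0         : ¬ 1# ≈ 0#)
    where

    E-comm : ∀ i j → E i ⊗ E j ≋ E j ⊗ E i
    E-comm i j x y = begin
      (E i ⊗ E j) x y                                     ≈⟨ ⊗-cong (proj₂ (in-algebra i)) (proj₂ (in-algebra j)) x y ⟩
      (lin a A ⊗ lin b A) x y                             ≈⟨ lin-⊗-lin a A b A x y ⟩
      ∑ (λ k → a k * ∑ (λ l → b l * (A k ⊗ A l) x y))     ≈⟨ sum-cong-≋ (λ k → *-distribˡ-sum (a k) (λ l → b l * (A k ⊗ A l) x y)) ⟩
      ∑ (λ k → ∑ (λ l → a k * (b l * (A k ⊗ A l) x y)))   ≈⟨ ∑-comm (λ k l → a k * (b l * (A k ⊗ A l) x y)) ⟩
      ∑ (λ l → ∑ (λ k → a k * (b l * (A k ⊗ A l) x y)))   ≈⟨ sum-cong-≋ (λ l → sum-cong-≋ λ k → swap (a k) (b l) (commutative k l x y)) ⟩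
      ∑ (λ l → ∑ (λ k → b l * (a k * (A l ⊗ A k) x y)))   ≈⟨ sum-cong-≋ (λ l → *-distribˡ-sum (b l) (λ k → a k * (A l ⊗ A k) x y)) ⟨
      ∑ (λ l → b l * ∑ (λ k → a k * (A l ⊗ A k) x y))     ≈⟨ lin-⊗-lin b A a A x y ⟨
      (lin b A ⊗ lin a A) x y                             ≈⟨ ⊗-cong (proj₂ (in-algebra j)) (proj₂ (in-algebra i)) x y ⟨
      (E j ⊗ E i) x y                                     ∎
      where
      a = proj₁ (in-algebra i)
      b = proj₁ (in-algebra j)
      swap : ∀ a b {e e′} → e ≈ e′ → a * (b * e) ≈ b * (a * e′)
      swap a b {e} e≈ = ≈-trans (≈-sym (*-assoc a b e))
        (≈-trans (*-cong (*-comm a b) e≈) (*-assoc b a _))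

    -- If they agreed, Eᵢ - Eⱼ = 0 would be a linear relation whose coefficient at `i` is 1.
    E-distinct : ∀ {i j} → i ≢ j → ¬ E i ≋ E j
    E-distinct {i} {j} i≢j Eᵢ≋Eⱼ = 1≉0 (≈-trans (≈-sym cᵢ) (independent c lin≈0 i))
      where
      c : Fin m′ → Carrier
      c k = δ i 1# k + - δ j 1# k
      cᵢ : c i ≈ 1#
      cᵢ = begin
        δ i 1# i + - δ j 1# i   ≡⟨ cong₂ (λ a b → a + - b) (δ-refl i 1#) (δ-≢ 1# (i≢j ∘ sym)) ⟩
        1# + - 0#               ≈⟨ +-congˡ -0#≈0# ⟩
        1# + 0#                 ≈⟨ +-identityʳ 1# ⟩
        1#                      ∎
        where open import Algebra.Properties.Ring ring using (-0#≈0#)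
      lin-δ : ∀ k x y → ∑ (λ l → δ k 1# l * E l x y) ≈ E k x y
      lin-δ k x y = ≈-trans (∑-single (λ l → δ k 1# l * E l x y) k λ l k≢l → ≈-trans (*-congʳ (reflexive (δ-≢ 1# k≢l))) (zeroˡ (E l x y)))
        (≈-trans (*-congʳ (reflexive (δ-refl k 1#))) (*-identityˡ (E k x y)))
      lin≈0 : lin c E ≋ (λ _ _ → 0#)
      lin≈0 x y = begin
        ∑ (λ l → (δ i 1# l + - δ j 1# l) * E l x y)                    ≈⟨ sum-cong-≋ (λ l → ≈-trans (distribʳ (E l x y) (δ i 1# l) (- δ j 1# l)) (+-congˡ (minus (δ j 1# l) (E l x y)))) ⟩
        ∑ (λ l → δ i 1# l * E l x y + - 1# * (δ j 1# l * E l x y))      ≈⟨ ∑-distrib-+ (λ l → δ i 1# l * E l x y) (λ l → - 1# * (δ j 1# l * E l x y)) ⟩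
        ∑ (λ l → δ i 1# l * E l x y) + ∑ (λ l → - 1# * (δ j 1# l * E l x y))
          ≈⟨ +-cong (lin-δ i x y) (≈-trans (≈-sym (*-distribˡ-sum (- 1#) (λ l → δ j 1# l * E l x y))) (*-congˡ (lin-δ j x y))) ⟩
        E i x y + - 1# * E j x y                                       ≈⟨ +-cong (Eᵢ≋Eⱼ x y) (-1*x≈-x (E j x y)) ⟩
        E j x y + - E j x y                                            ≈⟨ -‿inverseʳ (E j x y) ⟩
        0#                                                             ∎
        where
        open import Algebra.Properties.Ring ring using (-1*x≈-x; -‿distribˡ-*)
        minus : ∀ a b → - a * b ≈ - 1# * (a * b)
        minus a b = ≈-trans (≈-sym (-‿distribˡ-* a b)) (≈-sym (-1*x≈-x (a * b)))

    -- Eᵢ Eⱼ is an idempotent below both Eᵢ and Eⱼ, so minimality leaves only 0.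
    orthogonal : ∀ {i j} → i ≢ j → E i ⊗ E j ≋ (λ _ _ → 0#)
    orthogonal {i} {j} i≢j = go (minimal i f f-span f-idem Eᵢf) (minimal j f f-span f-idem Eⱼf)
      where
      f = E i ⊗ E j
      f-span : f ∈Span A
      f-span = span-resp (λ x y → ≈-trans (⊗-cong (proj₂ (in-algebra i)) (proj₂ (in-algebra j)) x y)
                                          (lin-⊗-lin (proj₁ (in-algebra i)) A (proj₁ (in-algebra j)) A x y))
        (lin-span (proj₁ (in-algebra i)) λ k → lin-span (proj₁ (in-algebra j)) λ l → closed k l)
      Eᵢf : E i ⊗ f ≋ f
      Eᵢf x y = ≈-trans (≈-sym (⊗-assoc (E i) (E i) (E j) x y)) (⊗-cong {L = E j} (idempotent i) (λ _ _ → ≈-refl) x y)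
      fEⱼ : f ⊗ E j ≋ f
      fEⱼ x y = ≈-trans (⊗-assoc (E i) (E j) (E j) x y) (⊗-cong {M = E i} (λ _ _ → ≈-refl) (idempotent j) x y)
      Eⱼf : E j ⊗ f ≋ f
      Eⱼf x y = begin
        (E j ⊗ (E i ⊗ E j)) x y     ≈⟨ ⊗-assoc (E j) (E i) (E j) x y ⟨
        ((E j ⊗ E i) ⊗ E j) x y     ≈⟨ ⊗-cong {L = E j} (E-comm j i) (λ _ _ → ≈-refl) x y ⟩
        (f ⊗ E j) x y               ≈⟨ fEⱼ x y ⟩
        f x y                       ∎
      f-idem : f ⊗ f ≋ f
      f-idem x y = begin
        ((E i ⊗ E j) ⊗ f) x y     ≈⟨ ⊗-assoc (E i) (E j) f x y ⟩
        (E i ⊗ (E j ⊗ f)) x y     ≈⟨ ⊗-cong {M = E i} (λ _ _ → ≈-refl) Eⱼf x y ⟩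
        (E i ⊗ f) x y             ≈⟨ Eᵢf x y ⟩
        f x y                     ∎
      go : f ≋ (λ _ _ → 0#) ⊎ f ≋ E i → f ≋ (λ _ _ → 0#) ⊎ f ≋ E j → f ≋ (λ _ _ → 0#)
      go (inj₁ f≋0) _           = f≋0
      go (inj₂ _)   (inj₁ f≋0)  = f≋0
      go (inj₂ f≋Eᵢ) (inj₂ f≋Eⱼ) = contradiction (λ x y → ≈-trans (≈-sym (f≋Eᵢ x y)) (f≋Eⱼ x y)) (E-distinct i≢j)

    lin-multiply : ∀ s t → lin s E ⊗ lin t E ≋ lin (λ i → s i * t i) E
    lin-multiply s t x y = begin
      (lin s E ⊗ lin t E) x y                                 ≈⟨ lin-⊗-lin s E t E x y ⟩
      ∑ (λ i → s i * ∑ (λ j → t j * (E i ⊗ E j) x y))         ≈⟨ sum-cong-≋ (λ i → *-congˡ (inner i)) ⟩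
      ∑ (λ i → s i * (t i * E i x y))                         ≈⟨ sum-cong-≋ (λ i → *-assoc (s i) (t i) (E i x y)) ⟨
      ∑ (λ i → s i * t i * E i x y)                           ∎
      where
      inner : ∀ i → ∑ (λ j → t j * (E i ⊗ E j) x y) ≈ t i * E i x y
      inner i = ≈-trans (∑-single (λ j → t j * (E i ⊗ E j) x y) i λ j i≢j → ≈-trans (*-congˡ (orthogonal i≢j x y)) (zeroʳ (t j)))
        (*-congˡ (idempotent i x y))

  module Spectra (𝒩 : NaturalsIn K)
    {m N : ℕ} (E : Fin m → Mat N)
    (multiply : ∀ s t → lin s E ⊗ lin t E ≋ lin (λ i → s i * t i) E)
    where

    open NaturalsIn 𝒩
    open SemiringSum ℕₚ.+-*-semiring using (sum)

    ℕMat : Set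
    ℕMat = Fin N → Fin N → ℕ

    _⊛_ : ℕMat → ℕMat → ℕMat
    (f ⊛ g) x y = sum λ z → f x z ℕ.* g z y

    -- f = Σᵢ s i · Eᵢ, that is, s i is the eigenvalue of f on the i-th eigenspace.
    Spectrum : ℕMat → (Fin m → Carrier) → Set
    Spectrum f s = ∀ x y → ι (f x y) ≈ lin s E x y

    ι-sum : ∀ {k} (f : Fin k → ℕ) → ι (sum f) ≈ ∑ (ι ∘ f)
    ι-sum {zero}  f = ι-0
    ι-sum {suc k} f = ≈-trans (ι-+ (f zero) (sum (f ∘ suc))) (+-congˡ (ι-sum (f ∘ suc)))

    spectrum-⊛ : ∀ {f g s t} → Spectrum f s → Spectrum g t → Spectrum (f ⊛ g) (λ l → s l * t l)
    spectrum-⊛ {f} {g} {s} {t} fs gt x y = begin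
      ι (sum λ z → f x z ℕ.* g z y)           ≈⟨ ι-sum (λ z → f x z ℕ.* g z y) ⟩
      ∑ (λ z → ι (f x z ℕ.* g z y))           ≈⟨ sum-cong-≋ (λ z → ≈-trans (ι-* (f x z) (g z y)) (*-cong (fs x z) (gt z y))) ⟩
      (lin s E ⊗ lin t E) x y                 ≈⟨ multiply s t x y ⟩
      lin (λ l → s l * t l) E x y             ∎

    lin-+ : ∀ s t x y → lin s E x y + lin t E x y ≈ lin (λ l → s l + t l) E x y
    lin-+ s t x y = begin
      ∑ (λ l → s l * E l x y) + ∑ (λ l → t l * E l x y)        ≈⟨ ∑-distrib-+ (λ l → s l * E l x y) (λ l → t l * E l x y) ⟨
      ∑ (λ l → s l * E l x y + t l * E l x y)                  ≈⟨ sum-cong-≋ (λ l → distribʳ (E l x y) (s l) (t l)) ⟨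
      ∑ (λ l → (s l + t l) * E l x y)                          ∎

    spectrum-+ : ∀ {f g s t} → Spectrum f s → Spectrum g t → Spectrum (λ x y → f x y ℕ.+ g x y) (λ l → s l + t l)
    spectrum-+ {f} {g} {s} {t} fs gt x y =
      ≈-trans (ι-+ (f x y) (g x y)) (≈-trans (+-cong (fs x y) (gt x y)) (lin-+ s t x y))

    spectrum-scale : ∀ a {f s} → Spectrum f s → Spectrum (λ x y → a ℕ.* f x y) (λ l → ι a * s l)
    spectrum-scale a {f} {s} fs x y = begin
      ι (a ℕ.* f x y)                              ≈⟨ ι-* a (f x y) ⟩
      ι a * ι (f x y)                              ≈⟨ *-congˡ (fs x y) ⟩
      ι a * ∑ (λ l → s l * E l x y)                ≈⟨ *-distribˡ-sum (ι a) (λ l → s l * E l x y) ⟩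
      ∑ (λ l → ι a * (s l * E l x y))              ≈⟨ sum-cong-≋ (λ l → *-assoc (ι a) (s l) (E l x y)) ⟨
      ∑ (λ l → ι a * s l * E l x y)                ∎

    -- The exit from ℂ: equal eigenvalues give equal complex matrices, and as all entries are images
    -- of naturals the equality descends to ℕ.
    spectrum-injective : ∀ {f g s t} → Spectrum f s → Spectrum g t → (∀ l → s l ≈ t l) → ∀ x y → f x y ≡ g x y
    spectrum-injective fs gt s≈t x y = ι-injective (≈-trans (fs x y)
      (≈-trans (sum-cong-≋ λ l → *-congʳ (s≈t l)) (≈-sym (gt x y))))

    lin-δ : ∀ a i x y → lin (δ i a) E x y ≈ a * E i x y
    lin-δ a i x y = ≈-trans
      (∑-single (λ l → δ i a l * E l x y) i λ l i≢l → ≈-trans (*-congʳ (reflexive (δ-≢ a i≢l))) (zeroˡ (E l x y)))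
      (*-congʳ (reflexive (δ-refl i a)))

    spectrum-single : ∀ {f} a i → (∀ x y → ι (f x y) ≈ a * E i x y) → Spectrum f (δ i a)
    spectrum-single a i f≈ x y = ≈-trans (f≈ x y) (≈-sym (lin-δ a i x y))

    -- A product with a spectrum supported at `i` sees only the `i`-th eigenvalue of the other
    -- factor. Hence one row of P decides products with J, and two rows decide products with T.
    δ-*-cong : ∀ i (s : Fin m → Carrier) a b → s i ≈ b → ∀ l → s l * δ i a l ≈ b * δ i a l
    δ-*-cong i s a b sᵢ≈b l with i ≟ l
    ... | yes refl = *-congʳ sᵢ≈b
    ... | no _     = ≈-trans (zeroʳ (s l)) (≈-sym (zeroʳ b))

open import Data.Nat.Base using (_∸_; _≤_; _<_)

-- Counting with indicator functions.

module Combinatorics where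

  open import Data.Nat.Base using (_+_; _*_)
  open SemiringSum ℕₚ.+-*-semiring

  ⟦_⟧ : Bool → ℕ
  ⟦ b ⟧ = if b then 1 else 0

  module Counting where

    open SingleTerm ℕₚ.+-0-commutativeMonoid using (sum-single) public

    ⟦⟧≤1 : ∀ b → ⟦ b ⟧ ≤ 1
    ⟦⟧≤1 true  = ℕₚ.≤-refl
    ⟦⟧≤1 false = z≤n

    ⟦⟧-injective : ∀ {a b} → ⟦ a ⟧ ≡ ⟦ b ⟧ → a ≡ b
    ⟦⟧-injective {true}  {true}  _ = refl
    ⟦⟧-injective {false} {false} _ = refl

    ⟦true⟧ : ∀ {b} → b ≡ true → ⟦ b ⟧ ≡ 1
    ⟦true⟧ = cong ⟦_⟧

    ⟦false⟧ : ∀ {b} → b ≢ true → ⟦ b ⟧ ≡ 0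
    ⟦false⟧ {true}  b≢ = contradiction refl b≢
    ⟦false⟧ {false} _  = refl

    ⟦⟧≢0 : ∀ {b} → ⟦ b ⟧ ≢ 0 → b ≡ true
    ⟦⟧≢0 {true}  _ = refl
    ⟦⟧≢0 {false} h = contradiction refl h

    sum-zero : ∀ {m} (f : Fin m → ℕ) → (∀ j → f j ≡ 0) → sum f ≡ 0
    sum-zero {m} f f≡0 = trans (sum-cong-≗ f≡0) (sum-replicate-zero m)

    ≤-sum : ∀ {m} (f : Fin m → ℕ) i → f i ≤ sum f
    ≤-sum {suc m} f i = subst (f i ≤_) (sym (sum-remove {i = i} f)) (ℕₚ.m≤m+n (f i) (sum (f ∘ punchIn i)))

    +-≤-sum : ∀ {m} (f : Fin m → ℕ) {i j} → i ≢ j → f i + f j ≤ sum f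
    +-≤-sum {suc m} f {i} {j} i≢j = subst (f i + f j ≤_) (sym (sum-remove {i = i} f))
      (ℕₚ.+-monoʳ-≤ (f i) (subst (λ z → f z ≤ sum (f ∘ punchIn i)) (punchIn-punchOut i≢j) (≤-sum (f ∘ punchIn i) (punchOut i≢j))))

    sum-mono : ∀ {m} {f g : Fin m → ℕ} → (∀ i → f i ≤ g i) → sum f ≤ sum g
    sum-mono {zero}  _   = z≤n
    sum-mono {suc m} f≤g = ℕₚ.+-mono-≤ (f≤g zero) (sum-mono (f≤g ∘ suc))

    -- The tight case of `sum-mono`: a count that attains its maximum becomes a statement about
    -- every single point.
    sum-mono-≡ : ∀ {m} {f g : Fin m → ℕ} → (∀ i → f i ≤ g i) → sum f ≡ sum g → ∀ i → f i ≡ g i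
    sum-mono-≡ {suc m} {f} {g} f≤g eq = λ where
        zero    → head≡
        (suc i) → sum-mono-≡ (f≤g ∘ suc) (ℕₚ.+-cancelˡ-≡ (f zero) _ _ (trans eq (cong (_+ sum (g ∘ suc)) (sym head≡)))) i
      where
      head≡ : f zero ≡ g zero
      head≡ = ℕₚ.≤-antisym (f≤g zero) (ℕₚ.+-cancelʳ-≤ (sum (f ∘ suc)) (g zero) (f zero)
        (ℕₚ.≤-trans (ℕₚ.+-monoʳ-≤ (g zero) (sum-mono (f≤g ∘ suc))) (ℕₚ.≤-reflexive (sym eq))))

    sum-const : ∀ m c → sum {m} (λ _ → c) ≡ m * c
    sum-const zero    c = refl
    sum-const (suc m) c = cong (c ℕ.+_) (sum-const m c)

    unique-true : ∀ {m} (p : Fin m → Bool) → sum (⟦_⟧ ∘ p) ≤ 1 → ∀ {i j} → p i ≡ true → p j ≡ true → i ≡ j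
    unique-true p h {i} {j} pᵢ pⱼ with i ≟ j
    ... | yes i≡j = i≡j
    ... | no i≢j = contradiction (ℕₚ.≤-trans (subst (_≤ sum (⟦_⟧ ∘ p)) (cong₂ _+_ (⟦true⟧ pᵢ) (⟦true⟧ pⱼ)) (+-≤-sum (⟦_⟧ ∘ p) i≢j)) h) λ { (s≤s ()) }

    exists-true : ∀ {m} (p : Fin m → Bool) → sum (⟦_⟧ ∘ p) ≢ 0 → ∃[ i ] p i ≡ true
    exists-true p h with any? (λ i → p i Boolₚ.≟ true)
    ... | yes ∃i = ∃i
    ... | no ∄i  = contradiction (sum-zero (⟦_⟧ ∘ p) λ i → ⟦false⟧ λ pᵢ → ∄i (i , pᵢ)) h

    sum-unique : ∀ {m} (p : Fin m → Bool) (f : Fin m → ℕ) {i} → p i ≡ true → (∀ {j} → p j ≡ true → i ≡ j) →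
      sum (λ j → ⟦ p j ⟧ * f j) ≡ f i
    sum-unique p f {i} pᵢ unique = trans
      (sum-single (λ j → ⟦ p j ⟧ * f j) i λ j i≢j → cong (_* f j) (⟦false⟧ λ pⱼ → i≢j (unique pⱼ)))
      (trans (cong (_* f i) (⟦true⟧ pᵢ)) (ℕₚ.*-identityˡ (f i)))

  open Counting public

  module Lists where

    is-just-of : ∀ {n} → Fin n → Maybe (Fin n) → ℕ
    is-just-of g nothing  = 0
    is-just-of g (just a) = ⟦ does (a ≟ g) ⟧

    length-catMaybes : ∀ {S : Set} {m} (f : Fin m → Maybe S) →
      length (catMaybes (tabulate f)) ≡ sum (λ l → ⟦ is-just (f l) ⟧)
    length-catMaybes {m = zero}  f = refl
    length-catMaybes {m = suc m} f with f zero
    ... | just _  = cong suc (length-catMaybes (f ∘ suc))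
    ... | nothing = length-catMaybes (f ∘ suc)

    length-filter : ∀ {n m} (f : Fin m → Maybe (Fin n)) g →
      length (filter (_≟ g) (catMaybes (tabulate f))) ≡ sum (λ l → is-just-of g (f l))
    length-filter {m = zero}  f g = refl
    length-filter {m = suc m} f g with f zero
    ... | nothing = length-filter (f ∘ suc) g
    ... | just a with does (a ≟ g)
    ... | true  = cong suc (length-filter (f ∘ suc) g)
    ... | false = length-filter (f ∘ suc) g

    -- Meant for predicates with at most one witness, where the choice made by `any?` is immaterial.
    find : ∀ {n} → (Fin n → Bool) → Maybe (Fin n)
    find p with any? (λ i → p i Boolₚ.≟ true)
    ... | yes (i , _) = just i
    ... | no _        = nothing

    find-spec : ∀ {n} (p : Fin n → Bool) →
      (∃[ i ] p i ≡ true × find p ≡ just i) ⊎ ((∀ i → p i ≢ true) × find p ≡ nothing)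
    find-spec p with any? (λ i → p i Boolₚ.≟ true)
    ... | yes (i , pᵢ) = inj₁ (i , pᵢ , refl)
    ... | no ∄i        = inj₂ ((λ i pᵢ → ∄i (i , pᵢ)) , refl)

    sum-find : ∀ {n} (p : Fin n → Bool) → (∀ {i j} → p i ≡ true → p j ≡ true → i ≡ j) →
      sum (⟦_⟧ ∘ p) ≡ ⟦ is-just (find p) ⟧
    sum-find p unique with find-spec p
    ... | inj₁ (i , pᵢ , eq) = trans (trans (sum-cong-≗ λ j → sym (ℕₚ.*-identityʳ ⟦ p j ⟧)) (sum-unique p (λ _ → 1) pᵢ (unique pᵢ)))
                                     (cong (⟦_⟧ ∘ is-just) (sym eq))
    ... | inj₂ (none , eq)   = trans (sum-zero (⟦_⟧ ∘ p) (⟦false⟧ ∘ none)) (cong (⟦_⟧ ∘ is-just) (sym eq))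

    unique-lookup : ∀ {a} {S : Set a} {xs : List S} → Unique xs → ∀ i j → lookup xs i ≡ lookup xs j → i ≡ j
    unique-lookup (_ ∷ _)  zero    zero    _  = refl
    unique-lookup (x∉ ∷ _) zero    (suc j) eq = contradiction eq (All.lookup x∉ (∈-lookup j))
    unique-lookup (x∉ ∷ _) (suc i) zero    eq = contradiction (sym eq) (All.lookup x∉ (∈-lookup i))
    unique-lookup (_ ∷ u)  (suc i) (suc j) eq = cong suc (unique-lookup u i j eq)

  -- A is the relation A_{0,i}, B is A₁, R is A_{2,0}, and T is the union of A₁ and all
  -- A_{0,i}.
  record Counts (n v k N : ℕ) .{{_ : NonZero n}} : Set where
    field
      A     : Fin n → Fin N → Fin N → Bool
      B R T : Fin N → Fin N → Bool

      A-refl    : ∀ x → A (0ₙ n) x x ≡ true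
      A-rows    : ∀ i x → sum (λ z → ⟦ A i x z ⟧) ≡ 1
      A-columns : ∀ i z → sum (λ x → ⟦ A i x z ⟧) ≡ 1
      B-rows    : ∀ x → sum (λ z → ⟦ B x z ⟧) ≡ n * (v ∸ 1)
      R-rows    : ∀ x → sum (λ z → ⟦ R x z ⟧) ≡ k
      T-split   : ∀ x y → sum (λ i → ⟦ A i x y ⟧) + ⟦ B x y ⟧ ≡ ⟦ T x y ⟧
      AA        : ∀ {i j l} → toℕ i + toℕ j ≡ toℕ l → ∀ x y → sum (λ z → ⟦ A i x z ⟧ * ⟦ A j z y ⟧) ≡ ⟦ A l x y ⟧
      BA        : ∀ i x y → sum (λ z → ⟦ B x z ⟧ * ⟦ A i z y ⟧) ≡ ⟦ B x y ⟧
      AR        : ∀ i x y → sum (λ z → ⟦ A i x z ⟧ * ⟦ R z y ⟧) ≡ sum (λ z → ⟦ R x z ⟧ * ⟦ A i z y ⟧)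
      -- A_{2,0}² = k A_{0,0} + (λ/n) A₁ with λ/n = k(k-1)/(n(v-1)), cleared of its denominator.
      RR        : ∀ x y → (n * (v ∸ 1)) * sum (λ z → ⟦ R x z ⟧ * ⟦ R z y ⟧) ≡
                          (n * (v ∸ 1)) * k * ⟦ A (0ₙ n) x y ⟧ + k * (k ∸ 1) * ⟦ B x y ⟧
      AT        : ∀ i x y → sum (λ z → ⟦ A i x z ⟧ * ⟦ T z y ⟧) ≡ ⟦ T x y ⟧
      BT        : ∀ x y → sum (λ z → ⟦ B x z ⟧ * ⟦ T z y ⟧) ≡ n * (v ∸ 1) * ⟦ T x y ⟧
      -- R T = k (J - T), written without subtraction.
      RT        : ∀ x y → sum (λ z → ⟦ R x z ⟧ * ⟦ T z y ⟧) + k * ⟦ T x y ⟧ ≡ k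

  -- The action of ℤₙ generated by τ, and how A₁ and A_{2,0} behave under it.

  module CyclicAction {n v k N : ℕ} .{{_ : NonZero n}} (C : Counts n v k N) where
    open Counts C
    open Lists using (unique-lookup)

    A⇒T : ∀ {i x y} → A i x y ≡ true → T x y ≡ true
    A⇒T {i} {x} {y} a = ⟦⟧≢0 λ t≡0 → contradiction (ℕₚ.≤-trans (ℕₚ.≤-reflexive (sym (⟦true⟧ a)))
      (ℕₚ.≤-trans (≤-sum (λ i → ⟦ A i x y ⟧) i) (ℕₚ.m+n≤o⇒m≤o (sum (λ i → ⟦ A i x y ⟧)) (ℕₚ.≤-reflexive (trans (T-split x y) t≡0))))) λ ()

    A-disjoint : ∀ {i j x y} → A i x y ≡ true → A j x y ≡ true → i ≡ j
    A-disjoint {x = x} {y} = unique-true (λ i → A i x y)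
      (ℕₚ.m+n≤o⇒m≤o (sum (λ i → ⟦ A i x y ⟧)) (ℕₚ.≤-trans (ℕₚ.≤-reflexive (T-split x y)) (⟦⟧≤1 (T x y))))

    A-B-disjoint : ∀ {i x y} → A i x y ≡ true → B x y ≢ true
    A-B-disjoint {i} {x} {y} a b = contradiction (ℕₚ.≤-trans
      (ℕₚ.+-mono-≤ (subst (_≤ sum (λ i → ⟦ A i x y ⟧)) (⟦true⟧ a) (≤-sum (λ i → ⟦ A i x y ⟧) i)) (ℕₚ.≤-reflexive (sym (⟦true⟧ b))))
      (ℕₚ.≤-trans (ℕₚ.≤-reflexive (T-split x y)) (⟦⟧≤1 (T x y)))) λ { (s≤s ()) }

    T⇒A⊎B : ∀ {x y} → T x y ≡ true → (∃[ i ] A i x y ≡ true) ⊎ B x y ≡ true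
    T⇒A⊎B {x} {y} t with B x y in eq
    ... | true  = inj₂ refl
    ... | false = inj₁ (exists-true (λ i → A i x y) λ s≡0 → contradiction
      (trans (sym (⟦true⟧ t)) (trans (sym (T-split x y)) (cong₂ _+_ s≡0 (cong ⟦_⟧ eq)))) λ ())

    σ : Fin n → Fin N → Fin N
    σ i x = proj₁ (exists-true (A i x) λ eq → contradiction (trans (sym (A-rows i x)) eq) λ ())

    A-σ : ∀ i x → A i x (σ i x) ≡ true
    A-σ i x = proj₂ (exists-true (A i x) λ eq → contradiction (trans (sym (A-rows i x)) eq) λ ())

    A⇒σ : ∀ {i x y} → A i x y ≡ true → y ≡ σ i x
    A⇒σ {i} {x} a = unique-true (A i x) (ℕₚ.≤-reflexive (A-rows i x)) a (A-σ i x)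

    sum-A : ∀ i x (f : Fin N → ℕ) → sum (λ z → ⟦ A i x z ⟧ * f z) ≡ f (σ i x)
    sum-A i x f = sum-unique (A i x) f (A-σ i x) (sym ∘ A⇒σ)

    -- Right multiplication by A_{0,i}, evaluated in column `σ i y` so that the inverse permutation
    -- never has to be named.
    sum-Aʳ : ∀ i y (f : Fin N → ℕ) → sum (λ z → f z * ⟦ A i z (σ i y) ⟧) ≡ f y
    sum-Aʳ i y f = trans (sum-cong-≗ λ z → ℕₚ.*-comm (f z) ⟦ A i z (σ i y) ⟧)
      (sum-unique (λ z → A i z (σ i y)) f (A-σ i y) λ a → unique-true (λ z → A i z (σ i y)) (ℕₚ.≤-reflexive (A-columns i (σ i y))) (A-σ i y) a)

    σ-injective : ∀ i {x y} → σ i x ≡ σ i y → x ≡ y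
    σ-injective i {x} {y} eq = unique-true (λ z → A i z (σ i y)) (ℕₚ.≤-reflexive (A-columns i (σ i y)))
      (subst (λ z → A i x z ≡ true) eq (A-σ i x)) (A-σ i y)

    σ-0 : ∀ x → σ (0ₙ n) x ≡ x
    σ-0 x = sym (A⇒σ (A-refl x))

    σ-+ : ∀ {i j l} → toℕ i + toℕ j ≡ toℕ l → ∀ x → σ j (σ i x) ≡ σ l x
    σ-+ {i} {j} {l} eq x = sym (A⇒σ (⟦⟧-injective (begin
      ⟦ A j (σ i x) (σ l x) ⟧                                ≡⟨ sum-A i x (λ z → ⟦ A j z (σ l x) ⟧) ⟨
      sum (λ z → ⟦ A i x z ⟧ * ⟦ A j z (σ l x) ⟧)            ≡⟨ AA eq x (σ l x) ⟩
      ⟦ A l x (σ l x) ⟧                                      ≡⟨ ⟦true⟧ (A-σ l x) ⟩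
      1                                                      ∎)))
      where open ≡-Reasoning

    -- The generator: A_{0,1}, which is the identity A_{0,0} if n = 1.
    τ : Fin N → Fin N
    τ = σ (1 mod n)

    pow : ℕ → Fin N → Fin N
    pow zero    x = x
    pow (suc m) x = τ (pow m x)

    pow-+ : ∀ a b x → pow (a + b) x ≡ pow a (pow b x)
    pow-+ zero    b x = refl
    pow-+ (suc a) b x = cong τ (pow-+ a b x)

    pow-injective : ∀ m {x y} → pow m x ≡ pow m y → x ≡ y
    pow-injective zero    eq = eq
    pow-injective (suc m) eq = pow-injective m (σ-injective (1 mod n) eq)

    σ-pow : ∀ {m} (m<n : m < n) x → σ (fromℕ< m<n) x ≡ pow m x
    σ-pow {zero}  m<n x = σ-0 x
    σ-pow {suc m} 1+m<n x = begin
      σ (fromℕ< 1+m<n) x                     ≡⟨ σ-+ {fromℕ< m<n} {1 mod n} {fromℕ< 1+m<n} eq x ⟨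
      τ (σ (fromℕ< m<n) x)                   ≡⟨ cong τ (σ-pow m<n x) ⟩
      τ (pow m x)                            ∎
      where
      open ≡-Reasoning
      m<n = ℕₚ.<-trans (ℕₚ.n<1+n m) 1+m<n
      eq : toℕ (fromℕ< m<n) + toℕ (1 mod n) ≡ toℕ (fromℕ< 1+m<n)
      eq = begin
        toℕ (fromℕ< m<n) + toℕ (1 mod n)     ≡⟨ cong₂ _+_ (toℕ-fromℕ< m<n) (toℕ-fromℕ< (m%n<n 1 n)) ⟩
        m + 1 % n                            ≡⟨ cong (m ℕ.+_) (m<n⇒m%n≡m (ℕₚ.≤-<-trans (s≤s z≤n) 1+m<n)) ⟩
        m + 1                                ≡⟨ ℕₚ.+-comm m 1 ⟩
        suc m                                ≡⟨ toℕ-fromℕ< 1+m<n ⟨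
        toℕ (fromℕ< 1+m<n)                   ∎

    σ≡pow : ∀ i x → σ i x ≡ pow (toℕ i) x
    σ≡pow i x = trans (cong (λ j → σ j x) (sym (fromℕ<-toℕ i (toℕ<n i)))) (σ-pow (toℕ<n i) x)

    A⇒pow : ∀ {i x y} → A i x y ≡ true → y ≡ pow (toℕ i) x
    A⇒pow {i} {x} a = trans (A⇒σ a) (σ≡pow i x)

    A-pow : ∀ i x → A i x (pow (toℕ i) x) ≡ true
    A-pow i x = subst (λ y → A i x y ≡ true) (σ≡pow i x) (A-σ i x)

    -- If z = σ i x, this is `AT` at one point. For z in B x, `BT` says that the number of
    -- B-neighbours of x in the class of y is either all n(v-1) or 0, according to `T x y`, so z
    -- behaves like x. Together with reflexivity this yields symmetry and transitivity.
    T-invariant : ∀ {x z} → T x z ≡ true → ∀ y → T z y ≡ T x y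
    T-invariant {x} {z} t y with T⇒A⊎B t
    ... | inj₁ (i , a) = ⟦⟧-injective (begin
      ⟦ T z y ⟧                                    ≡⟨ cong (λ z → ⟦ T z y ⟧) (A⇒σ a) ⟩
      ⟦ T (σ i x) y ⟧                              ≡⟨ sum-A i x (λ z → ⟦ T z y ⟧) ⟨
      sum (λ z → ⟦ A i x z ⟧ * ⟦ T z y ⟧)          ≡⟨ AT i x y ⟩
      ⟦ T x y ⟧                                    ∎)
      where open ≡-Reasoning
    ... | inj₂ b with T x y in eq
    ... | true  = ⟦⟧-injective (begin
      ⟦ T z y ⟧                 ≡⟨ ℕₚ.*-identityˡ ⟦ T z y ⟧ ⟨
      1 * ⟦ T z y ⟧             ≡⟨ cong (_* ⟦ T z y ⟧) (⟦true⟧ b) ⟨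
      ⟦ B x z ⟧ * ⟦ T z y ⟧     ≡⟨ sum-mono-≡ (λ z → ℕₚ.≤-trans (ℕₚ.*-monoʳ-≤ ⟦ B x z ⟧ (⟦⟧≤1 (T z y))) (ℕₚ.≤-reflexive (ℕₚ.*-identityʳ ⟦ B x z ⟧)))
                                    (trans (BT x y) (trans (cong (λ t → n * (v ∸ 1) * ⟦ t ⟧) eq) (trans (ℕₚ.*-identityʳ (n * (v ∸ 1))) (sym (B-rows x))))) z ⟩
      ⟦ B x z ⟧                 ≡⟨ ⟦true⟧ b ⟩
      1                         ∎)
      where open ≡-Reasoning
    ... | false = ⟦⟧-injective (ℕₚ.n≤0⇒n≡0 (begin
      ⟦ T z y ⟧                                    ≡⟨ ℕₚ.*-identityˡ ⟦ T z y ⟧ ⟨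
      1 * ⟦ T z y ⟧                                ≡⟨ cong (_* ⟦ T z y ⟧) (⟦true⟧ b) ⟨
      ⟦ B x z ⟧ * ⟦ T z y ⟧                        ≤⟨ ≤-sum (λ z → ⟦ B x z ⟧ * ⟦ T z y ⟧) z ⟩
      sum (λ z → ⟦ B x z ⟧ * ⟦ T z y ⟧)            ≡⟨ BT x y ⟩
      n * (v ∸ 1) * ⟦ T x y ⟧                      ≡⟨ cong (λ t → n * (v ∸ 1) * ⟦ t ⟧) eq ⟩
      n * (v ∸ 1) * 0                              ≡⟨ ℕₚ.*-zeroʳ (n * (v ∸ 1)) ⟩
      0                                            ∎))
      where open ℕₚ.≤-Reasoning

    T-refl : ∀ x → T x x ≡ true
    T-refl x = A⇒T (A-refl x)

    T-pow : ∀ m x → T x (pow m x) ≡ true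
    T-pow zero    x = T-refl x
    T-pow (suc m) x = trans (sym (T-invariant (T-pow m x) (pow (suc m) x))) (A⇒T (A-σ (1 mod n) (pow m x)))

    B-τ : ∀ x y → B x (τ y) ≡ B x y
    B-τ x y = ⟦⟧-injective (trans (sym (BA (1 mod n) x (τ y))) (sum-Aʳ (1 mod n) y (λ z → ⟦ B x z ⟧)))

    B-pow : ∀ m x → B x (pow m x) ≢ true
    B-pow zero    x b = A-B-disjoint (A-refl x) b
    B-pow (suc m) x b = B-pow m x (trans (sym (B-τ x (pow m x))) b)

    -- τⁿ x lies in T x but not in B x, so τⁿ x = τⁱ x for some i < n, and τⁿ⁻ⁱ fixes x.
    pow-n : ∀ x → pow n x ≡ x
    pow-n x with T⇒A⊎B (T-pow n x)
    ... | inj₂ b = contradiction b (B-pow n x)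
    ... | inj₁ (i , a) with toℕ i in eq
    ... | zero  = trans (A⇒pow a) (cong (λ m → pow m x) eq)
    ... | suc m = contradiction (trans (sym (toℕ-fromℕ< n∸i<n)) (trans (cong toℕ j≡0) (toℕ-fromℕ< (ℕ.>-nonZero⁻¹ n)))) (ℕₚ.m>n⇒m∸n≢0 i<n)
      where
      i<n : suc m < n
      i<n = subst (_< n) eq (toℕ<n i)
      n∸i<n : n ∸ suc m < n
      n∸i<n = ℕₚ.∸-monoʳ-< {n} {suc m} {0} (s≤s z≤n) (ℕₚ.<⇒≤ i<n)
      fixed : pow (n ∸ suc m) x ≡ x
      fixed = pow-injective (suc m) (trans (sym (pow-+ (suc m) (n ∸ suc m) x)) (trans (cong (λ m → pow m x) (ℕₚ.m+[n∸m]≡n (ℕₚ.<⇒≤ i<n)))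
        (trans (A⇒pow a) (cong (λ m → pow m x) eq))))
      -- Since τʲ fixes x for j = n-i, the pair (x, x) lies in A_{0,j} as well as in A_{0,0};
      -- disjointness gives j = 0, whereas i < n.
      j≡0 : fromℕ< n∸i<n ≡ 0ₙ n
      j≡0 = A-disjoint (subst (λ y → A (fromℕ< n∸i<n) x y ≡ true) (trans (σ-pow n∸i<n x) fixed) (A-σ (fromℕ< n∸i<n) x)) (A-refl x)

    pow-multiple : ∀ q x → pow (q * n) x ≡ x
    pow-multiple zero    x = refl
    pow-multiple (suc q) x = trans (pow-+ n (q * n) x) (trans (pow-n (pow (q * n) x)) (pow-multiple q x))

    pow-% : ∀ m x → pow m x ≡ pow (m % n) x
    pow-% m x = trans (cong (λ m → pow m x) (m≡m%n+[m/n]*n m n))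
      (trans (pow-+ (m % n) (m ℕ/./ n * n) x) (cong (pow (m % n)) (pow-multiple (m ℕ/./ n) x)))

    pow-mod : ∀ m x → pow (toℕ (m mod n)) x ≡ pow m x
    pow-mod m x = trans (cong (λ m → pow m x) (toℕ-fromℕ< (m%n<n m n))) (sym (pow-% m x))

    pow-inverse : ∀ (i : Fin n) x → pow (n ∸ toℕ i) (pow (toℕ i) x) ≡ x
    pow-inverse i x = trans (sym (pow-+ (n ∸ toℕ i) (toℕ i) x))
      (trans (cong (λ m → pow m x) (ℕₚ.m∸n+n≡m (ℕₚ.<⇒≤ (toℕ<n i)))) (pow-n x))

    pow-inverseʳ : ∀ (i : Fin n) x → pow (toℕ i) (pow (n ∸ toℕ i) x) ≡ x
    pow-inverseʳ i x = trans (sym (pow-+ (toℕ i) (n ∸ toℕ i) x))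
      (trans (cong (λ m → pow m x) (ℕₚ.m+[n∸m]≡n (ℕₚ.<⇒≤ (toℕ<n i)))) (pow-n x))

    -- A_{2,0} commutes with the permutation matrix of τ; the identity is read at the entry (x, τ
    -- y).
    R-τ : ∀ x y → R (τ x) (τ y) ≡ R x y
    R-τ x y = ⟦⟧-injective (trans (sym (sum-A (1 mod n) x (λ z → ⟦ R z (τ y) ⟧)))
      (trans (AR (1 mod n) x (τ y)) (sum-Aʳ (1 mod n) y (λ z → ⟦ R x z ⟧))))

    R-pow : ∀ m x y → R (pow m x) (pow m y) ≡ R x y
    R-pow zero    x y = refl
    R-pow (suc m) x y = trans (R-τ (pow m x) (pow m y)) (R-pow m x y)

    -- All or nothing again: by `RT` the number of R-neighbours of x in the class of y is 0 if
    -- `T x y` holds and otherwise k, that is, all of them.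
    R-T : ∀ {x z} → R x z ≡ true → ∀ y → T z y ≡ not (T x y)
    R-T {x} {z} r y with T x y in eq
    ... | true  = ⟦⟧-injective (ℕₚ.n≤0⇒n≡0 (begin
      ⟦ T z y ⟧                                    ≡⟨ ℕₚ.*-identityˡ ⟦ T z y ⟧ ⟨
      1 * ⟦ T z y ⟧                                ≡⟨ cong (_* ⟦ T z y ⟧) (⟦true⟧ r) ⟨
      ⟦ R x z ⟧ * ⟦ T z y ⟧                        ≤⟨ ≤-sum (λ z → ⟦ R x z ⟧ * ⟦ T z y ⟧) z ⟩
      sum (λ z → ⟦ R x z ⟧ * ⟦ T z y ⟧)            ≡⟨ ℕₚ.+-cancelʳ-≡ k _ 0 (trans (cong (sum (λ z → ⟦ R x z ⟧ * ⟦ T z y ⟧) ℕ.+_)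
                                                        (trans (sym (ℕₚ.*-identityʳ k)) (cong (λ t → k * ⟦ t ⟧) (sym eq)))) (RT x y)) ⟩
      0                                            ∎))
      where open ℕₚ.≤-Reasoning
    ... | false = ⟦⟧-injective (begin
      ⟦ T z y ⟧                 ≡⟨ ℕₚ.*-identityˡ ⟦ T z y ⟧ ⟨
      1 * ⟦ T z y ⟧             ≡⟨ cong (_* ⟦ T z y ⟧) (⟦true⟧ r) ⟨
      ⟦ R x z ⟧ * ⟦ T z y ⟧     ≡⟨ sum-mono-≡ (λ z → ℕₚ.≤-trans (ℕₚ.*-monoʳ-≤ ⟦ R x z ⟧ (⟦⟧≤1 (T z y))) (ℕₚ.≤-reflexive (ℕₚ.*-identityʳ ⟦ R x z ⟧)))
                                    (trans sum≡k (sym (R-rows x))) z ⟩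
      ⟦ R x z ⟧                 ≡⟨ ⟦true⟧ r ⟩
      1                         ∎)
      where
      open ≡-Reasoning
      sum≡k : sum (λ z → ⟦ R x z ⟧ * ⟦ T z y ⟧) ≡ k
      sum≡k = trans (sym (ℕₚ.+-identityʳ _)) (trans (cong (sum (λ z → ⟦ R x z ⟧ * ⟦ T z y ⟧) ℕ.+_)
        (trans (sym (ℕₚ.*-zeroʳ k)) (cong (λ t → k * ⟦ t ⟧) (sym eq)))) (RT x y))

    module _ .{{_ : NonZero (n * (v ∸ 1))}} where

      -- The diagonal entry of A_{2,0}² at x counts the neighbours z of x that have x as a
      -- neighbour. It equals k, the number of all neighbours, so none fails.
      R-sym : ∀ {x z} → R x z ≡ true → R z x ≡ true
      R-sym {x} {z} r = ⟦⟧≢0 λ r′≡0 → contradiction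
        (trans (sym (⟦true⟧ r)) (trans (sym (sum-mono-≡ (λ z → ℕₚ.≤-trans (ℕₚ.*-monoʳ-≤ ⟦ R x z ⟧ (⟦⟧≤1 (R z x))) (ℕₚ.≤-reflexive (ℕₚ.*-identityʳ ⟦ R x z ⟧)))
          (trans sum≡k (sym (R-rows x))) z)) (trans (cong (⟦ R x z ⟧ *_) r′≡0) (ℕₚ.*-zeroʳ ⟦ R x z ⟧)))) λ ()
        where
        sum≡k : sum (λ z → ⟦ R x z ⟧ * ⟦ R z x ⟧) ≡ k
        sum≡k = ℕₚ.*-cancelˡ-≡ _ k (n * (v ∸ 1)) (begin
          n * (v ∸ 1) * sum (λ z → ⟦ R x z ⟧ * ⟦ R z x ⟧)                            ≡⟨ RR x x ⟩
          n * (v ∸ 1) * k * ⟦ A (0ₙ n) x x ⟧ + k * (k ∸ 1) * ⟦ B x x ⟧               ≡⟨ cong₂ (λ a b → n * (v ∸ 1) * k * a + k * (k ∸ 1) * b) (⟦true⟧ (A-refl x)) (⟦false⟧ (A-B-disjoint (A-refl x))) ⟩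
          n * (v ∸ 1) * k * 1 + k * (k ∸ 1) * 0                                      ≡⟨ cong₂ _+_ (ℕₚ.*-identityʳ (n * (v ∸ 1) * k)) (ℕₚ.*-zeroʳ (k * (k ∸ 1))) ⟩
          n * (v ∸ 1) * k + 0                                                        ≡⟨ ℕₚ.+-identityʳ _ ⟩
          n * (v ∸ 1) * k                                                            ∎)
          where open ≡-Reasoning

      R-comm : ∀ x z → R x z ≡ R z x
      R-comm x z with R x z in eq | R z x in eq′
      ... | true  | true  = refl
      ... | false | false = refl
      ... | true  | false = trans (sym (R-sym eq)) eq′
      ... | false | true  = trans (sym eq) (R-sym eq′)

      -- By `RR` the square of A_{2,0} is supported on A_{0,0} and A₁, whereas a common neighbour
      -- makes its entry at (x, y) positive.
      R-meet : ∀ {x y z} → R x z ≡ true → R y z ≡ true → x ≡ y ⊎ B x y ≡ true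
      R-meet {x} {y} {z} r r′ with A (0ₙ n) x y in eq | B x y in eq′
      ... | _     | true  = inj₂ refl
      ... | true  | false = inj₁ (trans (sym (σ-0 x)) (sym (A⇒σ eq)))
      ... | false | false = contradiction (ℕₚ.≤-trans
              (ℕₚ.≤-reflexive (sym (cong₂ _*_ (⟦true⟧ r) (⟦true⟧ (R-sym r′)))))
              (ℕₚ.≤-trans (≤-sum (λ z → ⟦ R x z ⟧ * ⟦ R z y ⟧) z) (ℕₚ.≤-reflexive sum≡0))) λ ()
        where
        sum≡0 : sum (λ z → ⟦ R x z ⟧ * ⟦ R z y ⟧) ≡ 0
        sum≡0 = ℕₚ.*-cancelˡ-≡ _ 0 (n * (v ∸ 1)) (trans (RR x y) (trans
          (cong₂ (λ a b → n * (v ∸ 1) * k * ⟦ a ⟧ + k * (k ∸ 1) * ⟦ b ⟧) eq eq′)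
          (trans (cong₂ _+_ (ℕₚ.*-zeroʳ (n * (v ∸ 1) * k)) (ℕₚ.*-zeroʳ (k * (k ∸ 1)))) (sym (ℕₚ.*-zeroʳ (n * (v ∸ 1)))))))

      R-common : ∀ {x y} → B x y ≡ true → n * (v ∸ 1) * sum (λ z → ⟦ R x z ⟧ * ⟦ R y z ⟧) ≡ k * (k ∸ 1)
      R-common {x} {y} b = begin
        n * (v ∸ 1) * sum (λ z → ⟦ R x z ⟧ * ⟦ R y z ⟧)                    ≡⟨ cong (n * (v ∸ 1) *_) (sum-cong-≗ λ z → cong (λ r → ⟦ R x z ⟧ * ⟦ r ⟧) (R-comm y z)) ⟩
        n * (v ∸ 1) * sum (λ z → ⟦ R x z ⟧ * ⟦ R z y ⟧)                    ≡⟨ RR x y ⟩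
        n * (v ∸ 1) * k * ⟦ A (0ₙ n) x y ⟧ + k * (k ∸ 1) * ⟦ B x y ⟧       ≡⟨ cong₂ (λ a b → n * (v ∸ 1) * k * a + k * (k ∸ 1) * b) (⟦false⟧ λ a → A-B-disjoint a b) (⟦true⟧ b) ⟩
        n * (v ∸ 1) * k * 0 + k * (k ∸ 1) * 1                              ≡⟨ cong₂ _+_ (ℕₚ.*-zeroʳ (n * (v ∸ 1) * k)) (ℕₚ.*-identityʳ (k * (k ∸ 1))) ⟩
        k * (k ∸ 1)                                                        ∎
        where open ≡-Reasoning

      -- By symmetry x is a common neighbour of τⁱ y and τʲ y, so these are equal or related by A₁.
      -- The latter never happens inside an orbit (`B-pow`), and the former gives i = j because the
      -- A_{0,i} are disjoint.
      R-unique : ∀ {x y} {i j : Fin n} → R x (pow (toℕ i) y) ≡ true → R x (pow (toℕ j) y) ≡ true → i ≡ j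
      R-unique {x} {y} {i} {j} r r′ with R-meet (R-sym r) (R-sym r′)
      ... | inj₁ eq = A-disjoint (A-pow i y) (subst (λ z → A j y z ≡ true) (sym eq) (A-pow j y))
      ... | inj₂ b  = contradiction (subst (λ z → B (pow (toℕ i) y) z ≡ true) eq b) (B-pow (toℕ j + (n ∸ toℕ i)) (pow (toℕ i) y))
        where
        eq : pow (toℕ j) y ≡ pow (toℕ j + (n ∸ toℕ i)) (pow (toℕ i) y)
        eq = sym (trans (pow-+ (toℕ j) (n ∸ toℕ i) (pow (toℕ i) y)) (cong (pow (toℕ j)) (pow-inverse i y)))

    -- Representatives of the blocks in a class of T.

    -- The number `m` of blocks stays a parameter: that it is v follows only by counting with
    -- `sum-T`.
    record Transversal (m : ℕ) (y : Fin N) : Set where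
      field
        rep      : Fin m → Fin N
        same     : ∀ b → T y (rep b) ≡ true
        covers   : ∀ {z} → T y z ≡ true → ∃[ b ] ∃[ i ] z ≡ pow (toℕ {n} i) (rep b)
        separate : ∀ {b b′} a → rep b′ ≡ pow a (rep b) → b ≡ b′

      -- The points τⁱ (rep b) run through the class of y exactly once. This bijection is used in
      -- the form that the indicators `A i (rep b) z` sum to 1 over b and i for each z in the class,
      -- after which the sums are interchanged.
      sum-T : (f : Fin N → ℕ) → (∀ z → T y z ≢ true → f z ≡ 0) →
        sum f ≡ sum λ b → sum λ i → f (pow (toℕ {n} i) (rep b))
      sum-T f f≡0 = begin
        sum f                                                                ≡⟨ sum-cong-≗ weight ⟩
        sum (λ z → sum λ b → sum λ i → ⟦ A i (rep b) z ⟧ * f z)              ≡⟨ ∑-comm (λ z b → sum λ i → ⟦ A i (rep b) z ⟧ * f z) ⟩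
        sum (λ b → sum λ z → sum λ i → ⟦ A i (rep b) z ⟧ * f z)              ≡⟨ sum-cong-≗ {m} (λ b → ∑-comm {N} {n} (λ z i → ⟦ A i (rep b) z ⟧ * f z)) ⟩
        sum (λ b → sum λ i → sum λ z → ⟦ A i (rep b) z ⟧ * f z)              ≡⟨ sum-cong-≗ {m} (λ b → sum-cong-≗ {n} λ i → trans (sum-A i (rep b) f) (cong f (σ≡pow i (rep b)))) ⟩
        sum (λ b → sum λ i → f (pow (toℕ {n} i) (rep b)))                    ∎
        where
        open ≡-Reasoning
        weight : ∀ z → f z ≡ sum (λ b → sum λ i → ⟦ A i (rep b) z ⟧ * f z)
        weight z with T y z Boolₚ.≟ true
        ... | no ¬t = trans (f≡0 z ¬t) (sym (sum-zero {m} (λ b → sum λ i → ⟦ A i (rep b) z ⟧ * f z) λ b → sum-zero {n} (λ i → ⟦ A i (rep b) z ⟧ * f z) λ i →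
                        trans (cong (⟦ A i (rep b) z ⟧ *_) (f≡0 z ¬t)) (ℕₚ.*-zeroʳ ⟦ A i (rep b) z ⟧)))
        ... | yes t with covers t
        ... | b , i , z≡ = sym (trans
          (sum-single {m} (λ b → sum λ i → ⟦ A i (rep b) z ⟧ * f z) b λ b′ b≢b′ → sum-zero {n} (λ j → ⟦ A j (rep b′) z ⟧ * f z) λ j → cong (_* f z) (⟦false⟧ λ a → b≢b′ (sym (separate (n ∸ toℕ i + toℕ j) (begin
            rep b                                             ≡⟨ pow-inverse i (rep b) ⟨
            pow (n ∸ toℕ i) (pow (toℕ i) (rep b))             ≡⟨ cong (pow (n ∸ toℕ i)) (trans (sym z≡) (A⇒pow a)) ⟩
            pow (n ∸ toℕ i) (pow (toℕ j) (rep b′))            ≡⟨ pow-+ (n ∸ toℕ i) (toℕ j) (rep b′) ⟨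
            pow (n ∸ toℕ i + toℕ j) (rep b′)                  ∎)))))
          (sum-unique (λ j → A j (rep b) z) (λ _ → f z) aᵢ (A-disjoint aᵢ)))
          where
          aᵢ : A i (rep b) z ≡ true
          aᵢ = subst (λ z → A i (rep b) z ≡ true) (sym z≡) (A-pow i (rep b))

    -- The point of least index in its orbit: a decidable choice of one representative per block, so
    -- that representatives can be filtered from a list.
    Leader : Fin N → Set
    Leader z = ∀ (i : Fin n) → toℕ z ≤ toℕ (pow (toℕ i) z)

    leader? : Decidable Leader
    leader? z = all? λ i → toℕ z ℕₚ.≤? toℕ (pow (toℕ i) z)

    leader-exists : ∀ z → ∃[ i ] Leader (pow (toℕ {n} i) z)
    -- The search returns the least point at which a decidable predicate fails. Applied to lying
    -- outside the orbit of z it finds the least point of the orbit, up to a double negation.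
    leader-exists z = go (¬∀⟶∃¬-smallest N (λ w → ¬ Orbit w) (λ w → ¬? (orbit? w)) λ none → none z (0ₙ n , sym (trans (sym (σ≡pow (0ₙ n) z)) (σ-0 z))))
      where
      Orbit : Fin N → Set
      Orbit w = ∃[ i ] w ≡ pow (toℕ {n} i) z
      orbit? : Decidable Orbit
      orbit? w = any? λ i → w ≟ pow (toℕ i) z
      go : (∃ λ w → ¬ ¬ Orbit w × (∀ j → ¬ Orbit (inject {i = w} j))) → ∃[ i ] Leader (pow (toℕ {n} i) z)
      go (w , ¬¬o , smallest) with decidable-stable (orbit? w) ¬¬o
      ... | i , refl = i , λ j → ℕₚ.≮⇒≥ λ lt → smallest (fromℕ< lt) ((toℕ j + toℕ i) mod n , (begin
          inject {i = w} (fromℕ< lt)                ≡⟨ toℕ-injective (trans (toℕ-inject {i = w} (fromℕ< lt)) (toℕ-fromℕ< lt)) ⟩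
          pow (toℕ j) (pow (toℕ i) z)               ≡⟨ pow-+ (toℕ j) (toℕ i) z ⟨
          pow (toℕ j + toℕ i) z                     ≡⟨ pow-mod (toℕ j + toℕ i) z ⟨
          pow (toℕ ((toℕ j + toℕ i) mod n)) z       ∎))
        where open ≡-Reasoning

    leader-≤ : ∀ {z} → Leader z → ∀ m → toℕ z ≤ toℕ (pow m z)
    leader-≤ {z} l m = subst (λ w → toℕ z ≤ toℕ w) (pow-mod m z) (l (m mod n))

    transversal′ : ∀ y → ∃[ m ] Transversal m y
    transversal′ y = length reps , record
      { rep      = lookup reps
      ; same     = λ b → proj₁ (rep-P b)
      ; covers   = λ {z} t → cover z t
      -- Two leaders of one orbit are each at most the other: τᵃ leads from the first to the second,
      -- and the power n - (a mod n) of τ leads back.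
      ; separate = λ {b} {b′} a eq → unique-lookup (filter⁺ P? (allFin⁺ N)) b b′ (toℕ-injective (ℕₚ.≤-antisym
          (subst (λ w → toℕ (lookup reps b) ≤ toℕ w) (sym eq) (leader-≤ (proj₂ (rep-P b)) a))
          (subst (λ w → toℕ (lookup reps b′) ≤ toℕ w) (back a eq) (leader-≤ (proj₂ (rep-P b′)) (n ∸ toℕ (a mod n))))))
      }
      where
      P? : Decidable (λ z → T y z ≡ true × Leader z)
      P? z = (T y z Boolₚ.≟ true) ×-dec leader? z
      reps = filter P? (allFin N)
      rep-P : ∀ b → T y (lookup reps b) ≡ true × Leader (lookup reps b)
      rep-P b = proj₂ (∈-filter⁻ P? {xs = allFin N} (∈-lookup {xs = reps} b))
      back : ∀ a {x z} → z ≡ pow a x → pow (n ∸ toℕ (a mod n)) z ≡ x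
      back a {x} refl = trans (cong (pow (n ∸ toℕ (a mod n))) (sym (pow-mod a x))) (pow-inverse (a mod n) x)
      cover : ∀ z → T y z ≡ true → ∃[ b ] ∃[ i ] z ≡ pow (toℕ {n} i) (lookup reps b)
      cover z t with leader-exists z
      ... | i , l = Any.index w∈ , (n ∸ toℕ i) mod n , (begin
          z                                                                ≡⟨ pow-inverse i z ⟨
          pow (n ∸ toℕ i) w                                                ≡⟨ pow-mod (n ∸ toℕ i) w ⟨
          pow (toℕ ((n ∸ toℕ i) mod n)) w                                  ≡⟨ cong (pow (toℕ ((n ∸ toℕ i) mod n))) (lookup-index w∈) ⟩
          pow (toℕ ((n ∸ toℕ i) mod n)) (lookup reps (Any.index w∈))       ∎)
        where
        open ≡-Reasoning
        w = pow (toℕ i) z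
        w∈ = ∈-filter⁺ P? (∈-allFin w) (trans (sym (T-invariant t w)) (T-pow (toℕ i) z) , l)

    -- The class of y is counted twice: as m blocks of n points, and by row sums as n + n(v-1) = nv.
    transversal : .{{_ : NonZero v}} → ∀ y → Transversal v y
    transversal y = go (transversal′ y)
      where
      open ≡-Reasoning
      go : ∃[ m ] Transversal m y → Transversal v y
      go (m , t) = subst (λ m → Transversal m y) (ℕₚ.*-cancelʳ-≡ m v n (begin
        m * n                                                            ≡⟨ sum-const m n ⟨
        sum {m} (λ b → n)                                                ≡⟨ sum-cong-≗ {m} (λ b → trans (sum-const n 1) (ℕₚ.*-identityʳ n)) ⟨
        sum {m} (λ b → sum {n} λ i → 1)                                  ≡⟨ sum-cong-≗ {m} (λ b → sum-cong-≗ {n} λ i → ⟦true⟧ (trans (sym (T-invariant (same b) (pow (toℕ i) (rep b)))) (T-pow (toℕ i) (rep b)))) ⟨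
        sum (λ b → sum λ i → ⟦ T y (pow (toℕ {n} i) (rep b)) ⟧)          ≡⟨ sum-T (λ z → ⟦ T y z ⟧) (λ z → ⟦false⟧) ⟨
        sum (λ z → ⟦ T y z ⟧)                                            ≡⟨ sum-cong-≗ (T-split y) ⟨
        sum (λ z → sum (λ i → ⟦ A i y z ⟧) + ⟦ B y z ⟧)                  ≡⟨ ∑-distrib-+ (λ z → sum (λ i → ⟦ A i y z ⟧)) (λ z → ⟦ B y z ⟧) ⟩
        sum (λ z → sum (λ i → ⟦ A i y z ⟧)) + sum (λ z → ⟦ B y z ⟧)      ≡⟨ cong₂ _+_ (trans (∑-comm (λ z i → ⟦ A i y z ⟧)) (trans (sum-cong-≗ λ i → A-rows i y) (trans (sum-const n 1) (ℕₚ.*-identityʳ n)))) (B-rows y) ⟩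
        n + n * (v ∸ 1)                                                  ≡⟨ ℕₚ.*-suc n (v ∸ 1) ⟨
        n * suc (v ∸ 1)                                                  ≡⟨ cong (n *_) (ℕₚ.m+[n∸m]≡n (ℕ.>-nonZero⁻¹ v)) ⟩
        n * v                                                            ≡⟨ ℕₚ.*-comm n v ⟩
        v * n                                                            ∎)) t
        where open Transversal t

  -- Addition and subtraction modulo n, and differences of positions.

  module Modular (n : ℕ) .{{_ : NonZero n}} where
    open ≡-Reasoning

    %-+ˡ : ∀ a b → (a % n + b) % n ≡ (a + b) % n
    %-+ˡ a b = begin
      (a % n + b) % n              ≡⟨ %-distribˡ-+ (a % n) b n ⟩
      (a % n % n + b % n) % n      ≡⟨ cong (λ z → (z + b % n) % n) (m%n%n≡m%n a n) ⟩
      (a % n + b % n) % n          ≡⟨ %-distribˡ-+ a b n ⟨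
      (a + b) % n                  ∎

    [i+n]%n : ∀ (i : Fin n) → (toℕ i + n) % n ≡ toℕ i
    [i+n]%n i = trans ([m+n]%n≡m%n (toℕ i) n) (m<n⇒m%n≡m (toℕ<n i))

    toℕ-mod : ∀ m → toℕ (m mod n) ≡ m % n
    toℕ-mod m = toℕ-fromℕ< (m%n<n m n)

    +-then--ₙ : ∀ g i → _-ₙ_ n ((toℕ g + toℕ i) mod n) i ≡ g
    +-then--ₙ g i = toℕ-injective (begin
      toℕ (_-ₙ_ n ((toℕ g + toℕ i) mod n) i)               ≡⟨ toℕ-mod _ ⟩
      (toℕ ((toℕ g + toℕ i) mod n) + (n ∸ toℕ i)) % n      ≡⟨ cong (λ z → (z + (n ∸ toℕ i)) % n) (toℕ-mod (toℕ g + toℕ i)) ⟩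
      ((toℕ g + toℕ i) % n + (n ∸ toℕ i)) % n              ≡⟨ %-+ˡ (toℕ g + toℕ i) (n ∸ toℕ i) ⟩
      (toℕ g + toℕ i + (n ∸ toℕ i)) % n                    ≡⟨ cong (_% n) (trans (ℕₚ.+-assoc (toℕ g) (toℕ i) (n ∸ toℕ i)) (cong (toℕ g ℕ.+_) (ℕₚ.m+[n∸m]≡n (ℕₚ.<⇒≤ (toℕ<n i))))) ⟩
      (toℕ g + n) % n                                      ≡⟨ [i+n]%n g ⟩
      toℕ g                                                ∎)

    -ₙ-then-+ : ∀ j i → (toℕ (_-ₙ_ n j i) + toℕ i) mod n ≡ j
    -ₙ-then-+ j i = toℕ-injective (begin
      toℕ ((toℕ (_-ₙ_ n j i) + toℕ i) mod n)               ≡⟨ toℕ-mod _ ⟩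
      (toℕ (_-ₙ_ n j i) + toℕ i) % n                       ≡⟨ cong (λ z → (z + toℕ i) % n) (toℕ-mod (toℕ j + (n ∸ toℕ i))) ⟩
      ((toℕ j + (n ∸ toℕ i)) % n + toℕ i) % n              ≡⟨ %-+ˡ (toℕ j + (n ∸ toℕ i)) (toℕ i) ⟩
      (toℕ j + (n ∸ toℕ i) + toℕ i) % n                    ≡⟨ cong (_% n) (trans (ℕₚ.+-assoc (toℕ j) (n ∸ toℕ i) (toℕ i)) (cong (toℕ j ℕ.+_) (ℕₚ.m∸n+n≡m (ℕₚ.<⇒≤ (toℕ<n i))))) ⟩
      (toℕ j + n) % n                                      ≡⟨ [i+n]%n j ⟩
      toℕ j                                                ∎)

    open Lists

    -- With p true only at j and p′ true only at i, the sum asks whether g + i = j modulo n, that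
    -- is, whether j - i = g. If either predicate is empty, both sides are 0, the matrix entry being
    -- the formal zero.
    sum-shift : (p p′ : Fin n → Bool) → (∀ {i j} → p i ≡ true → p j ≡ true → i ≡ j) →
      (∀ {i j} → p′ i ≡ true → p′ j ≡ true → i ≡ j) → ∀ g →
      sum (λ i → ⟦ p′ i ⟧ * ⟦ p ((toℕ g + toℕ i) mod n) ⟧) ≡ is-just-of g (zipWith (_-ₙ_ n) (find p) (find p′))
    sum-shift p p′ unique unique′ g with find-spec p′
    ... | inj₂ (none , eq) = trans (sum-zero {n} (λ i → ⟦ p′ i ⟧ * ⟦ p ((toℕ g + toℕ i) mod n) ⟧) λ i → cong (_* ⟦ p ((toℕ g + toℕ i) mod n) ⟧) (⟦false⟧ (none i)))
                                   (sym (trans (cong (λ m → is-just-of g (zipWith (_-ₙ_ n) (find p) m)) eq) (zero-right (find p))))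
      where
      zero-right : ∀ m → is-just-of g (zipWith (_-ₙ_ n) m nothing) ≡ 0
      zero-right nothing  = refl
      zero-right (just _) = refl
    ... | inj₁ (i , p′ᵢ , eq) = trans (sum-unique p′ (λ i → ⟦ p ((toℕ g + toℕ i) mod n) ⟧) p′ᵢ (unique′ p′ᵢ))
                                      (trans (go (find-spec p)) (sym (cong (λ m → is-just-of g (zipWith (_-ₙ_ n) (find p) m)) eq)))
      where
      go : (∃[ j ] p j ≡ true × find p ≡ just j) ⊎ ((∀ j → p j ≢ true) × find p ≡ nothing) →
        ⟦ p ((toℕ g + toℕ i) mod n) ⟧ ≡ is-just-of g (zipWith (_-ₙ_ n) (find p) (just i))
      go (inj₂ (none , eq))   = trans (⟦false⟧ (none _)) (sym (cong (λ m → is-just-of g (zipWith (_-ₙ_ n) m (just i))) eq))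
      go (inj₁ (j , pⱼ , eq)) = trans (decide (_-ₙ_ n j i ≟ g)) (sym (cong (λ m → is-just-of g (zipWith (_-ₙ_ n) m (just i))) eq))
        where
        decide : (d : Dec (_-ₙ_ n j i ≡ g)) → ⟦ p ((toℕ g + toℕ i) mod n) ⟧ ≡ ⟦ does d ⟧
        decide (yes refl) = ⟦true⟧ (trans (cong p (-ₙ-then-+ j i)) pⱼ)
        decide (no j-i≢g) = ⟦false⟧ λ p⁺ → j-i≢g (trans (cong (λ j → _-ₙ_ n j i) (unique pⱼ p⁺)) (+-then--ₙ g i))

  -- The weighing matrix, its row weights and its balance.

  module Construction {n v k N : ℕ} .{{_ : NonZero n}} .{{_ : NonZero v}} .{{_ : NonZero k}} .{{_ : NonZero (n * (v ∸ 1))}}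
    (C : Counts n v k N)
    {x₀ y₀ : Fin N} (r₀ : Counts.R C x₀ y₀ ≡ true)
    (X : CyclicAction.Transversal C v x₀) (Y : CyclicAction.Transversal C v y₀) where
    open Counts C
    open CyclicAction C
    open Lists
    open Modular n
    open ≡-Reasoning

    module X = Transversal X
    module Y = Transversal Y

    -- T has two classes: `T y₀ z` and `T z z` are both the negation of z lying in the class of x₀,
    -- by `R-T` applied to x₀ y₀ and to x z.
    R-opposite : ∀ {x z} → T x₀ x ≡ true → R x z ≡ true → T y₀ z ≡ true
    R-opposite {x} {z} t r = begin
      T y₀ z          ≡⟨ R-T r₀ z ⟩
      not (T x₀ z)    ≡⟨ cong not (T-invariant t z) ⟨
      not (T x z)     ≡⟨ R-T r z ⟨
      T z z           ≡⟨ T-refl z ⟩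
      true            ∎

    hits : Fin v → Fin v → Fin n → Bool
    hits a b j = R (X.rep a) (pow (toℕ j) (Y.rep b))

    hits-unique : ∀ a b {i j} → hits a b i ≡ true → hits a b j ≡ true → i ≡ j
    hits-unique a b = R-unique

    -- W a b = j when A_{2,0} relates the a-th point on one side to τʲ of the b-th point
    -- on the other side.
    W : Fin v → Fin v → Maybe (Fin n)
    W a b = find (hits a b)

    -- All k neighbours of `X.rep a` lie in the opposite class and no block contains two of them, so
    -- the nonzero entries of the row correspond to the neighbours.
    row-weight : ∀ a → length (catMaybes (tabulate (W a))) ≡ k
    row-weight a = begin
      length (catMaybes (tabulate (W a)))             ≡⟨ length-catMaybes (W a) ⟩
      sum (λ b → ⟦ is-just (W a b) ⟧)                 ≡⟨ sum-cong-≗ {v} (λ b → sum-find {n} (hits a b) (hits-unique a b)) ⟨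
      sum (λ b → sum λ i → ⟦ hits a b i ⟧)            ≡⟨ Y.sum-T (λ z → ⟦ R (X.rep a) z ⟧) (λ z ¬t → ⟦false⟧ λ r → ¬t (R-opposite (X.same a) r)) ⟨
      sum (λ z → ⟦ R (X.rep a) z ⟧)                   ≡⟨ R-rows (X.rep a) ⟩
      k                                               ∎

    -- Inside a class of T, two points not related by A₁ are related by some A_{0,i} and hence share
    -- an orbit; distinct representatives do not, even after translation.
    B-translate : ∀ {a a′} → a ≢ a′ → ∀ m → B (pow m (X.rep a)) (X.rep a′) ≡ true
    B-translate {a} {a′} a≢a′ m with T⇒A⊎B (trans (T-invariant (T-pow m (X.rep a)) (X.rep a′)) (trans (T-invariant (X.same a) (X.rep a′)) (X.same a′)))
    ... | inj₂ b       = b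
    ... | inj₁ (i , e) = contradiction (X.separate (toℕ i + m) (trans (A⇒pow e) (sym (pow-+ (toℕ i) m (X.rep a))))) a≢a′

    -- If z is the neighbour of x′ in block b, the difference of the entries in column b is g
    -- exactly when τ^g z is a neighbour of x, equivalently when z is a neighbour of τ^(-g) x. So
    -- the columns with difference g correspond to the common neighbours of τ^(-g) x and x′, two
    -- points related by A₁ whatever g is.
    balanced : ∀ a a′ → a ≢ a′ → ∀ g → n * (v ∸ 1) * length (filter (_≟ g) (differences n W a a′)) ≡ k * (k ∸ 1)
    balanced a a′ a≢a′ g = begin
      n * (v ∸ 1) * length (filter (_≟ g) (differences n W a a′))
        ≡⟨ cong (n * (v ∸ 1) *_) count ⟩
      n * (v ∸ 1) * sum (λ z → ⟦ R (pow (n ∸ toℕ g) x) z ⟧ * ⟦ R x′ z ⟧)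
        ≡⟨ R-common (B-translate a≢a′ (n ∸ toℕ g)) ⟩
      k * (k ∸ 1) ∎
      where
      x = X.rep a
      x′ = X.rep a′
      f : Fin N → ℕ
      f z = ⟦ R x′ z ⟧ * ⟦ R x (pow (toℕ g) z) ⟧
      -- The exponent `n ∸ toℕ g` stands for -g; for g = 0 it is n, and τⁿ is the identity.
      shift : ∀ z → R x (pow (toℕ g) z) ≡ R (pow (n ∸ toℕ g) x) z
      shift z = trans (cong (λ x → R x (pow (toℕ g) z)) (sym (pow-inverseʳ g x))) (R-pow (toℕ g) (pow (n ∸ toℕ g) x) z)
      count : length (filter (_≟ g) (differences n W a a′)) ≡ sum (λ z → ⟦ R (pow (n ∸ toℕ g) x) z ⟧ * ⟦ R x′ z ⟧)
      count = begin
        length (filter (_≟ g) (differences n W a a′))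
          ≡⟨ length-filter (λ b → zipWith (_-ₙ_ n) (W a b) (W a′ b)) g ⟩
        sum (λ b → is-just-of g (zipWith (_-ₙ_ n) (W a b) (W a′ b)))
          ≡⟨ sum-cong-≗ {v} (λ b → sum-shift (hits a b) (hits a′ b) (hits-unique a b) (hits-unique a′ b) g) ⟨
        sum (λ b → sum λ i → ⟦ hits a′ b i ⟧ * ⟦ hits a b ((toℕ g + toℕ i) mod n) ⟧)
          ≡⟨ sum-cong-≗ {v} (λ b → sum-cong-≗ {n} λ i → cong (λ w → ⟦ hits a′ b i ⟧ * ⟦ R x w ⟧)
               (trans (pow-mod (toℕ g + toℕ i) (Y.rep b)) (pow-+ (toℕ g) (toℕ i) (Y.rep b)))) ⟩
        sum (λ b → sum λ i → f (pow (toℕ {n} i) (Y.rep b)))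
          ≡⟨ Y.sum-T f (λ z ¬t → cong (_* ⟦ R x (pow (toℕ g) z) ⟧) (⟦false⟧ λ r → ¬t (R-opposite (X.same a′) r))) ⟨
        sum f
          ≡⟨ sum-cong-≗ (λ z → trans (ℕₚ.*-comm ⟦ R x′ z ⟧ _) (cong (λ r → ⟦ r ⟧ * ⟦ R x′ z ⟧) (shift z))) ⟩
        sum (λ z → ⟦ R (pow (n ∸ toℕ g) x) z ⟧ * ⟦ R x′ z ⟧) ∎

open Combinatorics

-- From eigenvalues to counting identities.

module FromEigenmatrices (K : CommutativeRing 0ℓ 0ℓ) (𝒩 : NaturalsIn K) where

  open CommutativeRing K hiding (zero) renaming (refl to ≈-refl; sym to ≈-sym; trans to ≈-trans)
  open MatrixAlgebra K
  open NaturalsIn 𝒩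

  module _ {m N : ℕ} (E : Fin m → Mat N)
    (multiply : ∀ s t → lin s E ⊗ lin t E ≋ lin (λ i → s i * t i) E)
    where

    open Spectra 𝒩 E multiply

    -- The tables enter only through the identities listed here, which both cases satisfy, so that
    -- the counting identities are derived once.
    module _ (rel : Fin m → Fin N → Fin N → Bool) (P Q : Fin m → Fin m → Carrier)
      (partition   : ∀ x y → SemiringSum.sum ℕₚ.+-*-semiring (λ r → ⟦ rel r x y ⟧) ≡ 1)
      (spectrum    : ∀ r → Spectrum (λ x y → ⟦ rel r x y ⟧) (λ l → P l r))
      (e₀ e₁       : Fin m) (size 1/size : Carrier) (size-inverse : size * 1/size ≈ 1#)
      (E₀≈J        : ∀ x y → E e₀ x y ≈ 1/size)
      (E₁≈Q        : ∀ x y → E e₁ x y ≈ 1/size * lin (λ r → Q r e₁) (λ r x y → ι ⟦ rel r x y ⟧) x y)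
      {n v k : ℕ} .{{_ : NonZero n}}
      (a₀ : Fin n → Fin m) (a₁ a₂ : Fin m) (side : Fin m → Bool)
      (diagonal     : ∀ x → rel (a₀ (0ₙ n)) x x ≡ true)
      (a₀-injective : ∀ {i j} → a₀ i ≡ a₀ j → i ≡ j)
      (a₀≢a₁        : ∀ {i} → a₀ i ≢ a₁)
      (side-a₀      : ∀ i → side (a₀ i) ≡ true)
      (side-a₁      : side a₁ ≡ true)
      (side-only    : ∀ r → side r ≡ true → (∃[ i ] r ≡ a₀ i) ⊎ r ≡ a₁)
      (Q-side       : ∀ r → 1# + Q r e₁ ≈ ι (2 ℕ.* ⟦ side r ⟧))
      (P₀-a₀        : ∀ i → P e₀ (a₀ i) ≈ ι 1)
      (P₀-a₁        : P e₀ a₁ ≈ ι (n ℕ.* (v ℕ.∸ 1)))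
      (P₀-a₂        : P e₀ a₂ ≈ ι k)
      (P₁-a₀        : ∀ i → P e₁ (a₀ i) ≈ ι 1)
      (P₁-a₁        : P e₁ a₁ ≈ ι (n ℕ.* (v ℕ.∸ 1)))
      (P₁-a₂        : P e₁ a₂ ≈ - ι k)
      (P-a₀a₀       : ∀ {i j l} → toℕ i ℕ.+ toℕ j ≡ toℕ l → ∀ e → P e (a₀ i) * P e (a₀ j) ≈ P e (a₀ l))
      (P-a₁a₀       : ∀ i e → P e a₁ * P e (a₀ i) ≈ P e a₁)
      (P-a₂a₂       : ∀ e → ι (n ℕ.* (v ℕ.∸ 1)) * (P e a₂ * P e a₂) ≈
                            ι (n ℕ.* (v ℕ.∸ 1) ℕ.* k) * P e (a₀ (0ₙ n)) + ι (k ℕ.* (k ℕ.∸ 1)) * P e a₁)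
      where

      open SemiringSum ℕₚ.+-*-semiring using (sum) renaming (sum-cong-≗ to sum-congℕ; *-distribˡ-sum to *-distribˡ-sumℕ)
      open Counting
      open import Relation.Binary.Reasoning.Setoid setoid

      class : ∀ x y → ∃[ r ] rel r x y ≡ true
      class x y = exists-true (λ r → rel r x y) λ eq → contradiction (trans (sym (partition x y)) eq) λ ()

      class-unique : ∀ {x y r r′} → rel r x y ≡ true → rel r′ x y ≡ true → r ≡ r′
      class-unique {x} {y} = unique-true (λ r → rel r x y) (ℕₚ.≤-reflexive (partition x y))

      T : Fin N → Fin N → Bool
      T x y = side (proj₁ (class x y))

      T-sum : ∀ x y → sum (λ r → ⟦ rel r x y ⟧ ℕ.* ⟦ side r ⟧) ≡ ⟦ T x y ⟧
      T-sum x y = sum-unique (λ r → rel r x y) (λ r → ⟦ side r ⟧) (proj₂ (class x y)) (class-unique (proj₂ (class x y)))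

      J : ℕMat
      J _ _ = 1

      spectrum-J : Spectrum J (δ e₀ size)
      spectrum-J = spectrum-single size e₀ λ x y → ≈-trans ι-1 (≈-sym (≈-trans (*-congˡ (E₀≈J x y)) size-inverse))

      size*E₁ : ∀ x y → size * E e₁ x y ≈ lin (λ r → Q r e₁) (λ r x y → ι ⟦ rel r x y ⟧) x y
      size*E₁ x y = ≈-trans (*-congˡ (E₁≈Q x y)) (≈-trans (≈-sym (*-assoc size 1/size _)) (≈-trans (*-congʳ size-inverse) (*-identityˡ _)))

      -- 2T = J + |X| E₁, because the E₁-column of Q is +1 on T and -1 off T.
      spectrum-2T : Spectrum (λ x y → 2 ℕ.* ⟦ T x y ⟧) (λ l → δ e₀ size l + δ e₁ size l)
      spectrum-2T x y = begin
        ι (2 ℕ.* ⟦ T x y ⟧)                                                   ≡⟨ cong ι eq ⟩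
        ι (sum (λ r → 2 ℕ.* ⟦ side r ⟧ ℕ.* ⟦ rel r x y ⟧))                    ≈⟨ ι-sum (λ r → 2 ℕ.* ⟦ side r ⟧ ℕ.* ⟦ rel r x y ⟧) ⟩
        ∑ (λ r → ι (2 ℕ.* ⟦ side r ⟧ ℕ.* ⟦ rel r x y ⟧))                      ≈⟨ sum-cong-≋ (λ r → ≈-trans (ι-* (2 ℕ.* ⟦ side r ⟧) ⟦ rel r x y ⟧) (*-congʳ (≈-sym (Q-side r)))) ⟩
        ∑ (λ r → (1# + Q r e₁) * A r)                                         ≈⟨ sum-cong-≋ (λ r → ≈-trans (distribʳ (A r) 1# (Q r e₁)) (+-congʳ (*-identityˡ (A r)))) ⟩
        ∑ (λ r → A r + Q r e₁ * A r)                                          ≈⟨ ∑-distrib-+ A (λ r → Q r e₁ * A r) ⟩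
        ∑ A + ∑ (λ r → Q r e₁ * A r)                                          ≈⟨ +-cong (≈-trans (≈-sym (ι-sum (λ r → ⟦ rel r x y ⟧))) (reflexive (cong ι (partition x y)))) (≈-sym (size*E₁ x y)) ⟩
        ι 1 + size * E e₁ x y                                                 ≈⟨ +-cong (spectrum-J x y) (≈-sym lin-e₁) ⟩
        lin (δ e₀ size) E x y + lin (δ e₁ size) E x y                         ≈⟨ lin-+ (δ e₀ size) (δ e₁ size) x y ⟩
        lin (λ l → δ e₀ size l + δ e₁ size l) E x y                           ∎
        where
        A : Fin m → Carrier
        A r = ι ⟦ rel r x y ⟧
        lin-e₁ : lin (δ e₁ size) E x y ≈ size * E e₁ x y
        lin-e₁ = lin-δ size e₁ x y
        eq : 2 ℕ.* ⟦ T x y ⟧ ≡ sum (λ r → 2 ℕ.* ⟦ side r ⟧ ℕ.* ⟦ rel r x y ⟧)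
        eq = trans (cong (2 ℕ.*_) (sym (T-sum x y))) (trans (*-distribˡ-sumℕ 2 (λ r → ⟦ rel r x y ⟧ ℕ.* ⟦ side r ⟧))
          (sum-congℕ {m} λ r → trans (cong (2 ℕ.*_) (ℕₚ.*-comm ⟦ rel r x y ⟧ ⟦ side r ⟧)) (sym (ℕₚ.*-assoc 2 ⟦ side r ⟧ ⟦ rel r x y ⟧))))

      R : Fin m → ℕMat
      R r x y = ⟦ rel r x y ⟧

      2T : ℕMat
      2T x y = 2 ℕ.* ⟦ T x y ⟧

      -- The valency is the eigenvalue on E₀: J has its spectrum at `e₀` alone, hence A_r J = a J,
      -- of which any entry gives the row sum. `columns` uses J A_r in the same way.
      rows : ∀ r a → P e₀ r ≈ ι a → ∀ x → sum (λ z → ⟦ rel r x z ⟧) ≡ a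
      rows r a eq x = trans (sum-congℕ {N} λ z → sym (ℕₚ.*-identityʳ ⟦ rel r x z ⟧))
        (trans (spectrum-injective (spectrum-⊛ {R r} {J} (spectrum r) spectrum-J) (spectrum-scale a {J} spectrum-J)
          (δ-*-cong e₀ (λ l → P l r) size (ι a) eq) x x) (ℕₚ.*-identityʳ a))

      columns : ∀ r a → P e₀ r ≈ ι a → ∀ z → sum (λ x → ⟦ rel r x z ⟧) ≡ a
      columns r a eq z = trans (sum-congℕ {N} λ x → sym (ℕₚ.*-identityˡ ⟦ rel r x z ⟧))
        (trans (spectrum-injective (spectrum-⊛ {J} {R r} spectrum-J (spectrum r)) (spectrum-scale a {J} spectrum-J)
          (λ l → ≈-trans (*-comm (δ e₀ size l) (P l r)) (δ-*-cong e₀ (λ l → P l r) size (ι a) eq l)) z z) (ℕₚ.*-identityʳ a))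

      pull-2 : ∀ {k} (f g : Fin k → ℕ) → sum (λ z → f z ℕ.* (2 ℕ.* g z)) ≡ 2 ℕ.* sum (λ z → f z ℕ.* g z)
      pull-2 {k} f g = trans (sum-congℕ {k} λ z → trans (sym (ℕₚ.*-assoc (f z) 2 (g z))) (trans (cong (ℕ._* g z) (ℕₚ.*-comm (f z) 2)) (ℕₚ.*-assoc 2 (f z) (g z))))
        (sym (*-distribˡ-sumℕ 2 (λ z → f z ℕ.* g z)))

      -- The spectrum of 2T sits at `e₀` and `e₁`, where A_r has the same eigenvalue a. The factor 2
      -- is cancelled in ℕ afterwards.
      times-T : ∀ r a → P e₀ r ≈ ι a → P e₁ r ≈ ι a → ∀ x y → sum (λ z → ⟦ rel r x z ⟧ ℕ.* ⟦ T z y ⟧) ≡ a ℕ.* ⟦ T x y ⟧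
      times-T r a eq₀ eq₁ x y = ℕₚ.*-cancelˡ-≡ _ _ 2 (trans (sym (pull-2 (λ z → ⟦ rel r x z ⟧) (λ z → ⟦ T z y ⟧)))
        (trans (spectrum-injective (spectrum-⊛ {R r} {2T} (spectrum r) spectrum-2T) (spectrum-scale a {2T} spectrum-2T) same x y)
          (trans (sym (ℕₚ.*-assoc a 2 ⟦ T x y ⟧)) (trans (cong (ℕ._* ⟦ T x y ⟧) (ℕₚ.*-comm a 2)) (ℕₚ.*-assoc 2 a ⟦ T x y ⟧)))))
        where
        same : ∀ l → P l r * (δ e₀ size l + δ e₁ size l) ≈ ι a * (δ e₀ size l + δ e₁ size l)
        same l = ≈-trans (distribˡ (P l r) _ _) (≈-trans
          (+-cong (δ-*-cong e₀ (λ l → P l r) size (ι a) eq₀ l) (δ-*-cong e₁ (λ l → P l r) size (ι a) eq₁ l))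
          (≈-sym (distribˡ (ι a) _ _)))

      -- A_{2,0} has eigenvalue k on E₀ and -k on E₁. Adding k times 2T cancels the E₁ part and
      -- doubles the E₀ part, leaving 2k J.
      a₂-times-T : ∀ x y → sum (λ z → ⟦ rel a₂ x z ⟧ ℕ.* ⟦ T z y ⟧) ℕ.+ k ℕ.* ⟦ T x y ⟧ ≡ k
      a₂-times-T x y = ℕₚ.*-cancelˡ-≡ _ _ 2 (trans (ℕₚ.*-distribˡ-+ 2 s (k ℕ.* ⟦ T x y ⟧)) (trans
        (cong₂ ℕ._+_ (sym (pull-2 (λ z → ⟦ rel a₂ x z ⟧) (λ z → ⟦ T z y ⟧)))
          (trans (sym (ℕₚ.*-assoc 2 k ⟦ T x y ⟧)) (trans (cong (ℕ._* ⟦ T x y ⟧) (ℕₚ.*-comm 2 k)) (ℕₚ.*-assoc k 2 ⟦ T x y ⟧))))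
        (trans (spectrum-injective
          (spectrum-+ {R a₂ ⊛ 2T} {λ x y → k ℕ.* 2T x y} (spectrum-⊛ {R a₂} {2T} (spectrum a₂) spectrum-2T) (spectrum-scale k {2T} spectrum-2T))
          (spectrum-scale (2 ℕ.* k) {J} spectrum-J) same x y) (ℕₚ.*-identityʳ (2 ℕ.* k)))))
        where
        s = sum (λ z → ⟦ rel a₂ x z ⟧ ℕ.* ⟦ T z y ⟧)
        same : ∀ l → P l a₂ * (δ e₀ size l + δ e₁ size l) + ι k * (δ e₀ size l + δ e₁ size l) ≈ ι (2 ℕ.* k) * δ e₀ size l
        same l = begin
          P l a₂ * (p + q) + ι k * (p + q)                    ≈⟨ +-cong (distribˡ (P l a₂) p q) (distribˡ (ι k) p q) ⟩
          (P l a₂ * p + P l a₂ * q) + (ι k * p + ι k * q)     ≈⟨ +-congʳ (+-cong (δ-*-cong e₀ (λ l → P l a₂) size (ι k) P₀-a₂ l) (δ-*-cong e₁ (λ l → P l a₂) size (- ι k) P₁-a₂ l)) ⟩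
          (ι k * p + - ι k * q) + (ι k * p + ι k * q)         ≈⟨ +-congˡ (+-comm (ι k * p) (ι k * q)) ⟩
          (ι k * p + - ι k * q) + (ι k * q + ι k * p)         ≈⟨ +-assoc (ι k * p) (- ι k * q) (ι k * q + ι k * p) ⟩
          ι k * p + (- ι k * q + (ι k * q + ι k * p))         ≈⟨ +-congˡ (+-assoc (- ι k * q) (ι k * q) (ι k * p)) ⟨
          ι k * p + ((- ι k * q + ι k * q) + ι k * p)         ≈⟨ +-congˡ (+-congʳ (≈-trans (≈-sym (distribʳ q (- ι k) (ι k))) (≈-trans (*-congʳ (-‿inverseˡ (ι k))) (zeroˡ q)))) ⟩
          ι k * p + (0# + ι k * p)                            ≈⟨ +-congˡ (+-identityˡ (ι k * p)) ⟩
          ι k * p + ι k * p                                   ≈⟨ distribʳ p (ι k) (ι k) ⟨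
          (ι k + ι k) * p                                     ≈⟨ *-congʳ (≈-trans (≈-sym (ι-+ k k)) (reflexive (cong (λ z → ι (k ℕ.+ z)) (sym (ℕₚ.+-identityʳ k))))) ⟩
          ι (2 ℕ.* k) * p                                     ∎
          where
          p = δ e₀ size l
          q = δ e₁ size l

      T-split : ∀ x y → sum (λ i → ⟦ rel (a₀ i) x y ⟧) ℕ.+ ⟦ rel a₁ x y ⟧ ≡ ⟦ T x y ⟧
      T-split x y with class x y
      ... | r , c with side r in eq
      ... | false = cong₂ ℕ._+_
        (sum-zero (λ i → ⟦ rel (a₀ i) x y ⟧) λ i → ⟦false⟧ λ c′ → absurd (side-a₀ i) (class-unique c c′))
        (⟦false⟧ λ c′ → absurd side-a₁ (class-unique c c′))
        where
        absurd : ∀ {r′} → side r′ ≡ true → r ≢ r′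
        absurd s refl = contradiction (trans (sym s) eq) λ ()
      ... | true with side-only r eq
      ... | inj₁ (i , refl) = cong₂ ℕ._+_
        (trans (sum-single (λ j → ⟦ rel (a₀ j) x y ⟧) i λ j i≢j → ⟦false⟧ λ c′ → i≢j (a₀-injective (class-unique c c′))) (⟦true⟧ c))
        (⟦false⟧ λ c′ → a₀≢a₁ (class-unique c c′))
      ... | inj₂ refl = cong₂ ℕ._+_
        (sum-zero (λ j → ⟦ rel (a₀ j) x y ⟧) λ j → ⟦false⟧ λ c′ → a₀≢a₁ (class-unique c′ c))
        (⟦true⟧ c)

      counts : Counts n v k N
      counts = record
        { A         = λ i → rel (a₀ i)
        ; B         = rel a₁
        ; R         = rel a₂
        ; T         = T
        ; A-refl    = diagonal
        ; A-rows    = λ i → rows (a₀ i) 1 (P₀-a₀ i)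
        ; A-columns = λ i → columns (a₀ i) 1 (P₀-a₀ i)
        ; B-rows    = rows a₁ (n ℕ.* (v ℕ.∸ 1)) P₀-a₁
        ; R-rows    = rows a₂ k P₀-a₂
        ; T-split   = T-split
        ; AA        = λ {i} {j} {l} eq → spectrum-injective (spectrum-⊛ {R (a₀ i)} {R (a₀ j)} (spectrum (a₀ i)) (spectrum (a₀ j))) (spectrum (a₀ l)) (P-a₀a₀ eq)
        ; BA        = λ i → spectrum-injective (spectrum-⊛ {R a₁} {R (a₀ i)} (spectrum a₁) (spectrum (a₀ i))) (spectrum a₁) (P-a₁a₀ i)
        ; AR        = λ i → spectrum-injective (spectrum-⊛ {R (a₀ i)} {R a₂} (spectrum (a₀ i)) (spectrum a₂))
                        (spectrum-⊛ {R a₂} {R (a₀ i)} (spectrum a₂) (spectrum (a₀ i))) (λ e → *-comm (P e (a₀ i)) (P e a₂))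
        ; RR        = spectrum-injective (spectrum-scale (n ℕ.* (v ℕ.∸ 1)) (spectrum-⊛ {R a₂} {R a₂} (spectrum a₂) (spectrum a₂)))
                        (spectrum-+ (spectrum-scale (n ℕ.* (v ℕ.∸ 1) ℕ.* k) (spectrum (a₀ (0ₙ n)))) (spectrum-scale (k ℕ.* (k ℕ.∸ 1)) (spectrum a₁))) P-a₂a₂
        ; AT        = λ i x y → trans (times-T (a₀ i) 1 (P₀-a₀ i) (P₁-a₀ i) x y) (ℕₚ.*-identityˡ ⟦ T x y ⟧)
        ; BT        = times-T a₁ (n ℕ.* (v ℕ.∸ 1)) P₀-a₁ P₁-a₁
        ; RT        = a₂-times-T
        }

-- Algebraic identities between the entries of the tables.

module TableIdentities (K : CommutativeRing 0ℓ 0ℓ) (𝒩 : NaturalsIn K) where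

  open CommutativeRing K hiding (zero) renaming (refl to ≈-refl; sym to ≈-sym; trans to ≈-trans)
  open NaturalsIn 𝒩
  open import Algebra.Properties.Ring ring using (-‿distribˡ-*; -‿distribʳ-*; -‿involutive)
  open import Algebra.Properties.Semiring.Exp semiring using (_^_; ^-homo-*)
  open import Relation.Binary.Reasoning.Setoid setoid

  neg-square : ∀ a → - a * - a ≈ a * a
  neg-square a = ≈-trans (≈-sym (-‿distribˡ-* a (- a))) (≈-trans (-‿cong (≈-sym (-‿distribʳ-* a a))) (-‿involutive (a * a)))

  1-1 : 1# + - 1# ≈ ι 0
  1-1 = ≈-trans (-‿inverseʳ 1#) (≈-sym ι-0)

  1+1 : 1# + 1# ≈ ι 2
  1+1 = ≈-sym (≈-trans (ι-+ 1 1) (+-cong ι-1 ι-1))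

  ^-+ : ∀ z {a b c} d → a ℕ.+ b ≡ c → z ^ (a ℕ.* d) * z ^ (b ℕ.* d) ≈ z ^ (c ℕ.* d)
  ^-+ z {a} {b} d refl = ≈-trans (≈-sym (^-homo-* z (a ℕ.* d) (b ℕ.* d))) (reflexive (cong (z ^_) (sym (ℕₚ.*-distribʳ-+ d a b))))

  ^-0 : ∀ z {a} d → a ≡ 0 → z ^ (a ℕ.* d) ≈ 1#
  ^-0 z d refl = ≈-refl

  module _ (n v k : ℕ) .{{_ : NonZero k}} where
    M : ℕ
    M = n ℕ.* (v ∸ 1)

    -- The identity for A_{2,0}² on one eigenspace, with a₀, a₁, a₂ the eigenvalues of A_{0,0}, A₁,
    -- A_{2,0} there, multiplied by M = n(v-1).
    Quadratic : Carrier → Carrier → Carrier → Set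
    Quadratic a₀ a₁ a₂ = ι M * (a₂ * a₂) ≈ ι (M ℕ.* k) * a₀ + ι (k ℕ.* (k ∸ 1)) * a₁

    -- Only the square of a₂ occurs, so eigenspaces on which A_{2,0} differs by a sign share one
    -- computation.
    quadratic-cong : ∀ {a₀ a₁ a₂ a₂′} → a₂ * a₂ ≈ a₂′ * a₂′ → Quadratic a₀ a₁ a₂ → Quadratic a₀ a₁ a₂′
    quadratic-cong eq q = ≈-trans (*-congˡ (≈-sym eq)) q

    quadratic-E₀ : Quadratic 1# (ι M) (ι k)
    quadratic-E₀ = begin
      ι M * (ι k * ι k)                                       ≈⟨ *-congˡ (ι-* k k) ⟨
      ι M * ι (k ℕ.* k)                                       ≈⟨ ι-* M (k ℕ.* k) ⟨
      ι (M ℕ.* (k ℕ.* k))                                     ≡⟨ cong ι (eq M k) ⟩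
      ι (M ℕ.* k ℕ.+ k ℕ.* (k ∸ 1) ℕ.* M)                     ≈⟨ ι-+ (M ℕ.* k) (k ℕ.* (k ∸ 1) ℕ.* M) ⟩
      ι (M ℕ.* k) + ι (k ℕ.* (k ∸ 1) ℕ.* M)                   ≈⟨ +-cong (≈-sym (*-identityʳ (ι (M ℕ.* k)))) (ι-* (k ℕ.* (k ∸ 1)) M) ⟩
      ι (M ℕ.* k) * 1# + ι (k ℕ.* (k ∸ 1)) * ι M              ∎
      where
      eq : ∀ M k .{{_ : NonZero k}} → M ℕ.* (k ℕ.* k) ≡ M ℕ.* k ℕ.+ k ℕ.* (k ∸ 1) ℕ.* M
      eq M (suc k) = S.solve 2 (λ M k → M S.:* ((S.con 1 S.:+ k) S.:* (S.con 1 S.:+ k)) S.:= M S.:* (S.con 1 S.:+ k) S.:+ (S.con 1 S.:+ k) S.:* k S.:* M) refl M k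
        where module S = ℕSolver.+-*-Solver

    quadratic-E₁ : Quadratic 1# (ι M) (- ι k)
    quadratic-E₁ = quadratic-cong (≈-sym (neg-square (ι k))) quadratic-E₀

    -- After s² has been replaced, the claim is nk times the identity (v-k) + (k-1) = v-1; the term
    -- k(k-1)n is added and subtracted because a₁ is negative.
    quadratic-E₂ : ∀ s → k ≤ v → (s * s) * ι (v ∸ 1) ≈ ι (k ℕ.* (v ∸ k)) → Quadratic 1# (- ι n) s
    quadratic-E₂ s k≤v s² = begin
      ι M * (s * s)                                                    ≈⟨ *-congʳ (ι-* n (v ∸ 1)) ⟩
      ι n * ι (v ∸ 1) * (s * s)                                        ≈⟨ *-assoc (ι n) (ι (v ∸ 1)) (s * s) ⟩
      ι n * (ι (v ∸ 1) * (s * s))                                      ≈⟨ *-congˡ (≈-trans (*-comm (ι (v ∸ 1)) (s * s)) s²) ⟩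
      ι n * ι (k ℕ.* (v ∸ k))                                          ≈⟨ ι-* n (k ℕ.* (v ∸ k)) ⟨
      ι c                                                              ≈⟨ +-identityʳ (ι c) ⟨
      ι c + 0#                                                         ≈⟨ +-congˡ (-‿inverseʳ (ι b)) ⟨
      ι c + (ι b + - ι b)                                              ≈⟨ +-assoc (ι c) (ι b) (- ι b) ⟨
      (ι c + ι b) + - ι b                                              ≈⟨ +-congʳ (ι-+ c b) ⟨
      ι (c ℕ.+ b) + - ι b                                              ≡⟨ cong (λ z → ι z + - ι b) (eq v k (v ∸ k) (ℕₚ.m+[n∸m]≡n k≤v)) ⟩
      ι (M ℕ.* k) + - ι b                                              ≈⟨ +-cong (≈-sym (*-identityʳ (ι (M ℕ.* k)))) (-‿cong (ι-* (k ℕ.* (k ∸ 1)) n)) ⟩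
      ι (M ℕ.* k) * 1# + - (ι (k ℕ.* (k ∸ 1)) * ι n)                   ≈⟨ +-congˡ (-‿distribʳ-* (ι (k ℕ.* (k ∸ 1))) (ι n)) ⟩
      ι (M ℕ.* k) * 1# + ι (k ℕ.* (k ∸ 1)) * - ι n                     ∎
      where
      b = k ℕ.* (k ∸ 1) ℕ.* n
      c = n ℕ.* (k ℕ.* (v ∸ k))
      eq : ∀ v k d .{{_ : NonZero k}} → k ℕ.+ d ≡ v → n ℕ.* (k ℕ.* d) ℕ.+ k ℕ.* (k ∸ 1) ℕ.* n ≡ n ℕ.* (v ∸ 1) ℕ.* k
      eq v (suc k) d refl = S.solve 3 (λ n k d → n S.:* ((S.con 1 S.:+ k) S.:* d) S.:+ (S.con 1 S.:+ k) S.:* k S.:* n S.:= n S.:* (k S.:+ d) S.:* (S.con 1 S.:+ k)) refl n k d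
        where module S = ℕSolver.+-*-Solver

    quadratic-E₂₂ : ∀ s → k ≤ v → (s * s) * ι (v ∸ 1) ≈ ι (k ℕ.* (v ∸ k)) → Quadratic 1# (- ι n) (- s)
    quadratic-E₂₂ s k≤v s² = quadratic-cong (≈-sym (neg-square s)) (quadratic-E₂ s k≤v s²)

    -- For k = v the root √(k(v-k)/(v-1)) degenerates to 0, so the single row E₂ of the first table
    -- is the instance s = 0.
    quadratic-E₂-k≡v : k ≡ v → Quadratic 1# (- ι n) 0#
    quadratic-E₂-k≡v k≡v = quadratic-E₂ 0# (ℕₚ.≤-reflexive k≡v)
      (≈-trans (*-congʳ (zeroˡ 0#)) (≈-trans (zeroˡ (ι (v ∸ 1))) (≈-sym (≈-trans (reflexive (cong ι eq)) ι-0))))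
      where
      eq : k ℕ.* (v ∸ k) ≡ 0
      eq = trans (cong (k ℕ.*_) (ℕₚ.m≤n⇒m∸n≡0 (ℕₚ.≤-reflexive (sym k≡v)))) (ℕₚ.*-zeroʳ k)

    -- On these eigenspaces A₁ has eigenvalue 0 and A_{0,0} the power w with exponent 0, so only t²
    -- = k remains; the factor `ι 1` matches `√-/` with denominator 1.
    quadratic-E₃ : ∀ t w → (t * t) * ι 1 ≈ ι k → w ≈ 1# → Quadratic w 0# (t * w)
    quadratic-E₃ t w t² w≈1 = begin
      ι M * ((t * w) * (t * w))                         ≈⟨ *-congˡ (*-cong tw tw) ⟩
      ι M * (t * t)                                     ≈⟨ *-congˡ (≈-trans (≈-sym (*-identityʳ (t * t))) (≈-trans (*-congˡ (≈-sym ι-1)) t²)) ⟩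
      ι M * ι k                                         ≈⟨ ι-* M k ⟨
      ι (M ℕ.* k)                                       ≈⟨ *-identityʳ (ι (M ℕ.* k)) ⟨
      ι (M ℕ.* k) * 1#                                  ≈⟨ *-congˡ w≈1 ⟨
      ι (M ℕ.* k) * w                                   ≈⟨ +-identityʳ _ ⟨
      ι (M ℕ.* k) * w + 0#                              ≈⟨ +-congˡ (zeroʳ (ι (k ℕ.* (k ∸ 1)))) ⟨
      ι (M ℕ.* k) * w + ι (k ℕ.* (k ∸ 1)) * 0#          ∎
      where
      tw : t * w ≈ t
      tw = ≈-trans (*-congˡ w≈1) (*-identityʳ t)

    quadratic-E₄ : ∀ t w → (t * t) * ι 1 ≈ ι k → w ≈ 1# → Quadratic w 0# (- t * w)
    quadratic-E₄ t w t² w≈1 = quadratic-E₃ (- t) w (≈-trans (*-congʳ (neg-square t)) t²) w≈1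

-- Transfer from labelled tables to the indices of a scheme.

-- The hypotheses of `FromEigenmatrices` stated for labels, where they can be checked by matching on
-- constructors.
record EigenmatrixFacts (n v k : ℕ) .{{_ : NonZero n}} {Rel Idem : Set} (e₀ : Idem)
    (P : Idem → Rel → ℂ) (Q : Rel → Idem → ℂ) : Set where
  field
    r₀           : Fin n → Rel
    r₁ r₂        : Rel
    e₁           : Idem
    side         : Rel → Bool
    r₀-injective : ∀ {i j} → r₀ i ≡ r₀ j → i ≡ j
    r₀≢r₁        : ∀ {i} → r₀ i ≢ r₁
    side-r₀      : ∀ i → side (r₀ i) ≡ true
    side-r₁      : side r₁ ≡ true
    side-only    : ∀ r → side r ≡ true → (∃[ i ] r ≡ r₀ i) ⊎ r ≡ r₁
    Q-side       : ∀ r → # 1 +ᶜ Q r e₁ ≈ᶜ # (2 ℕ.* ⟦ side r ⟧)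
    P₀-r₀        : ∀ i → P e₀ (r₀ i) ≈ᶜ # 1
    P₀-r₁        : P e₀ r₁ ≈ᶜ # (n ℕ.* (v ∸ 1))
    P₀-r₂        : P e₀ r₂ ≈ᶜ # k
    P₁-r₀        : ∀ i → P e₁ (r₀ i) ≈ᶜ # 1
    P₁-r₁        : P e₁ r₁ ≈ᶜ # (n ℕ.* (v ∸ 1))
    P₁-r₂        : P e₁ r₂ ≈ᶜ -ᶜ # k
    P-r₀r₀       : ∀ i j l → toℕ i ℕ.+ toℕ j ≡ toℕ l → ∀ e → P e (r₀ i) *ᶜ P e (r₀ j) ≈ᶜ P e (r₀ l)
    P-r₁r₀       : ∀ i e → P e r₁ *ᶜ P e (r₀ i) ≈ᶜ P e r₁
    P-r₂r₂       : ∀ e → # (n ℕ.* (v ∸ 1)) *ᶜ (P e r₂ *ᶜ P e r₂) ≈ᶜ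
                         # (n ℕ.* (v ∸ 1) ℕ.* k) *ᶜ P e (r₀ (0ₙ n)) +ᶜ # (k ℕ.* (k ∸ 1)) *ᶜ P e r₁

module FromScheme {n v k : ℕ} .{{_ : NonZero n}} {Rel Idem : Set} {a₀ : Rel} {e₀ : Idem}
  {P : Idem → Rel → ℂ} {Q : Rel → Idem → ℂ} (S : SchemeWithEigenmatrices a₀ e₀ P Q)
  (F : EigenmatrixFacts n v k e₀ P Q) (r₀-0 : EigenmatrixFacts.r₀ F (0ₙ n) ≡ a₀) where

  open EigenmatrixFacts F
  open SchemeWithEigenmatrices S
  open CommutativeAssociationScheme scheme
  open ComplexRing
  open CommutativeRing ℂ-commutativeRing using (reflexive; *-comm; *-congˡ; *-identityʳ) renaming (trans to ≈-trans)
  open MatrixAlgebra ℂ-commutativeRing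

  module Basis = IsPrimitiveIdempotentBasis E-basis
  module Primitive i = IsPrimitiveIdempotent (Basis.primitiveIdempotent i)

  1≉0 : ¬ # 1 ≈ᶜ # 0
  1≉0 eq = contradiction (#-injective {1} {0} eq) λ ()

  open OrthogonalIdempotents A E closed commutative Primitive.in-algebra Primitive.idempotent Primitive.minimal Basis.independent 1≉0
    using (lin-multiply)

  open Spectra ℂ-naturals E lin-multiply
    using (Spectrum; ι-sum)

  A≡# : ∀ r x y → A r x y ≡ # ⟦ relation r x y ⟧
  A≡# r x y with relation r x y
  ... | true  = refl
  ... | false = refl

  partition : ∀ x y → SemiringSum.sum ℕₚ.+-*-semiring (λ r → ⟦ relation r x y ⟧) ≡ 1
  partition x y = #-injective (≈-trans {# sum f} {∑ₖ (λ r → # ⟦ relation r x y ⟧)} {# 1} (ι-sum f)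
    (≈-trans {∑ₖ (λ r → # ⟦ relation r x y ⟧)} {∑ₖ (λ r → A r x y)} {# 1} (reflexive (sum-cong-≗ λ r → sym (A≡# r x y))) (∑A≈J x y)))
    where
    open SemiringSum ℕₚ.+-*-semiring using (sum)
    f = λ r → ⟦ relation r x y ⟧
    ∑ₖ = MatrixAlgebra.∑ ℂ-commutativeRing

  spectrum : ∀ r → Spectrum (λ x y → ⟦ relation r x y ⟧) (λ l → P (idem l) (rel r))
  spectrum r x y = subst (_≈ᶜ lin (λ l → P (idem l) (rel r)) E x y) (A≡# r x y) (firstEigenmatrix r x y)

  1/size : ℂ
  1/size = real (fromℚ (+ 1 / size))

  to : Rel → Fin (suc classes)
  to = Inverse.to Rel↔Fin

  rel-to : ∀ r → rel (to r) ≡ r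
  rel-to = Inverse.strictlyInverseʳ Rel↔Fin

  to-rel : ∀ r → to (rel r) ≡ r
  to-rel = Inverse.strictlyInverseˡ Rel↔Fin

  to-injective : ∀ {r r′} → to r ≡ to r′ → r ≡ r′
  to-injective {r} {r′} eq = trans (sym (rel-to r)) (trans (cong rel eq) (rel-to r′))

  e : Fin (suc classes)
  e = Inverse.to Idem↔Fin e₁

  idem-e : idem e ≡ e₁
  idem-e = Inverse.strictlyInverseʳ Idem↔Fin e₁

  -- `rel (to r)` equals `r` only propositionally, so each fact about a label is transported
  -- separately for every label it mentions.
  at : (φ : Rel → Set) → ∀ {r} → φ r → φ (rel (to r))
  at φ {r} = subst φ (sym (rel-to r))

  at-e : (φ : Idem → Set) → φ e₁ → φ (idem e)
  at-e φ = subst φ (sym idem-e)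

  diagonal : ∀ x → relation (to (r₀ (0ₙ n))) x x ≡ true
  diagonal x = subst (λ r → relation r x x ≡ true) zero≡ (⟦⟧-injective (#-injective
      (subst₂ _≈ᶜ_ (A≡# zero x x) (cong (λ b → if b then # 1 else # 0) (dec-true (x ≟ x) refl)) (A₀≈I x x))))
    where
    open Counting using (⟦⟧-injective)
    zero≡ : zero ≡ to (r₀ (0ₙ n))
    zero≡ = trans (sym (to-rel zero)) (cong to (trans rel-zero (sym r₀-0)))

  E₁≈Q : ∀ x y → E e x y ≈ᶜ 1/size *ᶜ lin (λ r → Q (rel r) (idem e)) (λ r x y → # ⟦ relation r x y ⟧) x y
  E₁≈Q x y = subst (λ z → E e x y ≈ᶜ 1/size *ᶜ z) (sum-cong-≗ λ r → cong (Q (rel r) (idem e) *ᶜ_) (A≡# r x y)) (secondEigenmatrix e x y)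

  E₀≈J : ∀ x y → E zero x y ≈ᶜ 1/size
  E₀≈J x y = ≈-trans {E zero x y} {1/size *ᶜ # 1} {1/size} (Basis.E₀≈J/N x y) (*-identityʳ 1/size)

  size-inverse : # size *ᶜ 1/size ≈ᶜ # 1
  size-inverse = ≈-trans {# size *ᶜ 1/size} {1/size *ᶜ # size} {# 1} (*-comm (# size) 1/size) (1/-inverse size)

  side-only′ : ∀ r → side (rel r) ≡ true → (∃[ i ] r ≡ to (r₀ i)) ⊎ r ≡ to r₁
  side-only′ r s with side-only (rel r) s
  ... | inj₁ (i , eq) = inj₁ (i , trans (sym (to-rel r)) (cong to eq))
  ... | inj₂ eq       = inj₂ (trans (sym (to-rel r)) (cong to eq))

  counts : Counts n v k size
  counts = FromEigenmatrices.counts ℂ-commutativeRing ℂ-naturals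
    E lin-multiply relation (λ l r → P (idem l) (rel r)) (λ r l → Q (rel r) (idem l)) partition spectrum
    zero e (# size) 1/size size-inverse E₀≈J E₁≈Q
    (λ i → to (r₀ i)) (to r₁) (to r₂) (λ r → side (rel r))
    diagonal (r₀-injective ∘ to-injective) (r₀≢r₁ ∘ to-injective)
    (λ i → at (λ r → side r ≡ true) (side-r₀ i)) (at (λ r → side r ≡ true) side-r₁) side-only′
    (λ r → at-e (λ e → # 1 +ᶜ Q (rel r) e ≈ᶜ # (2 ℕ.* ⟦ side (rel r) ⟧)) (Q-side (rel r)))
    (λ i → at-e₀ (λ e → P e (rel (to (r₀ i))) ≈ᶜ # 1) (at (λ r → P e₀ r ≈ᶜ # 1) (P₀-r₀ i)))
    (at-e₀ (λ e → P e (rel (to r₁)) ≈ᶜ # M) (at (λ r → P e₀ r ≈ᶜ # M) P₀-r₁))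
    (at-e₀ (λ e → P e (rel (to r₂)) ≈ᶜ # k) (at (λ r → P e₀ r ≈ᶜ # k) P₀-r₂))
    (λ i → at-e (λ e → P e (rel (to (r₀ i))) ≈ᶜ # 1) (at (λ r → P e₁ r ≈ᶜ # 1) (P₁-r₀ i)))
    (at-e (λ e → P e (rel (to r₁)) ≈ᶜ # M) (at (λ r → P e₁ r ≈ᶜ # M) P₁-r₁))
    (at-e (λ e → P e (rel (to r₂)) ≈ᶜ -ᶜ # k) (at (λ r → P e₁ r ≈ᶜ -ᶜ # k) P₁-r₂))
    (λ {i} {j} {l} eq f → at (λ r → P (idem f) r *ᶜ P (idem f) (rel (to (r₀ j))) ≈ᶜ P (idem f) (rel (to (r₀ l))))
      (at (λ r → P (idem f) (r₀ i) *ᶜ P (idem f) r ≈ᶜ P (idem f) (rel (to (r₀ l))))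
        (at (λ r → P (idem f) (r₀ i) *ᶜ P (idem f) (r₀ j) ≈ᶜ P (idem f) r) (P-r₀r₀ i j l eq (idem f)))))
    (λ i f → at (λ r → P (idem f) r *ᶜ P (idem f) (rel (to (r₀ i))) ≈ᶜ P (idem f) r)
      (at (λ r → P (idem f) r₁ *ᶜ P (idem f) r ≈ᶜ P (idem f) r₁) (P-r₁r₀ i (idem f))))
    (λ f → at (λ r → # M *ᶜ (P (idem f) r *ᶜ P (idem f) r) ≈ᶜ # (M ℕ.* k) *ᶜ P (idem f) (rel (to (r₀ (0ₙ n)))) +ᶜ # (k ℕ.* (k ∸ 1)) *ᶜ P (idem f) (rel (to r₁)))
      (at (λ r → # M *ᶜ (P (idem f) r₂ *ᶜ P (idem f) r₂) ≈ᶜ # (M ℕ.* k) *ᶜ P (idem f) r +ᶜ # (k ℕ.* (k ∸ 1)) *ᶜ P (idem f) (rel (to r₁)))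
        (at (λ r → # M *ᶜ (P (idem f) r₂ *ᶜ P (idem f) r₂) ≈ᶜ # (M ℕ.* k) *ᶜ P (idem f) (r₀ (0ₙ n)) +ᶜ # (k ℕ.* (k ∸ 1)) *ᶜ P (idem f) r) (P-r₂r₂ (idem f)))))
    where
    M = n ℕ.* (v ∸ 1)
    at-e₀ : (φ : Idem → Set) → φ e₀ → φ (idem zero)
    at-e₀ φ = subst φ (sym idem-zero)

  point : Fin size
  point = proj₁ (nonzero zero)

-- From the counts to a balanced generalized weighing matrix.

module _ {n v k : ℕ} .{{_ : NonZero n}} .{{_ : NonZero k}} (2≤v : 2 ≤ v) where

  private
    instance
      v-nonZero : NonZero v
      v-nonZero = ℕ.>-nonZero (ℕₚ.<-trans (ℕ.s≤s ℕ.z≤n) 2≤v)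

      v∸1-nonZero : NonZero (v ∸ 1)
      v∸1-nonZero = <⇒∸-nonZero 2≤v

      n[v∸1]-nonZero : NonZero (n ℕ.* (v ∸ 1))
      n[v∸1]-nonZero = ℕₚ.m*n≢0 n (v ∸ 1)

  -- Turns the integral balance count into the λ/n of the definition. The products (1/n) n and
  -- (1/(v-1)) (v-1) are inserted as ones, and n(v-1)L is then collected and replaced by a.
  /-*-/ : ∀ L a → n ℕ.* (v ∸ 1) ℕ.* L ≡ a → + L / 1 ≡ (+ a / (v ∸ 1)) ℚ.* (+ 1 / n)
  /-*-/ L a eq = begin
      fromℕ L                                           ≡⟨ solve 1 (λ l → l := l :* con 1ℚ :* con 1ℚ) refl (fromℕ L) ⟩
      fromℕ L ℚ.* 1ℚ ℚ.* 1ℚ                             ≡⟨ cong₂ (λ a b → fromℕ L ℚ.* a ℚ.* b) (/-fromℕ 1 n) (/-fromℕ 1 (v ∸ 1)) ⟨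
      fromℕ L ℚ.* (u ℚ.* N) ℚ.* (w ℚ.* V)               ≡⟨ solve 5 (λ l u n w v → l :* (u :* n) :* (w :* v) := n :* v :* l :* u :* w) refl (fromℕ L) u N w V ⟩
      N ℚ.* V ℚ.* fromℕ L ℚ.* u ℚ.* w                   ≡⟨ cong (λ z → z ℚ.* u ℚ.* w) NVL ⟩
      q ℚ.* V ℚ.* u ℚ.* w                               ≡⟨ solve 4 (λ q v u w → q :* v :* u :* w := q :* u :* (w :* v)) refl q V u w ⟩
      q ℚ.* u ℚ.* (w ℚ.* V)                             ≡⟨ cong (q ℚ.* u ℚ.*_) (/-fromℕ 1 (v ∸ 1)) ⟩
      q ℚ.* u ℚ.* 1ℚ                                    ≡⟨ ℚₚ.*-identityʳ (q ℚ.* u) ⟩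
      q ℚ.* u                                           ∎
    where
    open ≡-Reasoning
    open +-*-Solver using (solve; _:*_; _:=_; con)
    open Reals using (fromℕ)
    open RealArithmetic using (fromℕ-*; /-fromℕ)
    N = fromℕ n
    V = fromℕ (v ∸ 1)
    u = + 1 / n
    w = + 1 / (v ∸ 1)
    q = + a / (v ∸ 1)
    NVL : N ℚ.* V ℚ.* fromℕ L ≡ q ℚ.* V
    NVL = begin
      N ℚ.* V ℚ.* fromℕ L                     ≡⟨ cong (ℚ._* fromℕ L) (fromℕ-* n (v ∸ 1)) ⟨
      fromℕ (n ℕ.* (v ∸ 1)) ℚ.* fromℕ L       ≡⟨ fromℕ-* (n ℕ.* (v ∸ 1)) L ⟨
      fromℕ (n ℕ.* (v ∸ 1) ℕ.* L)             ≡⟨ cong fromℕ eq ⟩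
      fromℕ a                                 ≡⟨ /-fromℕ a (v ∸ 1) ⟨
      q ℚ.* V                                 ∎

  counts⇒BGW : ∀ {N} → Counts n v k N → Fin N →
    ∃[ W ] IsBGW n v k ((+ (k ℕ.* (k ∸ 1)) / (v ∸ 1)) {{<⇒∸-nonZero 2≤v}}) W
  counts⇒BGW C x₀ = W , record
    { row-weight = row-weight
    ; balanced   = λ a a′ a≢a′ g → /-*-/ _ (k ℕ.* (k ∸ 1)) (balanced a a′ a≢a′ g)
    }
    where
    open Counts C
    open CyclicAction C
    -- As k is not 0, x₀ has a neighbour, which serves as base point of the other class.
    opposite : ∃[ y₀ ] R x₀ y₀ ≡ true
    opposite = Counting.exists-true (R x₀) λ eq → ℕ.≢-nonZero⁻¹ k (trans (sym (R-rows x₀)) eq)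
    open Construction C (proj₂ opposite) (transversal x₀) (transversal (proj₁ opposite))

-- Verification of the two pairs of eigenmatrices.

module Tables (n v k : ℕ) .{{_ : NonZero n}} .{{_ : NonZero k}} where

  open ComplexRing
  open CommutativeRing ℂ-commutativeRing using (*-identityˡ; *-identityʳ; zeroˡ) renaming (refl to ≈-refl)
  open TableIdentities ℂ-commutativeRing ℂ-naturals

  private
    z : ℂ
    z = e^i (-ʳ 2π/n n)

    w^-0 : ∀ j → w^- n (0ₙ n) j ≈ᶜ # 1
    w^-0 j = ^-0 z (suc (toℕ j)) (toℕ-fromℕ< (ℕ.>-nonZero⁻¹ n))

    √k² : (√k n v k *ᶜ √k n v k) *ᶜ # 1 ≈ᶜ # k
    √k² = √-/ k 1

  facts₁ : k ≡ v → EigenmatrixFacts n v k E₀ (P₁ n v k) (Q₁ n v k)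
  facts₁ k≡v = record
    { r₀           = A₀
    ; r₁           = A₁
    ; r₂           = A₂ (0ₙ n)
    ; e₁           = E₁
    ; side         = side
    ; r₀-injective = λ { refl → refl }
    ; r₀≢r₁        = λ ()
    ; side-r₀      = λ _ → refl
    ; side-r₁      = refl
    ; side-only    = λ { (A₀ i) _ → inj₁ (i , refl) ; A₁ _ → inj₂ refl }
    ; Q-side       = λ { (A₀ _) → 1+1 ; A₁ → 1+1 ; (A₂ _) → 1-1 }
    ; P₀-r₀        = λ _ → ≈-refl {# 1}
    ; P₀-r₁        = ≈-refl {# (n ℕ.* (v ∸ 1))}
    ; P₀-r₂        = ≈-refl {# k}
    ; P₁-r₀        = λ _ → ≈-refl {# 1}
    ; P₁-r₁        = ≈-refl {# (n ℕ.* (v ∸ 1))}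
    ; P₁-r₂        = ≈-refl { -ᶜ # k}
    -- On `E₃ c` and `E₄ c` the eigenvalue of A_{0,i} is z to the power i(c+1), and i + j = l holds
    -- in ℕ, so exponents add without reduction modulo n.
    ; P-r₀r₀       = λ i j l eq → λ
        { E₀ → *-identityˡ (# 1) ; E₁ → *-identityˡ (# 1) ; E₂ → *-identityˡ (# 1)
        ; (E₃ c) → ^-+ z {toℕ i} {toℕ j} {toℕ l} (suc (toℕ c)) eq
        ; (E₄ c) → ^-+ z {toℕ i} {toℕ j} {toℕ l} (suc (toℕ c)) eq
        }
    ; P-r₁r₀       = λ i → λ
        { E₀ → *-identityʳ (# (n ℕ.* (v ∸ 1))) ; E₁ → *-identityʳ (# (n ℕ.* (v ∸ 1))) ; E₂ → *-identityʳ (-ᶜ # n)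
        ; (E₃ c) → zeroˡ (w^- n i c) ; (E₄ c) → zeroˡ (w^- n i c)
        }
    ; P-r₂r₂       = λ
        { E₀ → quadratic-E₀ n v k ; E₁ → quadratic-E₁ n v k ; E₂ → quadratic-E₂-k≡v n v k k≡v
        ; (E₃ c) → quadratic-E₃ n v k (√k n v k) (w^- n (0ₙ n) c) √k² (w^-0 c)
        ; (E₄ c) → quadratic-E₄ n v k (√k n v k) (w^- n (0ₙ n) c) √k² (w^-0 c)
        }
    }
    where
    side : Rel₁ n → Bool
    side (A₀ _) = true
    side A₁     = true
    side (A₂ _) = false

  facts₂ : (2≤v : 2 ≤ v) (k<v : k < v) → EigenmatrixFacts n v k E₀ (P₂ n v k 2≤v) (Q₂ n v k k<v)
  facts₂ 2≤v k<v = record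
    { r₀           = A₀
    ; r₁           = A₁
    ; r₂           = A₂ (0ₙ n)
    ; e₁           = E₁
    ; side         = side
    ; r₀-injective = λ { refl → refl }
    ; r₀≢r₁        = λ ()
    ; side-r₀      = λ _ → refl
    ; side-r₁      = refl
    ; side-only    = λ { (A₀ i) _ → inj₁ (i , refl) ; A₁ _ → inj₂ refl }
    ; Q-side       = λ { (A₀ _) → 1+1 ; A₁ → 1+1 ; (A₂ _) → 1-1 ; A₃ → 1-1 }
    ; P₀-r₀        = λ _ → ≈-refl {# 1}
    ; P₀-r₁        = ≈-refl {# (n ℕ.* (v ∸ 1))}
    ; P₀-r₂        = ≈-refl {# k}
    ; P₁-r₀        = λ _ → ≈-refl {# 1}
    ; P₁-r₁        = ≈-refl {# (n ℕ.* (v ∸ 1))}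
    ; P₁-r₂        = ≈-refl { -ᶜ # k}
    ; P-r₀r₀       = λ i j l eq → λ
        { E₀ → *-identityˡ (# 1) ; E₁ → *-identityˡ (# 1) ; E₂₁ → *-identityˡ (# 1) ; E₂₂ → *-identityˡ (# 1)
        ; (E₃ c) → ^-+ z {toℕ i} {toℕ j} {toℕ l} (suc (toℕ c)) eq
        ; (E₄ c) → ^-+ z {toℕ i} {toℕ j} {toℕ l} (suc (toℕ c)) eq
        }
    ; P-r₁r₀       = λ i → λ
        { E₀ → *-identityʳ (# (n ℕ.* (v ∸ 1))) ; E₁ → *-identityʳ (# (n ℕ.* (v ∸ 1)))
        ; E₂₁ → *-identityʳ (-ᶜ # n) ; E₂₂ → *-identityʳ (-ᶜ # n)
        ; (E₃ c) → zeroˡ (w^- n i c) ; (E₄ c) → zeroˡ (w^- n i c)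
        }
    ; P-r₂r₂       = λ
        { E₀ → quadratic-E₀ n v k ; E₁ → quadratic-E₁ n v k
        ; E₂₁ → quadratic-E₂ n v k s (ℕₚ.<⇒≤ k<v) s² ; E₂₂ → quadratic-E₂₂ n v k s (ℕₚ.<⇒≤ k<v) s²
        ; (E₃ c) → quadratic-E₃ n v k (√k n v k) (w^- n (0ₙ n) c) √k² (w^-0 c)
        ; (E₄ c) → quadratic-E₄ n v k (√k n v k) (w^- n (0ₙ n) c) √k² (w^-0 c)
        }
    }
    where
    side : Rel₂ n → Bool
    side (A₀ _) = true
    side A₁     = true
    side (A₂ _) = false
    side A₃     = false
    s : ℂ
    s = √[k[v-k]/[v-1]] n v k 2≤v
    s² : (s *ᶜ s) *ᶜ # (v ∸ 1) ≈ᶜ # (k ℕ.* (v ∸ k))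
    s² = √-/ (k ℕ.* (v ∸ k)) (v ∸ 1) {{<⇒∸-nonZero 2≤v}}

open import Data.Nat.Base using (_*_)

theorem10 : (n v k : ℕ) .{{_ : NonZero n}} .{{_ : NonZero k}} (2≤v : 2 ≤ v) → k ≤ v →
    (k ≡ v × SchemeWithEigenmatrices (A₀ (0ₙ n)) E₀ (P₁ n v k) (Q₁ n v k))
      ⊎ (Σ[ k<v ∈ k < v ] SchemeWithEigenmatrices (A₀ (0ₙ n)) E₀ (P₂ n v k 2≤v) (Q₂ n v k k<v)) →
    ∃[ W ] IsBGW n v k ((+ (k * (k ∸ 1)) / (v ∸ 1)) {{<⇒∸-nonZero 2≤v}}) W
theorem10 n v k 2≤v _ (inj₁ (k≡v , S)) = counts⇒BGW 2≤v counts point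
  where open FromScheme S (Tables.facts₁ n v k k≡v) refl
theorem10 n v k 2≤v _ (inj₂ (k<v , S)) = counts⇒BGW 2≤v counts point
  where open FromScheme S (Tables.facts₂ n v k 2≤v k<v) refl
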